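{- For every integer $k\geq 3$ there exist an integer $n_1=n_1(k)$ and a constant $C=C(k)$ such that for every $n\geq n_1$ and every $I\in[n]^{(k-1)}$ with $1\in I$ there exists a partial Steiner $(k,k-1)$-system $H$ on $n^{C}$ vertices such that every linear ordering of $V(H)$ contains an ordered subhypergraph isomorphic to a member of $\mathcal{G}_I^{(k)}(n)$, and every linear ordering of $V(H)$ contains an ordered subhypergraph isomorphic to a member of $\mathrm{rev}\,\mathcal{G}_I^{(k)}(n)$.
   Context: A $k$-graph $H$ is a partial Steiner $(k,\ell)$-system if every $\ell$-subset of $V(H)$ lies in at most one edge. An ordered $k$-graph is a $k$-graph with a linear order on its vertices; isomorphism of ordered $k$-graphs means order-preserving isomorphism. For $I\in[n]^{(k-1)}$ with $1\in I$ let $\Omega_I=\{2,\dots,n\}^{(k-1)}\cup\{I\}$. $\mathcal{G}_I^{(k)}(n)$ is the family of ordered $k$-graphs $(G,<)$ with vertex set consisting of distinct points $\{x_J:J\in\Omega_I\}\cup\{x_1,\dots,x_n\}$, edge set $\{\{x_J\}\cup\{x_j:j\in J\}:J\in\Omega_I\}$, and an ordering satisfying $x_I<x_J<x_1<x_2<\dots<x_n$ for all $J\in\Omega_I\setminus\{I\}$ (the $x_J$, $J\neq I$, ordered arbitrarily among themselves). $\mathrm{rev}\,\mathcal{G}_I^{(k)}(n)$ consists of the same hypergraphs with the reversed orders. -}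

module Defs where

open import Data.Nat using (ℕ; zero; suc; _∸_)
open import Data.Bool using (Bool; true; false; if_then_else_)
open import Data.Fin using (Fin; zero; suc; _<_)
open import Data.Fin.Subset using (Subset; ⁅_⁆; _∪_; ⊥; ∣_∣; _⊆_)
open import Data.Vec using ([]; _∷_)
open import Data.Product using (Σ; _×_)
open import Data.Sum using (_⊎_)
open import Relation.Nullary using (¬_)
open import Relation.Binary.PropositionalEquality using (_≡_)

record KGraph (k N : ℕ) : Set₁ where
  field
    Edge    : Subset N → Set
    uniform : ∀ e → Edge e → ∣ e ∣ ≡ k
open KGraph public

PartialSteiner : ∀ {k N} → ℕ → KGraph k N → Set
PartialSteiner {k} {N} ℓ H =
  ∀ (e f S : Subset N) → Edge H e → Edge H f →
    ∣ S ∣ ≡ ℓ → S ⊆ e → S ⊆ f → e ≡ f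

img : ∀ {n N} → (Fin n → Fin N) → Subset n → Subset N
img {zero}  f []      = ⊥
img {suc n} f (b ∷ J) = (if b then ⁅ f zero ⁆ else ⊥) ∪ img (λ i → f (suc i)) J

-- "1 ∈ J" (the element 1 of [n] is represented by zero : Fin n).
HasOne : ∀ {n} → Subset n → Set
HasOne {zero}  []      = false ≡ true
HasOne {suc n} (b ∷ _) = b ≡ true

InΩ : ∀ {n} → ℕ → Subset n → Subset n → Set
InΩ k I J = (∣ J ∣ ≡ k ∸ 1 × ¬ HasOne J) ⊎ J ≡ I

-- The ordered k-graph (H , ≺) contains, as an ordered subhypergraph, a member of
-- 𝒢_I^{(k)}(n): distinct vertices x_J (J ∈ Ω_I) and y_1,…,y_n (y j = x_{j+1})
-- of H such that every {x_J} ∪ {x_j : j ∈ J} is an edge of H, and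
-- x_I ≺ x_J ≺ x_1 ≺ x_2 ≺ … ≺ x_n for J ∈ Ω_I ∖ {I}.
ContainsG : ∀ {k N} → (H : KGraph k N) → (Fin N → Fin N → Set) →
            (n : ℕ) → Subset n → Set
ContainsG {k} {N} H _≺_ n I =
  Σ (Subset n → Fin N) λ x → Σ (Fin n → Fin N) λ y →
    (∀ J J′ → InΩ k I J → InΩ k I J′ → x J ≡ x J′ → J ≡ J′) ×
    (∀ i j → y i ≡ y j → i ≡ j) ×
    (∀ J j → InΩ k I J → ¬ (x J ≡ y j)) ×
    (∀ J → InΩ k I J → Edge H (⁅ x J ⁆ ∪ img y J)) ×
    (∀ J → InΩ k I J → ¬ (J ≡ I) → x I ≺ x J) ×
    (∀ J j → InΩ k I J → x J ≺ y j) ×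
    (∀ i j → i < j → y i ≺ y j)

{-# OPTIONS --safe #-}

-- The vertices are three copies of the plane K², where K is a finite field of characteristic 2 and
-- polynomial size.  An edge consists of k − 1 points (xⱼ , yⱼ) of one copy with distinct yⱼ and the point
-- (m , w) of the next copy, m ≢ 0, such that m and w are the divided differences of x and of x y at the
-- nodes y.  If p and q interpolate x and x y, the nodes are exactly the roots of t p(t) − q(t), a
-- polynomial of degree k − 1 with leading coefficient m; so any k − 2 of the points together with (m , w)
-- determine the last one, and H is a partial Steiner system.
--
-- Fixing k − 3 of the points is a Newton step that reduces everything to k = 3, where (m , w) is
-- characterised by x = m y′ + w and x′ = m y + w.  Four such lines of generic slope close up to exactly
-- one 4-cycle, so two applications of Cauchy–Schwarz show that this system is pseudorandom: sets A and B
-- of points of polynomially small density span about the expected number of edges with (m , w) in a given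
-- set U.
--
-- Given an ordering, cut each copy at its n σ largest vertices and choose the copy whose cut is highest.
-- All but n σ vertices of the next copy lie below all of these large vertices.  Take the vertices y j of
-- ContainsG from n consecutive slices of σ large vertices; by pseudorandomness an averaging argument finds
-- y 2, …, y n for which all x J, J ≢ I, are distinct and avoid the n σ largest and the σ smallest vertices
-- of the next copy, while some y 1 in the first slice puts x I among the σ smallest ones.
module Submission where

-- The obstacle is the condition x I ≺ x J. Landing among the `σ` smallest vertices of a copy is
-- rare, so plain averaging over all points cannot produce it. But `I` is the only index that
-- contains 1: y 1 occurs in no other edge and can be chosen last. The discrepancy bound shows that
-- for most choices of the other points of `I` some y 1 in its slice works, and this existential
-- event is common enough to be averaged with the rest.
--
-- The apex has two coordinates because a missing point has two unknown ones. The condition m ≢ 0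
-- keeps the polynomial whose roots are the nodes from losing degree. With only two copies, edges of
-- opposite direction could share the pair of their apexes, which for k = 3 would break the Steiner
-- property.
--
-- Characteristic 2 removes all signs and makes the fields explicit: each Artin-Schreier extension
-- hands on the parameter of the next one, orders get squared, and some order lies between X and X²;
-- this affects only the exponent C.
--
-- The reversed half of the theorem is free, because H is fixed before the ordering and a reversed
-- linear order is again one.

-- Finite sums, indicator functions and counting over finite types.

module FiniteSums where

  open import Algebra.Structures using (IsCommutativeSemiring)
  import Data.Bool as Bool
  open import Data.Bool using (Bool; true; false; not; _∧_)
  open import Data.List using (List; []; _∷_; _++_; map; length; cartesianProduct)
  open import Data.List.Properties using (length-++; length-map)
  open import Data.Nat using (ℕ; _+_; _*_; _≤_; z≤n; s≤s)
  open import Data.Nat.Properties hiding (_≟_)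
  open import Data.Product using (∃; _×_; _,_)
  open import Data.Sum using (_⊎_; inj₁; inj₂)
  open import Relation.Binary.Definitions using (DecidableEquality)
  open import Relation.Binary.PropositionalEquality
  open import Relation.Nullary using (Dec; yes; no; does; ¬_)
  open import Relation.Nullary.Decidable using (map′; _×-dec_; dec-true)

  -- Kept general because the sums are needed twice: over ℕ for counting, and over ℤ for the signed
  -- weights in the Cauchy-Schwarz argument.
  module Summation {R : Set} (_⊕_ _⊗_ : R → R → R) (0# 1# : R)
                   (isCS : IsCommutativeSemiring _≡_ _⊕_ _⊗_ 0# 1#) where
    open IsCommutativeSemiring isCS
      using (distribˡ)
      renaming (+-assoc to ⊕-assoc; +-comm to ⊕-comm; +-identityˡ to ⊕-idˡ; *-comm to ⊗-comm; zeroʳ to ⊗-zeroʳ)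

    ∑ : {A : Set} → List A → (A → R) → R
    ∑ []       f = 0#
    ∑ (x ∷ xs) f = f x ⊕ ∑ xs f

    ∑-cong : {A : Set} (xs : List A) {f g : A → R} → (∀ x → f x ≡ g x) → ∑ xs f ≡ ∑ xs g
    ∑-cong []       eq = refl
    ∑-cong (x ∷ xs) eq = cong₂ _⊕_ (eq x) (∑-cong xs eq)

    ∑-0 : {A : Set} (xs : List A) → ∑ xs (λ _ → 0#) ≡ 0#
    ∑-0 []       = refl
    ∑-0 (x ∷ xs) = trans (⊕-idˡ _) (∑-0 xs)

    interchange : ∀ a b c d → (a ⊕ b) ⊕ (c ⊕ d) ≡ (a ⊕ c) ⊕ (b ⊕ d)
    interchange a b c d = begin
      (a ⊕ b) ⊕ (c ⊕ d) ≡⟨ ⊕-assoc a b _ ⟩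
      a ⊕ (b ⊕ (c ⊕ d)) ≡⟨ cong (a ⊕_) (⊕-assoc b c d) ⟨
      a ⊕ ((b ⊕ c) ⊕ d) ≡⟨ cong (λ z → a ⊕ (z ⊕ d)) (⊕-comm b c) ⟩
      a ⊕ ((c ⊕ b) ⊕ d) ≡⟨ cong (a ⊕_) (⊕-assoc c b d) ⟩
      a ⊕ (c ⊕ (b ⊕ d)) ≡⟨ ⊕-assoc a c _ ⟨
      (a ⊕ c) ⊕ (b ⊕ d) ∎
      where open ≡-Reasoning

    ∑-+ : {A : Set} (xs : List A) {f g : A → R} → ∑ xs (λ x → f x ⊕ g x) ≡ ∑ xs f ⊕ ∑ xs g
    ∑-+ []       = sym (⊕-idˡ 0#)
    ∑-+ (x ∷ xs) {f} {g} = trans (cong ((f x ⊕ g x) ⊕_) (∑-+ xs)) (interchange (f x) (g x) _ _)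

    ∑-*ˡ : {A : Set} (xs : List A) (a : R) {f : A → R} → ∑ xs (λ x → a ⊗ f x) ≡ a ⊗ ∑ xs f
    ∑-*ˡ []       a     = sym (⊗-zeroʳ a)
    ∑-*ˡ (x ∷ xs) a {f} = trans (cong ((a ⊗ f x) ⊕_) (∑-*ˡ xs a)) (sym (distribˡ a _ _))

    ∑-*ʳ : {A : Set} (xs : List A) (a : R) {f : A → R} → ∑ xs (λ x → f x ⊗ a) ≡ ∑ xs f ⊗ a
    ∑-*ʳ xs a {f} = trans (∑-cong xs (λ x → ⊗-comm (f x) a)) (trans (∑-*ˡ xs a) (⊗-comm a _))

    ∑-swap : {A B : Set} (xs : List A) (ys : List B) {f : A → B → R} →
             ∑ xs (λ x → ∑ ys (f x)) ≡ ∑ ys (λ y → ∑ xs (λ x → f x y))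
    ∑-swap []       ys     = sym (∑-0 ys)
    ∑-swap (x ∷ xs) ys {f} = trans (cong (∑ ys (f x) ⊕_) (∑-swap xs ys)) (sym (∑-+ ys))

    ∑-++ : {A : Set} (xs ys : List A) {f : A → R} → ∑ (xs ++ ys) f ≡ ∑ xs f ⊕ ∑ ys f
    ∑-++ []       ys     = sym (⊕-idˡ _)
    ∑-++ (x ∷ xs) ys {f} = trans (cong (f x ⊕_) (∑-++ xs ys)) (sym (⊕-assoc (f x) _ _))

    ∑-map : {A B : Set} (h : A → B) (xs : List A) {f : B → R} → ∑ (map h xs) f ≡ ∑ xs (λ x → f (h x))
    ∑-map h []           = refl
    ∑-map h (x ∷ xs) {f} = cong (f (h x) ⊕_) (∑-map h xs)

    ∑-× : {A B : Set} (xs : List A) (ys : List B) {f : A × B → R} →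
          ∑ (cartesianProduct xs ys) f ≡ ∑ xs (λ x → ∑ ys (λ y → f (x , y)))
    ∑-× []       ys     = refl
    ∑-× (x ∷ xs) ys {f} = trans (∑-++ (map (x ,_) ys) (cartesianProduct xs ys))
                                (cong₂ _⊕_ (∑-map (x ,_) ys) (∑-× xs ys))

    ∑-∑* : {A B : Set} (xs : List A) (ys : List B) {f : A → R} {g : B → R} →
           ∑ xs (λ x → ∑ ys (λ y → f x ⊗ g y)) ≡ ∑ xs f ⊗ ∑ ys g
    ∑-∑* xs ys {f} {g} = trans (∑-cong xs (λ x → ∑-*ˡ ys (f x))) (∑-*ʳ xs (∑ ys g))

  open Summation _+_ _*_ 0 1 +-*-isCommutativeSemiring public

  ∑-mono : {A : Set} (xs : List A) {f g : A → ℕ} → (∀ x → f x ≤ g x) → ∑ xs f ≤ ∑ xs g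
  ∑-mono []       le = z≤n
  ∑-mono (x ∷ xs) le = +-mono-≤ (le x) (∑-mono xs le)

  ∑-const : {A : Set} (xs : List A) (c : ℕ) → ∑ xs (λ _ → c) ≡ length xs * c
  ∑-const []       c = refl
  ∑-const (x ∷ xs) c = cong (c +_) (∑-const xs c)

  ⟦_⟧ : Bool → ℕ
  ⟦ true  ⟧ = 1
  ⟦ false ⟧ = 0

  ⟦⟧≤1 : ∀ b → ⟦ b ⟧ ≤ 1
  ⟦⟧≤1 true  = s≤s z≤n
  ⟦⟧≤1 false = z≤n

  ⟦∧⟧ : ∀ a b → ⟦ a ∧ b ⟧ ≡ ⟦ a ⟧ * ⟦ b ⟧
  ⟦∧⟧ true  b = sym (+-identityʳ _)
  ⟦∧⟧ false b = refl

  ⟦⟧-mono : ∀ {a b} → (a ≡ true → b ≡ true) → ⟦ a ⟧ ≤ ⟦ b ⟧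
  ⟦⟧-mono {true}  imp rewrite imp refl = ≤-refl
  ⟦⟧-mono {false} imp = z≤n

  ∧-true : ∀ {a b} → a ∧ b ≡ true → a ≡ true × b ≡ true
  ∧-true {true} {true} _ = refl , refl

  ∧-intro : ∀ {a b} → a ≡ true → b ≡ true → a ∧ b ≡ true
  ∧-intro refl refl = refl

  not-true : ∀ {a} → not a ≡ true → a ≡ false
  not-true {false} _ = refl

  does-true : {P : Set} (d : Dec P) → does d ≡ true → P
  does-true (yes p) _ = p

  does-false : {P : Set} (d : Dec P) → does d ≡ false → ¬ P
  does-false (no ¬p) _ = ¬p

  -- Summation identities over a finite type all follow from `once`.
  record Finite (A : Set) : Set where
    infix 4 _≟_
    field
      elems : List A
      _≟_   : DecidableEquality A
      once  : ∀ a → ∑ elems (λ x → ⟦ does (x ≟ a) ⟧) ≡ 1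

    size : ℕ
    size = length elems

    count : (A → Bool) → ℕ
    count P = ∑ elems (λ x → ⟦ P x ⟧)

    count≤size : ∀ P → count P ≤ size
    count≤size P = ≤-trans (∑-mono elems (λ x → ⟦⟧≤1 (P x))) (≤-reflexive (trans (∑-const elems 1) (*-identityʳ size)))

    ∑-1 : ∑ elems (λ _ → 1) ≡ size
    ∑-1 = trans (∑-const elems 1) (*-identityʳ size)

    ∑-pick : ∀ a (f : A → ℕ) → ∑ elems (λ x → ⟦ does (x ≟ a) ⟧ * f x) ≡ f a
    ∑-pick a f = begin
      ∑ elems (λ x → ⟦ does (x ≟ a) ⟧ * f x) ≡⟨ ∑-cong elems pointwise ⟩
      ∑ elems (λ x → ⟦ does (x ≟ a) ⟧ * f a) ≡⟨ ∑-*ʳ elems (f a) ⟩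
      count (λ x → does (x ≟ a)) * f a       ≡⟨ cong (_* f a) (once a) ⟩
      1 * f a                                ≡⟨ *-identityˡ (f a) ⟩
      f a ∎
      where
      open ≡-Reasoning
      pointwise : ∀ x → ⟦ does (x ≟ a) ⟧ * f x ≡ ⟦ does (x ≟ a) ⟧ * f a
      pointwise x with x ≟ a
      ... | yes refl = refl
      ... | no  _    = refl

    ∑-term : ∀ a (f : A → ℕ) → f a ≤ ∑ elems f
    ∑-term a f = ≤-trans (≤-reflexive (sym (∑-pick a f)))
      (∑-mono elems (λ x → ≤-trans (*-monoˡ-≤ (f x) (⟦⟧≤1 (does (x ≟ a)))) (≤-reflexive (*-identityˡ (f x)))))

  open Finite public using (size; count)

  search : {A : Set} (xs : List A) (P : A → Bool) →
           ∑ xs (λ x → ⟦ P x ⟧) ≡ 0 ⊎ ∃ λ x → P x ≡ true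
  search []       P = inj₁ refl
  search (x ∷ xs) P with P x in eq
  ... | true  = inj₂ (x , eq)
  ... | false = search xs P

  module _ {A : Set} (F : Finite A) where
    open Finite F hiding (size; count)

    count-unique : (P : A → Bool) → (∀ x y → P x ≡ true → P y ≡ true → x ≡ y) → count F P ≤ 1
    count-unique P uniq with search elems P
    ... | inj₁ eq       = ≤-trans (≤-reflexive eq) z≤n
    ... | inj₂ (a , Pa) = ≤-trans
      (∑-mono elems (λ x → ⟦⟧-mono (λ Px → dec-true (x ≟ a) (uniq x a Px Pa)))) (≤-reflexive (once a))

    count-exists : (P : A → Bool) (a : A) → P a ≡ true → 1 ≤ count F P
    count-exists P a Pa = ≤-trans (≤-reflexive (cong ⟦_⟧ (sym Pa))) (∑-term a (λ x → ⟦ P x ⟧))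

    count-cong : {P Q : A → Bool} → (∀ x → P x ≡ Q x) → count F P ≡ count F Q
    count-cong eq = ∑-cong elems (λ x → cong ⟦_⟧ (eq x))

    count-split : (P Q : A → Bool) →
      count F P ≡ count F (λ x → P x ∧ Q x) + count F (λ x → P x ∧ not (Q x))
    count-split P Q = trans (∑-cong elems λ x → pointwise (P x) (Q x)) (∑-+ elems)
      where
      pointwise : ∀ a b → ⟦ a ⟧ ≡ ⟦ a ∧ b ⟧ + ⟦ a ∧ not b ⟧
      pointwise true  true  = refl
      pointwise true  false = refl
      pointwise false b     = refl

    -- Double counting: the fibres of `π` partition the elements satisfying `P`, and each fibre
    -- contains at most one of them.
    count-injection : {B : Set} (G : Finite B) (P : A → Bool) (π : A → B) →
      (∀ x y → P x ≡ true → P y ≡ true → π x ≡ π y → x ≡ y) → count F P ≤ size G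
    count-injection G P π inj = begin
      ∑ elems (λ x → ⟦ P x ⟧)
        ≡⟨ ∑-cong elems (λ x → Finite.∑-pick G (π x) (λ _ → ⟦ P x ⟧)) ⟨
      ∑ elems (λ x → ∑ G.elems (λ y → ⟦ does (y G.≟ π x) ⟧ * ⟦ P x ⟧))
        ≡⟨ ∑-swap elems G.elems ⟩
      ∑ G.elems (λ y → ∑ elems (λ x → ⟦ does (y G.≟ π x) ⟧ * ⟦ P x ⟧))
        ≡⟨ ∑-cong G.elems (λ y → ∑-cong elems (λ x → sym (⟦∧⟧ (does (y G.≟ π x)) (P x)))) ⟩
      ∑ G.elems (λ y → count F (λ x → does (y G.≟ π x) ∧ P x))
        ≤⟨ ∑-mono G.elems (λ y → count-unique _ (λ x x′ p p′ →
             let (e , q) = ∧-true p ; (e′ , q′) = ∧-true p′ in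
             inj x x′ q q′ (trans (sym (does-true (y G.≟ π x) e)) (does-true (y G.≟ π x′) e′)))) ⟩
      ∑ G.elems (λ _ → 1)
        ≡⟨ Finite.∑-1 G ⟩
      size G ∎
      where
      module G = Finite G
      open ≤-Reasoning

  finite-× : {A B : Set} → Finite A → Finite B → Finite (A × B)
  finite-× F G = record
    { elems = cartesianProduct F.elems G.elems
    ; _≟_   = λ { (a , b) (c , d) → map′ (λ { (refl , refl) → refl }) (λ { refl → refl , refl }) (a F.≟ c ×-dec b G.≟ d) }
    ; once  = λ { (a , b) → trans (∑-× F.elems G.elems)
        (trans (∑-cong F.elems λ x → trans (∑-cong G.elems λ y → ⟦∧⟧ (does (x F.≟ a)) _) (∑-*ˡ G.elems ⟦ does (x F.≟ a) ⟧))
        (trans (∑-cong F.elems λ x → trans (cong (⟦ does (x F.≟ a) ⟧ *_) (G.once b)) (*-identityʳ _)) (F.once a))) }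
    }
    where
    module F = Finite F
    module G = Finite G

  length-cartesianProduct : {A B : Set} (xs : List A) (ys : List B) →
                            length (cartesianProduct xs ys) ≡ length xs * length ys
  length-cartesianProduct []       ys = refl
  length-cartesianProduct (x ∷ xs) ys = trans (length-++ (map (x ,_) ys))
    (cong₂ _+_ (length-map (x ,_) ys) (length-cartesianProduct xs ys))

  finite-Bool : Finite Bool
  finite-Bool = record
    { elems = true ∷ false ∷ []
    ; _≟_   = Bool._≟_
    ; once  = λ { true → refl ; false → refl }
    }

-- Finite fields of characteristic 2, as a tower of quadratic extensions.

module BinaryFields where

  open import Algebra.Bundles using (RawRing; CommutativeSemiring)
  import Algebra.Solver.Ring
  open import Algebra.Solver.Ring.AlmostCommutativeRing using (_-Raw-AlmostCommutative⟶_; fromCommutativeSemiring)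
  open import Data.Bool using (Bool; true; false; _∧_; _xor_)
  open import Data.Empty using (⊥-elim)
  open import Data.Maybe using (Maybe; just; nothing)
  import Data.Nat as ℕ
  open import Data.Nat using (ℕ; zero; suc; _≤_; z≤n; s≤s)
  import Data.Nat.Properties as ℕₚ
  open import Data.Product using (Σ; ∃; _×_; _,_; proj₁; proj₂)
  open import Data.Sum using (_⊎_; inj₁; inj₂)
  open import Level using (0ℓ)
  open import Relation.Binary.PropositionalEquality
  open import Relation.Nullary using (yes; no)
  open FiniteSums

  record BinaryField : Set₁ where
    infixl 6 _+_
    infixl 7 _*_
    field
      K        : Set
      finite   : Finite K
      _+_ _*_  : K → K → K
      0# 1#    : K
      inv      : K → K
      +-assoc  : ∀ x y z → (x + y) + z ≡ x + (y + z)
      +-comm   : ∀ x y → x + y ≡ y + x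
      +-idˡ    : ∀ x → 0# + x ≡ x
      +-self   : ∀ x → x + x ≡ 0#
      *-assoc  : ∀ x y z → (x * y) * z ≡ x * (y * z)
      *-comm   : ∀ x y → x * y ≡ y * x
      *-idˡ    : ∀ x → 1# * x ≡ x
      distribˡ : ∀ x y z → x * (y + z) ≡ x * y + x * z
      inv-*    : ∀ x → x ≢ 0# → inv x * x ≡ 1#
      1≢0      : 1# ≢ 0#

  module FieldTheory (F : BinaryField) where
    open BinaryField F public
    open Finite finite public using (_≟_)

    *-zeroʳ : ∀ x → x * 0# ≡ 0#
    *-zeroʳ x = begin
      x * 0#              ≡⟨ cong (x *_) (+-self 0#) ⟨
      x * (0# + 0#)       ≡⟨ distribˡ x 0# 0# ⟩
      x * 0# + x * 0#     ≡⟨ +-self (x * 0#) ⟩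
      0#                  ∎
      where open ≡-Reasoning

    private
      commutativeSemiring : CommutativeSemiring 0ℓ 0ℓ
      commutativeSemiring = record
        { Carrier = K ; _≈_ = _≡_ ; _+_ = _+_ ; _*_ = _*_ ; 0# = 0# ; 1# = 1#
        ; isCommutativeSemiring = record
          { isSemiring = record
            { isSemiringWithoutAnnihilatingZero = record
              { +-isCommutativeMonoid = record
                { isMonoid = record
                  { isSemigroup = record
                    { isMagma = record { isEquivalence = isEquivalence ; ∙-cong = cong₂ _+_ }
                    ; assoc = +-assoc }
                  ; identity = +-idˡ , λ x → trans (+-comm x 0#) (+-idˡ x) }
                ; comm = +-comm }
              ; *-cong = cong₂ _*_
              ; *-assoc = *-assoc
              ; *-identity = *-idˡ , λ x → trans (*-comm x 1#) (*-idˡ x)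
              ; distrib = distribˡ , λ x y z → trans (*-comm (y + z) x)
                  (trans (distribˡ x y z) (cong₂ _+_ (*-comm x y) (*-comm x z))) }
            ; zero = (λ x → trans (*-comm 0# x) (*-zeroʳ x)) , *-zeroʳ }
          ; *-comm = *-comm } }

      𝔽₂ : RawRing 0ℓ 0ℓ
      𝔽₂ = record { Carrier = Bool ; _≈_ = _≡_ ; _+_ = _xor_ ; _*_ = _∧_ ; -_ = λ b → b ; 0# = false ; 1# = true }

      fromBool : Bool → K
      fromBool false = 0#
      fromBool true  = 1#

      morphism : 𝔽₂ -Raw-AlmostCommutative⟶ fromCommutativeSemiring commutativeSemiring
      morphism = record
        { ⟦_⟧ = fromBool
        ; +-homo = λ { false y → sym (+-idˡ (fromBool y)) ; true false → sym (trans (+-comm 1# 0#) (+-idˡ 1#)) ; true true → sym (+-self 1#) }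
        ; *-homo = λ { false y → sym (trans (*-comm 0# (fromBool y)) (*-zeroʳ (fromBool y))) ; true y → sym (*-idˡ (fromBool y)) }
        ; -‿homo = λ _ → refl
        ; 0-homo = refl
        ; 1-homo = refl
        }

      weaklyDecide : (a b : Bool) → Maybe (fromBool a ≡ fromBool b)
      weaklyDecide false false = just refl
      weaklyDecide true  true  = just refl
      weaklyDecide _     _     = nothing

    -- Coefficients in 𝔽₂, so that the solver knows x + x ≡ 0.
    module Solver = Algebra.Solver.Ring 𝔽₂ (fromCommutativeSemiring commutativeSemiring) morphism
      weaklyDecide
    open Solver public using (solve; _:=_; _:+_; _:*_; con)

    +-idʳ : ∀ x → x + 0# ≡ x
    +-idʳ x = trans (+-comm x 0#) (+-idˡ x)

    *-zeroˡ : ∀ x → 0# * x ≡ 0#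
    *-zeroˡ x = trans (*-comm 0# x) (*-zeroʳ x)

    ≡⇒+≡0 : ∀ {x y} → x ≡ y → x + y ≡ 0#
    ≡⇒+≡0 {x} refl = +-self x

    abstract
      +≡0⇒≡ : ∀ {x y} → x + y ≡ 0# → x ≡ y
      +≡0⇒≡ {x} {y} eq = begin
        x             ≡⟨ solve 2 (λ x y → x := (x :+ y) :+ y) refl x y ⟩
        (x + y) + y   ≡⟨ cong (_+ y) eq ⟩
        0# + y        ≡⟨ +-idˡ y ⟩
        y             ∎
        where open ≡-Reasoning

    abstract
      +-cancelˡ : ∀ a {x y} → a + x ≡ a + y → x ≡ y
      +-cancelˡ a {x} {y} eq = +≡0⇒≡ (trans (solve 3 (λ a x y → x :+ y := (a :+ x) :+ (a :+ y)) refl a x y) (≡⇒+≡0 eq))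

    abstract
      *-cancelˡ : ∀ {a x y} → a ≢ 0# → a * x ≡ a * y → x ≡ y
      *-cancelˡ {a} {x} {y} a≢0 eq = begin
        x                 ≡⟨ step x ⟩
        inv a * (a * x)   ≡⟨ cong (inv a *_) eq ⟩
        inv a * (a * y)   ≡⟨ step y ⟨
        y                 ∎
        where
        open ≡-Reasoning
        step : ∀ z → z ≡ inv a * (a * z)
        step z = trans (sym (*-idˡ z)) (trans (cong (_* z) (sym (inv-* a a≢0))) (*-assoc (inv a) a z))

    abstract
      *≡0⇒ : ∀ {a x} → a ≢ 0# → a * x ≡ 0# → x ≡ 0#
      *≡0⇒ {a} a≢0 eq = *-cancelˡ a≢0 (trans eq (sym (*-zeroʳ a)))

    *≢0 : ∀ {a x} → a ≢ 0# → x ≢ 0# → a * x ≢ 0#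
    *≢0 a≢0 x≢0 eq = x≢0 (*≡0⇒ a≢0 eq)

    inv≢0 : ∀ {a} → a ≢ 0# → inv a ≢ 0#
    inv≢0 {a} a≢0 eq = 1≢0 (trans (sym (inv-* a a≢0)) (trans (cong (_* a) eq) (*-zeroˡ a)))

    +≢0 : ∀ {x y} → x ≢ y → x + y ≢ 0#
    +≢0 x≢y eq = x≢y (+≡0⇒≡ eq)

  -- Irreducibility of x² + x + t: in characteristic 2 a root of this polynomial is exactly a
  -- solution of y² + y = t.
  NotArtinSchreier : (F : BinaryField) → BinaryField.K F → Set
  NotArtinSchreier F t = ∀ y → y * y + y ≢ t
    where open BinaryField F

  -- K[x] / (x² + x + t); the pair (u , v) is u + v x.
  module Extension (F : BinaryField) (t : BinaryField.K F) (nas : NotArtinSchreier F t) where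
    open FieldTheory F

    L : Set
    L = K × K

    infixl 6 _⊕_
    infixl 7 _⊗_
    _⊕_ _⊗_ : L → L → L
    (a , b) ⊕ (c , d) = (a + c) , (b + d)
    (a , b) ⊗ (c , d) = (a * c + b * d * t) , (a * d + b * c + b * d)

    -- The field norm: the conjugate of a + b x is (a + b) + b x, and the product of the two is a² +
    -- a b + b² t.
    norm : L → K
    norm (a , b) = a * a + a * b + b * b * t

    -- For b ≢ 0 the quotient norm / b² is (a / b)² + a / b + t, so a vanishing norm would make `t`
    -- an Artin-Schreier value. For b ≡ 0 the norm is a².
    norm≢0 : ∀ u → u ≢ (0# , 0#) → norm u ≢ 0#
    norm≢0 (a , b) u≢0 eq with b ≟ 0#
    ... | no b≢0 = nas (inv b * a) (begin
            (inv b * a) * (inv b * a) + inv b * a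
              ≡⟨ expand ⟩
            inv b * inv b * (a * a) + inv b * (inv b * b) * a
              ≡⟨ solve 4 (λ i a b t → i :* i :* (a :* a) :+ i :* (i :* b) :* a :=
                   i :* i :* (a :* a :+ a :* b :+ b :* b :* t) :+ (i :* b) :* (i :* b) :* t) refl (inv b) a b t ⟩
            inv b * inv b * norm (a , b) + (inv b * b) * (inv b * b) * t
              ≡⟨ cong₂ (λ n o → inv b * inv b * n + o * o * t) eq (inv-* b b≢0) ⟩
            inv b * inv b * 0# + 1# * 1# * t
              ≡⟨ solve 2 (λ i t → i :* i :* con false :+ con true :* con true :* t := t) refl (inv b) t ⟩
            t ∎)
      where
      open ≡-Reasoning
      expand : (inv b * a) * (inv b * a) + inv b * a ≡ inv b * inv b * (a * a) + inv b * (inv b * b) * a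
      expand = cong₂ _+_ (solve 2 (λ i a → (i :* a) :* (i :* a) := i :* i :* (a :* a)) refl (inv b) a)
        (trans (sym (*-idˡ (inv b * a))) (trans (cong (_* (inv b * a)) (sym (inv-* b b≢0)))
          (solve 3 (λ i b a → i :* b :* (i :* a) := i :* (i :* b) :* a) refl (inv b) b a)))
    ... | yes refl with a ≟ 0#
    ...   | yes refl = u≢0 refl
    ...   | no a≢0   = *≢0 a≢0 a≢0 (trans (solve 2 (λ a t → a :* a := a :* a :+ a :* con false :+ con false :* con false :* t) refl a t) eq)

    -- The conjugate divided by the norm.
    inverse : L → L
    inverse (a , b) = (inv (norm (a , b)) * (a + b)) , (inv (norm (a , b)) * b)

    extension : BinaryField
    extension = record
      { K = L ; finite = finite-× finite finite ; _+_ = _⊕_ ; _*_ = _⊗_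
      ; 0# = 0# , 0# ; 1# = 1# , 0# ; inv = inverse
      ; +-assoc = λ { (a , b) (c , d) (e , f) → cong₂ _,_ (+-assoc a c e) (+-assoc b d f) }
      ; +-comm = λ { (a , b) (c , d) → cong₂ _,_ (+-comm a c) (+-comm b d) }
      ; +-idˡ = λ { (a , b) → cong₂ _,_ (+-idˡ a) (+-idˡ b) }
      ; +-self = λ { (a , b) → cong₂ _,_ (+-self a) (+-self b) }
      ; *-assoc = λ { (a , b) (c , d) (e , f) → cong₂ _,_
          (solve 7 (λ a b c d e f t →
            (a :* c :+ b :* d :* t) :* e :+ (a :* d :+ b :* c :+ b :* d) :* f :* t :=
            a :* (c :* e :+ d :* f :* t) :+ b :* (c :* f :+ d :* e :+ d :* f) :* t) refl a b c d e f t)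
          (solve 7 (λ a b c d e f t →
            (a :* c :+ b :* d :* t) :* f :+ (a :* d :+ b :* c :+ b :* d) :* e :+ (a :* d :+ b :* c :+ b :* d) :* f :=
            a :* (c :* f :+ d :* e :+ d :* f) :+ b :* (c :* e :+ d :* f :* t) :+ b :* (c :* f :+ d :* e :+ d :* f)) refl a b c d e f t) }
      ; *-comm = λ { (a , b) (c , d) → cong₂ _,_
          (solve 5 (λ a b c d t → a :* c :+ b :* d :* t := c :* a :+ d :* b :* t) refl a b c d t)
          (solve 4 (λ a b c d → a :* d :+ b :* c :+ b :* d := c :* b :+ d :* a :+ d :* b) refl a b c d) }
      ; *-idˡ = λ { (a , b) → cong₂ _,_
          (solve 3 (λ a b t → con true :* a :+ con false :* b :* t := a) refl a b t)
          (solve 2 (λ a b → con true :* b :+ con false :* a :+ con false :* b := b) refl a b) }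
      ; distribˡ = λ { (a , b) (c , d) (e , f) → cong₂ _,_
          (solve 7 (λ a b c d e f t → a :* (c :+ e) :+ b :* (d :+ f) :* t :=
            (a :* c :+ b :* d :* t) :+ (a :* e :+ b :* f :* t)) refl a b c d e f t)
          (solve 6 (λ a b c d e f → a :* (d :+ f) :+ b :* (c :+ e) :+ b :* (d :+ f) :=
            (a :* d :+ b :* c :+ b :* d) :+ (a :* f :+ b :* e :+ b :* f)) refl a b c d e f) }
      ; inv-* = λ { u@(a , b) u≢0 → cong₂ _,_
          (trans (solve 4 (λ n a b t → n :* (a :+ b) :* a :+ n :* b :* b :* t := n :* (a :* a :+ a :* b :+ b :* b :* t)) refl (inv (norm u)) a b t)
                 (inv-* (norm u) (norm≢0 u u≢0)))
          (solve 3 (λ n a b → n :* (a :+ b) :* b :+ n :* b :* a :+ n :* b :* b := con false) refl (inv (norm u)) a b) }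
      ; 1≢0 = λ eq → 1≢0 (cong proj₁ eq)
      }

    -- The x-coordinate of y² + y is v² + v.
    extension-nas : NotArtinSchreier extension (0# , t)
    extension-nas (u , v) eq = nas v (trans
      (solve 2 (λ u v → v :* v :+ v := (u :* v :+ v :* u :+ v :* v) :+ v) refl u v) (cong proj₂ eq))

  𝔽₂-field : BinaryField
  𝔽₂-field = record
    { K = Bool ; finite = finite-Bool ; _+_ = _xor_ ; _*_ = _∧_ ; 0# = false ; 1# = true ; inv = λ x → x
    ; +-assoc = λ { false y z → refl ; true false z → refl ; true true false → refl ; true true true → refl }
    ; +-comm = λ { false false → refl ; false true → refl ; true false → refl ; true true → refl }
    ; +-idˡ = λ _ → refl
    ; +-self = λ { false → refl ; true → refl }
    ; *-assoc = λ { false y z → refl ; true y z → refl }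
    ; *-comm = λ { false false → refl ; false true → refl ; true false → refl ; true true → refl }
    ; *-idˡ = λ _ → refl
    ; distribˡ = λ { false y z → refl ; true y z → refl }
    ; inv-* = λ { false x≢0 → ⊥-elim (x≢0 refl) ; true _ → refl }
    ; 1≢0 = λ ()
    }

  order : BinaryField → ℕ
  order F = size (BinaryField.finite F)

  -- The orders 2^(2^m) are each the square of the preceding one.
  field-of-order-between : ∀ X → 2 ≤ X → Σ BinaryField λ F → 2 ≤ order F × X ≤ order F × order F ≤ X ℕ.* X
  field-of-order-between X 2≤X = proj₁ (go X) , proj₁ (proj₂ (proj₂ (go X))) , result (go X)
    where
    open ℕₚ.≤-Reasoning
    -- The index `j` only forces growth: at stage `X` both alternatives say `X ≤ order F`. The
    -- Artin-Schreier parameter is carried along so that the next extension exists.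
    Stage : ℕ → Set₁
    Stage j = Σ BinaryField λ F → (∃ λ t → NotArtinSchreier F t) × 2 ≤ order F × order F ≤ X ℕ.* X × (j ≤ order F ⊎ X ≤ order F)

    go : ∀ j → Stage j
    go zero = 𝔽₂-field , (true , λ { false () ; true () }) , ℕₚ.≤-refl , ℕₚ.≤-trans 2≤X (ℕₚ.m≤m*n X X {{ℕ.>-nonZero (ℕₚ.<-≤-trans (s≤s z≤n) 2≤X)}}) , inj₁ z≤n
    go (suc j) with go j
    ... | F , nas , 2≤s , s≤X² , inj₂ X≤s = F , nas , 2≤s , s≤X² , inj₂ X≤s
    ... | F , (t , nas) , 2≤s , s≤X² , inj₁ j≤s with X ℕₚ.≤? order F
    ...   | yes X≤s = F , (t , nas) , 2≤s , s≤X² , inj₂ X≤s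
    -- Only an order below `X` is ever squared, so the result stays below `X * X`.
    ...   | no  X≰s = extension , (_ , extension-nas) , 2≤s² , s²≤X² , inj₁ j<s²
      where
      open Extension F t nas
      s : ℕ
      s = order F
      sq : order extension ≡ s ℕ.* s
      sq = length-cartesianProduct (Finite.elems (BinaryField.finite F)) _
      2s≤s² : s ℕ.+ s ≤ s ℕ.* s
      2s≤s² = ℕₚ.≤-trans (ℕₚ.≤-reflexive (cong (s ℕ.+_) (sym (ℕₚ.+-identityʳ s)))) (ℕₚ.*-monoˡ-≤ s 2≤s)
      2≤s² : 2 ≤ order extension
      2≤s² = subst (2 ≤_) (sym sq) (ℕₚ.≤-trans 2≤s (ℕₚ.≤-trans (ℕₚ.m≤m+n s s) 2s≤s²))
      s²≤X² : order extension ≤ X ℕ.* X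
      s²≤X² = subst (_≤ X ℕ.* X) (sym sq) (ℕₚ.*-mono-≤ (ℕₚ.<⇒≤ (ℕₚ.≰⇒> X≰s)) (ℕₚ.<⇒≤ (ℕₚ.≰⇒> X≰s)))
      j<s² : suc j ≤ order extension
      j<s² = subst (suc j ≤_) (sym sq) (ℕₚ.≤-trans (ℕₚ.+-mono-≤ (ℕₚ.<⇒≤ 2≤s) j≤s) 2s≤s²)

    result : (S : Stage X) → X ≤ order (proj₁ S) × order (proj₁ S) ≤ X ℕ.* X
    result (_ , _ , _ , le , inj₁ ge) = ge , le
    result (_ , _ , _ , le , inj₂ ge) = ge , le

-- Polynomial interpolation and the edge relation in terms of divided differences.

module DividedDifferences where

  open import Data.Bool using (true; false)
  open import Data.Empty using (⊥-elim)
  open import Data.List using (List; []; _∷_; map; length)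
  open import Data.List.Membership.Propositional using (_∈_; find; lose)
  open import Data.List.Properties using (length-map)
  open import Data.List.Relation.Binary.Permutation.Propositional using (_↭_; prep; swap) renaming (refl to ↭-refl; trans to ↭-trans)
  open import Data.List.Relation.Binary.Permutation.Propositional.Properties using (All-resp-↭; ↭-length)
  open import Data.List.Relation.Unary.All as All using (All; []; _∷_)
  import Data.List.Relation.Unary.All.Properties as Allₚ
  open import Data.List.Relation.Unary.AllPairs using (AllPairs; []; _∷_)
  import Data.List.Relation.Unary.AllPairs.Properties as AllPairsₚ
  open import Data.List.Relation.Unary.Any as Any using (here; there)
  import Data.Nat as ℕ
  open import Data.Nat using (ℕ; zero; suc)
  import Data.Nat.Properties as ℕₚ
  open import Data.Product using (Σ; ∃; _×_; _,_; proj₁; proj₂)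
  open import Relation.Binary.PropositionalEquality
  open import Relation.Nullary using (yes; no)
  open FiniteSums
  open BinaryFields

  module Interpolation (F : BinaryField) where
    open FieldTheory F

    -- The coefficient m of tⁿ may be zero.
    IsPoly : ℕ → K → (K → K) → Set
    IsPoly zero    m f = ∀ t → f t ≡ m
    IsPoly (suc n) m f = Σ (K → K) λ g → Σ K λ b → IsPoly n m g × (∀ t → f t ≡ b + t * g t)

    poly-ext : ∀ n {m f f′} → (∀ t → f′ t ≡ f t) → IsPoly n m f → IsPoly n m f′
    poly-ext zero    eq h               = λ t → trans (eq t) (h t)
    poly-ext (suc n) eq (g , b , h , e) = g , b , h , λ t → trans (eq t) (e t)

    poly-+ : ∀ n {m m′ f f′} → IsPoly n m f → IsPoly n m′ f′ → IsPoly n (m + m′) (λ t → f t + f′ t)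
    poly-+ zero    h h′ = λ t → cong₂ _+_ (h t) (h′ t)
    poly-+ (suc n) (g , b , h , e) (g′ , b′ , h′ , e′) = _ , b + b′ , poly-+ n h h′ , λ t →
      trans (cong₂ _+_ (e t) (e′ t))
        (solve 5 (λ b b′ t g g′ → (b :+ t :* g) :+ (b′ :+ t :* g′) := (b :+ b′) :+ t :* (g :+ g′)) refl b b′ t (g t) (g′ t))

    poly-scale : ∀ n a {m f} → IsPoly n m f → IsPoly n (a * m) (λ t → a * f t)
    poly-scale zero    a h = λ t → cong (a *_) (h t)
    poly-scale (suc n) a (g , b , h , e) = _ , a * b , poly-scale n a h , λ t →
      trans (cong (a *_) (e t)) (solve 4 (λ a b t g → a :* (b :+ t :* g) := a :* b :+ t :* (a :* g)) refl a b t (g t))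

    poly-lift : ∀ n {m f} → IsPoly n m f → IsPoly (suc n) 0# f
    poly-lift zero {m} h = (λ _ → 0#) , m , (λ _ → refl) , λ t →
      trans (h t) (solve 2 (λ m t → m := m :+ t :* con false) refl m t)
    poly-lift (suc n) (g , b , h , e) = g , b , poly-lift n h , e

    poly-drop : ∀ n {f} → IsPoly (suc n) 0# f → ∃ λ m → IsPoly n m f
    poly-drop zero (g , b , h , e) = b , λ t → trans (e t)
      (trans (cong (λ z → b + t * z) (h t)) (solve 2 (λ b t → b :+ t :* con false := b) refl b t))
    poly-drop (suc n) (g , b , h , e) = let (m , h′) = poly-drop n h in m , g , b , h′ , e

    poly-shift : ∀ n {m f} → IsPoly n m f → IsPoly (suc n) m (λ t → t * f t)
    poly-shift n {f = f} h = f , 0# , h , λ t → sym (+-idˡ _)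

    poly-add-const : ∀ n a {m f} → IsPoly (suc n) m f → IsPoly (suc n) m (λ t → a + f t)
    poly-add-const n a (g , b , h , e) = g , a + b , h , λ t →
      trans (cong (a +_) (e t)) (sym (+-assoc a b _))

    poly-newton : ∀ n a y {m g} → IsPoly n m g → IsPoly (suc n) m (λ t → a + (t + y) * g t)
    poly-newton n a y {m} {g} h = poly-add-const n a (subst (λ c → IsPoly (suc n) c _) (+-idʳ m)
      (poly-ext (suc n) (λ t → solve 3 (λ t y g → (t :+ y) :* g := t :* g :+ y :* g) refl t y (g t))
        (poly-+ (suc n) (poly-shift n h) (poly-lift n (poly-scale n y h)))))

    poly-divide : ∀ n y {m f} → IsPoly (suc n) m f →
                  Σ (K → K) λ g → IsPoly n m g × (∀ t → f t ≡ f y + (t + y) * g t)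
    poly-divide zero y {m} {f} (g , b , h , e) = g , h , λ t → begin
      f t                       ≡⟨ trans (e t) (cong (λ z → b + t * z) (h t)) ⟩
      b + t * m                 ≡⟨ solve 4 (λ b t y m → b :+ t :* m := (b :+ y :* m) :+ (t :+ y) :* m) refl b t y m ⟩
      (b + y * m) + (t + y) * m ≡⟨ cong₂ (λ u v → u + (t + y) * v) (trans (e y) (cong (λ z → b + y * z) (h y))) (h t) ⟨
      f y + (t + y) * g t       ∎
      where open ≡-Reasoning
    poly-divide (suc n) y {m} {f} (h , b , hp , e) with poly-divide n y hp
    ... | k , kp , ke = (λ t → h y + t * k t) , (k , h y , kp , λ _ → refl) , λ t → begin
      f t                                     ≡⟨ trans (e t) (cong (λ z → b + t * z) (ke t)) ⟩
      b + t * (h y + (t + y) * k t)           ≡⟨ solve 5 (λ b t y hy kt → b :+ t :* (hy :+ (t :+ y) :* kt) :=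
                                                   (b :+ y :* hy) :+ (t :+ y) :* (hy :+ t :* kt)) refl b t y (h y) (k t) ⟩
      (b + y * h y) + (t + y) * (h y + t * k t) ≡⟨ cong (_+ (t + y) * (h y + t * k t)) (e y) ⟨
      f y + (t + y) * (h y + t * k t)         ∎
      where open ≡-Reasoning

    -- Dividing by t + y passes the remaining roots to a quotient with the same leading coefficient,
    -- so the induction also returns m ≡ 0.
    poly-roots : ∀ n {m f} (ys : List K) → IsPoly n m f → length ys ≡ suc n → AllPairs _≢_ ys →
                 All (λ y → f y ≡ 0#) ys → m ≡ 0# × (∀ t → f t ≡ 0#)
    poly-roots zero (y ∷ []) h _ _ (r ∷ []) = let m≡0 = trans (sym (h y)) r in m≡0 , λ t → trans (h t) m≡0
    poly-roots (suc n) {f = f} (y ∷ ys) h len (≢y ∷ dist) (r ∷ rs) with poly-divide n y h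
    ... | g , gp , e = proj₁ IH , λ t → trans (factor t) (trans (cong ((t + y) *_) (proj₂ IH t)) (*-zeroʳ _))
      where
      factor : ∀ t → f t ≡ (t + y) * g t
      factor t = trans (e t) (trans (cong (_+ (t + y) * g t) r) (+-idˡ _))
      IH : _
      IH = poly-roots n ys gp (ℕₚ.suc-injective len) dist
        (All.zipWith (λ { {z} (y≢z , fz) → *≡0⇒ (+≢0 (λ eq → y≢z (sym eq))) (trans (sym (factor z)) fz) }) (≢y , rs))

    V : Set
    V = K × K

    DistinctY : List V → Set
    DistinctY = AllPairs (λ a b → proj₂ a ≢ proj₂ b)

    -- An edge arises for d = k - 2. The divided differences are encoded as leading coefficients of
    -- interpolating polynomials; this makes symmetry in the points immediate and reduces uniqueness
    -- questions to counting roots.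
    record Link (d : ℕ) (u : List V) (c : V) : Set where
      field
        len      : length u ≡ suc d
        lead≢0   : proj₁ c ≢ 0#
        distinct : DistinctY u
        p q      : K → K
        isPoly-p : IsPoly d (proj₁ c) p
        isPoly-q : IsPoly d (proj₂ c) q
        at-p     : All (λ a → p (proj₂ a) ≡ proj₁ a) u
        at-q     : All (λ a → q (proj₂ a) ≡ proj₁ a * proj₂ a) u

    distinctY-resp-↭ : ∀ {u v} → u ↭ v → DistinctY u → DistinctY v
    distinctY-resp-↭ ↭-refl dist = dist
    distinctY-resp-↭ (prep x p) (d ∷ dist) = All-resp-↭ p d ∷ distinctY-resp-↭ p dist
    distinctY-resp-↭ (swap x y p) ((x≢y ∷ dx) ∷ (dy ∷ dist)) =
      ((λ eq → x≢y (sym eq)) ∷ All-resp-↭ p dy) ∷ (All-resp-↭ p dx ∷ distinctY-resp-↭ p dist)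
    distinctY-resp-↭ (↭-trans p q) dist = distinctY-resp-↭ q (distinctY-resp-↭ p dist)

    link-↭ : ∀ {d u v c} → u ↭ v → Link d u c → Link d v c
    link-↭ π L = record
      { len = trans (sym (↭-length π)) len ; lead≢0 = lead≢0 ; distinct = distinctY-resp-↭ π distinct
      ; isPoly-p = isPoly-p ; isPoly-q = isPoly-q ; at-p = All-resp-↭ π at-p ; at-q = All-resp-↭ π at-q }
      where open Link L

    infix 4 _⊑_
    _⊑_ : {A : Set} → List A → List A → Set
    u ⊑ v = ∀ {a} → a ∈ u → a ∈ v

    agree : {f f′ : K → K} {h : V → K} {R u u′ : List V} → R ⊑ u → R ⊑ u′ →
            All (λ a → f (proj₂ a) ≡ h a) u → All (λ a → f′ (proj₂ a) ≡ h a) u′ →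
            All (λ y → f y + f′ y ≡ 0#) (map proj₂ R)
    agree R⊑u R⊑u′ at at′ = Allₚ.map⁺ (All.tabulate (λ {a} a∈R →
      ≡⇒+≡0 (trans (All.lookup at (R⊑u a∈R)) (sym (All.lookup at′ (R⊑u′ a∈R))))))

    -- The sum of the two interpolants has degree `d` and d + 1 roots, so its leading coefficient,
    -- the sum of the corresponding coordinates of `c` and `c′`, is zero.
    link-functional : ∀ {d u u′ c c′} → Link d u c → Link d u′ c′ → u ⊑ u′ → c ≡ c′
    link-functional {d} {u} L L′ u⊑u′ = cong₂ _,_
      (+≡0⇒≡ (proj₁ (poly-roots d (map proj₂ u) (poly-+ d L.isPoly-p L′.isPoly-p) len (AllPairsₚ.map⁺ L.distinct)
        (agree (λ a → a) u⊑u′ L.at-p L′.at-p))))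
      (+≡0⇒≡ (proj₁ (poly-roots d (map proj₂ u) (poly-+ d L.isPoly-q L′.isPoly-q) len (AllPairsₚ.map⁺ L.distinct)
        (agree (λ a → a) u⊑u′ L.at-q L′.at-q))))
      where
      module L = Link L
      module L′ = Link L′
      len : length (map proj₂ u) ≡ suc d
      len = trans (length-map proj₂ u) L.len

    -- Equal leading coefficients cancel and lower the degree by one, which is why one node fewer
    -- than interpolation requires is enough.
    same-poly : ∀ d {f f′ m} (ys : List K) → IsPoly (suc d) m f → IsPoly (suc d) m f′ → length ys ≡ suc d →
                AllPairs _≢_ ys → All (λ y → f y + f′ y ≡ 0#) ys → ∀ t → f t ≡ f′ t
    same-poly d {f} {f′} {m} ys h h′ len dist roots t =
      let (m″ , low) = poly-drop d (subst (λ c → IsPoly (suc d) c (λ z → f z + f′ z)) (+-self m) (poly-+ (suc d) h h′))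
      in +≡0⇒≡ (proj₂ (poly-roots d ys low len dist roots) t)

    -- The points of a link are recovered from p and q: their nodes are the roots of t p(t) + q(t).
    link-determined : ∀ {d u u′ c} (R : List V) → Link (suc d) u c → Link (suc d) u′ c →
                      length R ≡ suc d → DistinctY R → R ⊑ u → R ⊑ u′ → u′ ⊑ u
    link-determined {d} {u} {u′} {c} R L L′ lenR distR R⊑u R⊑u′ {a} a∈u′ with Any.any? (λ b → proj₂ b ≟ proj₂ a) u
    ... | yes any = let (b , b∈u , yb≡ya) = find any in
          subst (_∈ u) (cong₂ _,_ (begin
            proj₁ b         ≡⟨ All.lookup L.at-p b∈u ⟨
            L.p (proj₂ b)   ≡⟨ cong L.p yb≡ya ⟩
            L.p (proj₂ a)   ≡⟨ same-p (proj₂ a) ⟩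
            L′.p (proj₂ a)  ≡⟨ All.lookup L′.at-p a∈u′ ⟩
            proj₁ a         ∎) yb≡ya) b∈u
      where
      open ≡-Reasoning
      module L = Link L
      module L′ = Link L′
      same-p : ∀ t → L.p t ≡ L′.p t
      same-p = same-poly d (map proj₂ R) L.isPoly-p L′.isPoly-p (trans (length-map proj₂ R) lenR) (AllPairsₚ.map⁺ distR)
        (agree R⊑u R⊑u′ L.at-p L′.at-p)
    ... | no none = ⊥-elim (L.lead≢0 (proj₁ (poly-roots (suc (suc d)) (proj₂ a ∷ map proj₂ u)
            (subst (λ m → IsPoly (suc (suc d)) m _) (+-idʳ (proj₁ c))
              (poly-+ (suc (suc d)) (poly-shift (suc d) L.isPoly-p) (poly-lift (suc d) L.isPoly-q)))
            (cong suc (trans (length-map proj₂ u) L.len))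
            (Allₚ.map⁺ (All.tabulate (λ b∈u eq → none (lose b∈u (sym eq)))) ∷ AllPairsₚ.map⁺ L.distinct)
            (root-a ∷ Allₚ.map⁺ (All.zipWith (λ { {x , y} (ep , eq) → ≡⇒+≡0 (trans (cong (y *_) ep) (trans (*-comm y x) (sym eq))) }) (L.at-p , L.at-q))))))
      where
      module L = Link L
      module L′ = Link L′
      same-p : ∀ t → L.p t ≡ L′.p t
      same-p = same-poly d (map proj₂ R) L.isPoly-p L′.isPoly-p (trans (length-map proj₂ R) lenR) (AllPairsₚ.map⁺ distR)
        (agree R⊑u R⊑u′ L.at-p L′.at-p)
      same-q : ∀ t → L.q t ≡ L′.q t
      same-q = same-poly d (map proj₂ R) L.isPoly-q L′.isPoly-q (trans (length-map proj₂ R) lenR) (AllPairsₚ.map⁺ distR)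
        (agree R⊑u R⊑u′ L.at-q L′.at-q)
      root-a : proj₂ a * L.p (proj₂ a) + L.q (proj₂ a) ≡ 0#
      root-a = ≡⇒+≡0 (trans (cong (proj₂ a *_) (trans (same-p _) (All.lookup L′.at-p a∈u′)))
        (trans (*-comm (proj₂ a) (proj₁ a)) (sym (trans (same-q _) (All.lookup L′.at-q a∈u′)))))

    -- `link-determined` puts `a′` into `a ∷ R`, and distinctness of the nodes excludes `R`. It is
    -- used to show that moving a single point hits a given apex at most once.
    link-latin : ∀ {d R c a a′} → Link (suc d) (a ∷ R) c → Link (suc d) (a′ ∷ R) c → a ≡ a′
    link-latin {d} {R} {c} {a} {a′} L L′ with Link.distinct L
    ... | a≢R ∷ distR with link-determined R L L′ (ℕₚ.suc-injective (Link.len L)) distR there there (here refl)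
    ...   | here eq  = sym eq
    ...   | there a′∈R with Link.distinct L′
    ...     | a′≢R ∷ _ = ⊥-elim (All.lookup a′≢R a′∈R refl)

    -- The apex for k = 3. The second coordinate is indeed the divided difference of x y: by
    -- `slope-spec`, x y + x′ y′ = w (y + y′).
    slope : V → V → V
    slope (x , y) (x′ , y′) = let m = (x + x′) * inv (y + y′) in m , x + m * y′

    slope-spec : ∀ x y x′ y′ → y ≢ y′ → let (m , w) = slope (x , y) (x′ , y′) in x ≡ m * y′ + w × x′ ≡ m * y + w
    slope-spec x y x′ y′ y≢y′ =
      solve 3 (λ x m y′ → x := m :* y′ :+ (x :+ m :* y′)) refl x m y′ , (begin
      x′                                ≡⟨ solve 2 (λ x x′ → x′ := x :+ (x :+ x′) :* con true) refl x x′ ⟩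
      x + (x + x′) * 1#                 ≡⟨ cong (λ o → x + (x + x′) * o) (inv-* (y + y′) (+≢0 y≢y′)) ⟨
      x + (x + x′) * (inv (y + y′) * (y + y′))
        ≡⟨ solve 5 (λ x x′ y y′ i → x :+ (x :+ x′) :* (i :* (y :+ y′)) :=
             ((x :+ x′) :* i) :* y :+ (x :+ ((x :+ x′) :* i) :* y′)) refl x x′ y y′ (inv (y + y′)) ⟩
      m * y + (x + m * y′)              ∎)
      where
      open ≡-Reasoning
      m : K
      m = (x + x′) * inv (y + y′)

    link-base : ∀ {x y x′ y′} → y ≢ y′ → x ≢ x′ → Link 1 ((x , y) ∷ (x′ , y′) ∷ []) (slope (x , y) (x′ , y′))
    link-base {x} {y} {x′} {y′} y≢y′ x≢x′ = record
      { len = refl ; lead≢0 = *≢0 (+≢0 x≢x′) (inv≢0 (+≢0 y≢y′)) ; distinct = (y≢y′ ∷ []) ∷ ([] ∷ [])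
      ; p = λ t → (x + m * y) + t * m ; q = λ t → (x * y + w * y) + t * w
      ; isPoly-p = (λ _ → m) , _ , (λ _ → refl) , λ _ → refl
      ; isPoly-q = (λ _ → w) , _ , (λ _ → refl) , λ _ → refl
      ; at-p = solve 3 (λ x m y → (x :+ m :* y) :+ y :* m := x) refl x m y ∷ (begin
          (x + m * y) + y′ * m           ≡⟨ cong (λ z → (z + m * y) + y′ * m) e₁ ⟩
          (m * y′ + w + m * y) + y′ * m  ≡⟨ solve 4 (λ m y′ w y → (m :* y′ :+ w :+ m :* y) :+ y′ :* m := m :* y :+ w) refl m y′ w y ⟩
          m * y + w                      ≡⟨ e₂ ⟨
          x′                             ∎) ∷ []
      ; at-q = solve 3 (λ x w y → (x :* y :+ w :* y) :+ y :* w := x :* y) refl x w y ∷ (begin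
          (x * y + w * y) + y′ * w              ≡⟨ cong (λ z → (z * y + w * y) + y′ * w) e₁ ⟩
          ((m * y′ + w) * y + w * y) + y′ * w   ≡⟨ solve 4 (λ m y′ w y → ((m :* y′ :+ w) :* y :+ w :* y) :+ y′ :* w := (m :* y :+ w) :* y′) refl m y′ w y ⟩
          (m * y + w) * y′                      ≡⟨ cong (_* y′) e₂ ⟨
          x′ * y′                               ∎) ∷ [] }
      where
      open ≡-Reasoning
      m w : K
      m = proj₁ (slope (x , y) (x′ , y′))
      w = proj₂ (slope (x , y) (x′ , y′))
      e₁ : x ≡ m * y′ + w
      e₁ = proj₁ (slope-spec x y x′ y′ y≢y′)
      e₂ : x′ ≡ m * y + w
      e₂ = proj₂ (slope-spec x y x′ y′ y≢y′)

    -- Newton's divided difference: fixing the point e turns a k-point interpolation problem into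
    -- a (k − 1)-point one with the same leading coefficients.
    divide : V → V → V
    divide (x₀ , y₀) (x , y) = (x + x₀) * inv (y + y₀) , y

    undivide : V → V → V
    undivide (x₀ , y₀) (ξ , y) = x₀ + (y + y₀) * ξ , y

    undivide-divide : ∀ e a → proj₂ a ≢ proj₂ e → undivide e (divide e a) ≡ a
    undivide-divide (x₀ , y₀) (x , y) y≢y₀ = cong (_, y) (begin
      x₀ + (y + y₀) * ((x + x₀) * inv (y + y₀)) ≡⟨ solve 4 (λ x₀ d x i → x₀ :+ d :* ((x :+ x₀) :* i) := x₀ :+ (x :+ x₀) :* (i :* d)) refl x₀ (y + y₀) x (inv (y + y₀)) ⟩
      x₀ + (x + x₀) * (inv (y + y₀) * (y + y₀)) ≡⟨ cong (λ o → x₀ + (x + x₀) * o) (inv-* _ (+≢0 y≢y₀)) ⟩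
      x₀ + (x + x₀) * 1#                        ≡⟨ solve 2 (λ x₀ x → x₀ :+ (x :+ x₀) :* con true := x) refl x₀ x ⟩
      x                                         ∎)
      where open ≡-Reasoning

    divide-undivide : ∀ e a → proj₂ a ≢ proj₂ e → divide e (undivide e a) ≡ a
    divide-undivide (x₀ , y₀) (ξ , y) y≢y₀ = cong (_, y) (begin
      (x₀ + (y + y₀) * ξ + x₀) * inv (y + y₀) ≡⟨ solve 4 (λ x₀ d ξ i → (x₀ :+ d :* ξ :+ x₀) :* i := (i :* d) :* ξ) refl x₀ (y + y₀) ξ (inv (y + y₀)) ⟩
      (inv (y + y₀) * (y + y₀)) * ξ           ≡⟨ cong (_* ξ) (inv-* _ (+≢0 y≢y₀)) ⟩
      1# * ξ                                  ≡⟨ *-idˡ ξ ⟩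
      ξ                                       ∎)
      where open ≡-Reasoning

    -- Newton's formula for both interpolants. Writing x = x₀ + (y + y₀) ξ, the divided difference
    -- of x y with the fixed point is x₀ + ξ y. So the new `q` is built from x₀ + q, and the
    -- constant x₀ leaves the leading coefficient alone because the degree is at least 1.
    link-step : ∀ {d c} e u → All (λ a → proj₂ a ≢ proj₂ e) u →
                Link (suc d) (map (divide e) u) c → Link (suc (suc d)) (e ∷ u) c
    link-step {d} {c} e@(x₀ , y₀) u avoids L = record
      { len = cong suc (trans (sym (length-map (divide e) u)) len) ; lead≢0 = lead≢0
      ; distinct = All.map (λ ne eq → ne (sym eq)) avoids ∷ AllPairsₚ.map⁻ distinct
      ; p = λ t → x₀ + (t + y₀) * p t
      ; q = λ t → x₀ * y₀ + (t + y₀) * (x₀ + q t)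
      ; isPoly-p = poly-newton (suc d) x₀ y₀ isPoly-p
      ; isPoly-q = poly-newton (suc d) (x₀ * y₀) y₀ (poly-add-const d x₀ isPoly-q)
      ; at-p = solve 3 (λ x₀ y₀ p → x₀ :+ (y₀ :+ y₀) :* p := x₀) refl x₀ y₀ (p y₀)
             ∷ All.zipWith (λ { {a} (ne , ep) → trans (cong (λ z → x₀ + (proj₂ a + y₀) * z) ep) (cong proj₁ (undivide-divide e a ne)) }) (avoids , Allₚ.map⁻ at-p)
      ; at-q = solve 3 (λ x₀ y₀ q → x₀ :* y₀ :+ (y₀ :+ y₀) :* (x₀ :+ q) := x₀ :* y₀) refl x₀ y₀ (q y₀)
             ∷ All.zipWith (λ { {a} (ne , eq) → trans
                 (trans (cong (λ z → x₀ * y₀ + (proj₂ a + y₀) * (x₀ + z)) eq)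
                   (solve 4 (λ x₀ y₀ y ξ → x₀ :* y₀ :+ (y :+ y₀) :* (x₀ :+ ξ :* y) := (x₀ :+ (y :+ y₀) :* ξ) :* y) refl x₀ y₀ (proj₂ a) (proj₁ (divide e a))))
                 (cong (λ z → proj₁ z * proj₂ a) (undivide-divide e a ne)) }) (avoids , Allₚ.map⁻ at-q)
      }
      where open Link L

-- Two applications of Cauchy-Schwarz, and weighted four-cycles.

module FourCycles where

  open import Data.Bool using (Bool; true; false; _∧_)
  import Data.Integer as ℤ
  open import Data.Integer using (ℤ; +_; -[1+_]; ∣_∣; 0ℤ; 1ℤ; +≤+)
  import Data.Integer.Properties as ℤₚ
  open import Data.Integer.Solver using (module +-*-Solver)
  open import Data.List using (List; []; _∷_; cartesianProduct)
  import Data.Nat as ℕ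
  open import Data.Nat using (ℕ; z≤n)
  import Data.Nat.Properties as ℕₚ
  open import Data.Product using (_×_; _,_; proj₁; proj₂)
  open import Relation.Binary.PropositionalEquality
  open FiniteSums

  module ∑ℤ = Summation ℤ._+_ ℤ._*_ 0ℤ 1ℤ ℤₚ.+-*-isCommutativeSemiring

  module CauchySchwarz where
    open import Data.Integer using (_+_; _*_; _-_; _≤_)
    open ∑ℤ renaming (∑ to ∑ᶻ; ∑-cong to ∑ᶻ-cong; ∑-0 to ∑ᶻ-0; ∑-+ to ∑ᶻ-+; ∑-*ˡ to ∑ᶻ-*ˡ; ∑-swap to ∑ᶻ-swap; ∑-× to ∑ᶻ-×; ∑-∑* to ∑ᶻ-∑*)
      using () public
    open +-*-Solver using (solve; _:=_; _:+_; _:*_; _:-_; con)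

    ∑ᶻ-mono : {A : Set} (xs : List A) {f g : A → ℤ} → (∀ x → f x ≤ g x) → ∑ᶻ xs f ≤ ∑ᶻ xs g
    ∑ᶻ-mono []       le = ℤₚ.≤-refl
    ∑ᶻ-mono (x ∷ xs) le = ℤₚ.+-mono-≤ (le x) (∑ᶻ-mono xs le)

    ∑ᶻ-pos : {A : Set} (xs : List A) (f : A → ℕ) → ∑ᶻ xs (λ x → + f x) ≡ + ∑ xs f
    ∑ᶻ-pos []       f = refl
    ∑ᶻ-pos (x ∷ xs) f = trans (cong (ℤ._+_ (+ f x)) (∑ᶻ-pos xs f)) (sym (ℤₚ.pos-+ (f x) _))

    i*i≡∣i∣*∣i∣ : ∀ i → i * i ≡ + (∣ i ∣ ℕ.* ∣ i ∣)
    i*i≡∣i∣*∣i∣ (+ n)      = sym (ℤₚ.pos-* n n)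
    i*i≡∣i∣*∣i∣ (-[1+ n ]) = refl

    0≤i*i : ∀ i → 0ℤ ≤ i * i
    0≤i*i i = subst (0ℤ ≤_) (sym (i*i≡∣i∣*∣i∣ i)) (+≤+ z≤n)

    square-mono : ∀ {i j} → 0ℤ ≤ i → i ≤ j → i * i ≤ j * j
    square-mono {i} {j} 0≤i i≤j = ℤₚ.≤-trans
      (ℤₚ.*-monoˡ-≤-nonNeg i {{ℤ.nonNegative 0≤i}} i≤j)
      (ℤₚ.*-monoʳ-≤-nonNeg j {{ℤ.nonNegative (ℤₚ.≤-trans 0≤i i≤j)}} i≤j)

    ∑ᶻ-nonNeg : {A : Set} (xs : List A) {f : A → ℤ} → (∀ x → 0ℤ ≤ f x) → 0ℤ ≤ ∑ᶻ xs f
    ∑ᶻ-nonNeg xs {f} le = subst (_≤ ∑ᶻ xs f) (∑ᶻ-0 xs) (∑ᶻ-mono xs le)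

    -- Lagrange's identity: twice the difference of the two sides is a sum of squares over ordered
    -- pairs.
    cauchy-schwarz : {A : Set} (xs : List A) (f g : A → ℤ) →
      ∑ᶻ xs (λ x → f x * g x) * ∑ᶻ xs (λ x → f x * g x) ≤ ∑ᶻ xs (λ x → f x * f x) * ∑ᶻ xs (λ x → g x * g x)
    cauchy-schwarz xs f g = ℤₚ.*-cancelˡ-≤-pos _ _ (+ 2) (begin
      + 2 * (H * H)          ≡⟨ ℤₚ.+-identityˡ _ ⟨
      0ℤ + + 2 * (H * H)     ≤⟨ ℤₚ.+-monoˡ-≤ _ (∑ᶻ-nonNeg xs (λ x → ∑ᶻ-nonNeg xs (λ y → 0≤i*i (f x * g y - f y * g x)))) ⟩
      D + + 2 * (H * H)      ≡⟨ identity ⟩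
      + 2 * (F * G)          ∎)
      where
      open ℤₚ.≤-Reasoning
      F G H D : ℤ
      F = ∑ᶻ xs (λ x → f x * f x)
      G = ∑ᶻ xs (λ x → g x * g x)
      H = ∑ᶻ xs (λ x → f x * g x)
      D = ∑ᶻ xs (λ x → ∑ᶻ xs (λ y → (f x * g y - f y * g x) * (f x * g y - f y * g x)))
      identity : D + + 2 * (H * H) ≡ + 2 * (F * G)
      identity = begin-equality
        D + + 2 * (H * H)
          ≡⟨ cong (λ z → D + + 2 * z) (∑ᶻ-∑* xs xs) ⟨
        D + + 2 * ∑ᶻ xs (λ x → ∑ᶻ xs (λ y → (f x * g x) * (f y * g y)))
          ≡⟨ cong (ℤ._+_ D) (trans (∑ᶻ-cong xs (λ x → ∑ᶻ-*ˡ xs (+ 2))) (∑ᶻ-*ˡ xs (+ 2))) ⟨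
        D + ∑ᶻ xs (λ x → ∑ᶻ xs (λ y → + 2 * ((f x * g x) * (f y * g y))))
          ≡⟨ trans (∑ᶻ-cong xs (λ x → ∑ᶻ-+ xs)) (∑ᶻ-+ xs) ⟨
        ∑ᶻ xs (λ x → ∑ᶻ xs (λ y → (f x * g y - f y * g x) * (f x * g y - f y * g x) + + 2 * ((f x * g x) * (f y * g y))))
          ≡⟨ ∑ᶻ-cong xs (λ x → ∑ᶻ-cong xs (λ y → solve 4 (λ a b c d →
               (a :* d :- c :* b) :* (a :* d :- c :* b) :+ con (+ 2) :* ((a :* b) :* (c :* d)) :=
               (a :* a) :* (d :* d) :+ (b :* b) :* (c :* c)) refl (f x) (g x) (f y) (g y))) ⟩
        ∑ᶻ xs (λ x → ∑ᶻ xs (λ y → (f x * f x) * (g y * g y) + (g x * g x) * (f y * f y)))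
          ≡⟨ trans (∑ᶻ-cong xs (λ x → ∑ᶻ-+ xs)) (∑ᶻ-+ xs) ⟩
        ∑ᶻ xs (λ x → ∑ᶻ xs (λ y → (f x * f x) * (g y * g y))) + ∑ᶻ xs (λ x → ∑ᶻ xs (λ y → (g x * g x) * (f y * f y)))
          ≡⟨ cong₂ _+_ (∑ᶻ-∑* xs xs) (∑ᶻ-∑* xs xs) ⟩
        F * G + G * F
          ≡⟨ solve 2 (λ F G → F :* G :+ G :* F := con (+ 2) :* (F :* G)) refl F G ⟩
        + 2 * (F * G) ∎

    module _ {X : Set} (xs : List X) where

      pairs : List (X × X)
      pairs = cartesianProduct xs xs

      quadruples : List ((X × X) × (X × X))
      quadruples = cartesianProduct pairs pairs

      fourCycles : (X → X → ℤ) → ℤ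
      fourCycles G = ∑ᶻ quadruples λ { ((a , a′) , (b , b′)) → (G a b * G a b′) * (G a′ b * G a′ b′) }

      -- Idempotence makes `A` and `B` indicator functions. The first Cauchy-Schwarz removes `A` and
      -- duplicates b. After interchanging sums, the second removes the product of the two copies of
      -- `B` and duplicates a, which leaves the sum over all a, a′, b, b′.
      bilinear⁴≤fourCycles : (A B : X → ℤ) (G : X → X → ℤ) → (∀ a → A a * A a ≡ A a) → (∀ b → B b * B b ≡ B b) →
        let T = ∑ᶻ xs (λ a → A a * ∑ᶻ xs (λ b → B b * G a b)) in
        (T * T) * (T * T) ≤ (∑ᶻ xs A * ∑ᶻ xs A) * ((∑ᶻ xs B * ∑ᶻ xs B) * fourCycles G)
      bilinear⁴≤fourCycles A B G A²≡A B²≡B = begin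
        (T * T) * (T * T)                     ≤⟨ square-mono (0≤i*i T) step₁ ⟩
        (∑ᶻ xs A * W) * (∑ᶻ xs A * W)           ≡⟨ solve 2 (λ α w → (α :* w) :* (α :* w) := (α :* α) :* (w :* w)) refl (∑ᶻ xs A) W ⟩
        (∑ᶻ xs A * ∑ᶻ xs A) * (W * W)           ≤⟨ ℤₚ.*-monoˡ-≤-nonNeg (∑ᶻ xs A * ∑ᶻ xs A) {{ℤ.nonNegative (0≤i*i (∑ᶻ xs A))}} step₂ ⟩
        (∑ᶻ xs A * ∑ᶻ xs A) * ((∑ᶻ xs B * ∑ᶻ xs B) * fourCycles G) ∎
        where
        open ℤₚ.≤-Reasoning
        H : X → ℤ
        H a = ∑ᶻ xs (λ b → B b * G a b)
        T W : ℤ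
        T = ∑ᶻ xs (λ a → A a * H a)
        W = ∑ᶻ xs (λ a → H a * H a)
        step₁ : T * T ≤ ∑ᶻ xs A * W
        step₁ = ℤₚ.≤-trans (cauchy-schwarz xs A H) (ℤₚ.≤-reflexive (cong (_* W) (∑ᶻ-cong xs A²≡A)))
        BB R : X × X → ℤ
        BB (b , b′) = B b * B b′
        R  (b , b′) = ∑ᶻ xs (λ a → G a b * G a b′)
        W≡ : W ≡ ∑ᶻ pairs (λ p → BB p * R p)
        W≡ = begin-equality
          ∑ᶻ xs (λ a → H a * H a)
            ≡⟨ ∑ᶻ-cong xs (λ a → trans (∑ᶻ-× xs xs) (∑ᶻ-∑* xs xs)) ⟨
          ∑ᶻ xs (λ a → ∑ᶻ pairs (λ { (b , b′) → (B b * G a b) * (B b′ * G a b′) }))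
            ≡⟨ ∑ᶻ-swap xs pairs ⟩
          ∑ᶻ pairs (λ { (b , b′) → ∑ᶻ xs (λ a → (B b * G a b) * (B b′ * G a b′)) })
            ≡⟨ ∑ᶻ-cong pairs (λ { (b , b′) → trans (∑ᶻ-cong xs (λ a →
                 solve 4 (λ p q r s → (p :* q) :* (r :* s) := (p :* r) :* (q :* s)) refl (B b) (G a b) (B b′) (G a b′)))
                 (∑ᶻ-*ˡ xs (B b * B b′)) }) ⟩
          ∑ᶻ pairs (λ p → BB p * R p) ∎
        BB² : ∑ᶻ pairs (λ p → BB p * BB p) ≡ ∑ᶻ xs B * ∑ᶻ xs B
        BB² = begin-equality
          ∑ᶻ pairs (λ p → BB p * BB p)
            ≡⟨ ∑ᶻ-× xs xs ⟩
          ∑ᶻ xs (λ b → ∑ᶻ xs (λ b′ → (B b * B b′) * (B b * B b′)))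
            ≡⟨ ∑ᶻ-cong xs (λ b → ∑ᶻ-cong xs (λ b′ → trans
                 (solve 2 (λ p q → (p :* q) :* (p :* q) := (p :* p) :* (q :* q)) refl (B b) (B b′))
                 (cong₂ _*_ (B²≡B b) (B²≡B b′)))) ⟩
          ∑ᶻ xs (λ b → ∑ᶻ xs (λ b′ → B b * B b′))
            ≡⟨ ∑ᶻ-∑* xs xs ⟩
          ∑ᶻ xs B * ∑ᶻ xs B ∎
        R² : ∑ᶻ pairs (λ p → R p * R p) ≡ fourCycles G
        R² = begin-equality
          ∑ᶻ pairs (λ p → R p * R p)
            ≡⟨ ∑ᶻ-cong pairs (λ { (b , b′) → trans (∑ᶻ-× xs xs) (∑ᶻ-∑* xs xs) }) ⟨
          ∑ᶻ pairs (λ { (b , b′) → ∑ᶻ pairs (λ { (a , a′) → (G a b * G a b′) * (G a′ b * G a′ b′) }) })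
            ≡⟨ ∑ᶻ-swap pairs pairs ⟩
          ∑ᶻ pairs (λ { (a , a′) → ∑ᶻ pairs (λ { (b , b′) → (G a b * G a b′) * (G a′ b * G a′ b′) }) })
            ≡⟨ ∑ᶻ-× pairs pairs ⟨
          fourCycles G ∎
        step₂ : W * W ≤ (∑ᶻ xs B * ∑ᶻ xs B) * fourCycles G
        step₂ = begin
          W * W ≡⟨ cong₂ _*_ W≡ W≡ ⟩
          ∑ᶻ pairs (λ p → BB p * R p) * ∑ᶻ pairs (λ p → BB p * R p) ≤⟨ cauchy-schwarz pairs BB R ⟩
          ∑ᶻ pairs (λ p → BB p * BB p) * ∑ᶻ pairs (λ p → R p * R p) ≡⟨ cong₂ _*_ BB² R² ⟩
          (∑ᶻ xs B * ∑ᶻ xs B) * fourCycles G ∎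

      ∑⁴ : {f g h k : X → ℤ} →
        (∑ᶻ xs f * ∑ᶻ xs g) * (∑ᶻ xs h * ∑ᶻ xs k) ≡ ∑ᶻ quadruples (λ { ((c , c′) , (d , d′)) → (f c * g c′) * (h d * k d′) })
      ∑⁴ {f} {g} {h} {k} = sym (begin
        ∑ᶻ quadruples (λ { ((c , c′) , (d , d′)) → (f c * g c′) * (h d * k d′) })
          ≡⟨ ∑ᶻ-× pairs pairs ⟩
        ∑ᶻ pairs (λ p → ∑ᶻ pairs (λ r → (f (proj₁ p) * g (proj₂ p)) * (h (proj₁ r) * k (proj₂ r))))
          ≡⟨ ∑ᶻ-∑* pairs pairs ⟩
        ∑ᶻ pairs (λ p → f (proj₁ p) * g (proj₂ p)) * ∑ᶻ pairs (λ r → h (proj₁ r) * k (proj₂ r))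
          ≡⟨ cong₂ _*_ (trans (∑ᶻ-× xs xs) (∑ᶻ-∑* xs xs)) (trans (∑ᶻ-× xs xs) (∑ᶻ-∑* xs xs)) ⟩
        (∑ᶻ xs f * ∑ᶻ xs g) * (∑ᶻ xs h * ∑ᶻ xs k) ∎)
        where open ≡-Reasoning

      Quad : Set
      Quad = (X × X) × (X × X)

      φ⁴ : (X → ℤ) → Quad → ℤ
      φ⁴ φ ((c , c′) , (d , d′)) = (φ c * φ c′) * (φ d * φ d′)

      -- The first quadruple consists of the labels c, c′, d, d′ on the sides a b, a b′, a′ b, a′ b′
      -- of the cycle given by the second.
      cycle : (X → X → X → Bool) → Quad → Quad → Bool
      cycle ρ ((c , c′) , (d , d′)) ((a , a′) , (b , b′)) = (ρ c a b ∧ ρ c′ a b′) ∧ (ρ d a′ b ∧ ρ d′ a′ b′)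

      ⟦∧⟧ℤ : ∀ p q → + ⟦ p ∧ q ⟧ ≡ + ⟦ p ⟧ * + ⟦ q ⟧
      ⟦∧⟧ℤ p q = trans (cong +_ (⟦∧⟧ p q)) (ℤₚ.pos-* ⟦ p ⟧ ⟦ q ⟧)

      -- Multiplying out and interchanging the sums groups the cycles by their four labels: each
      -- label quadruple contributes its weight times the number of cycles that carry it.
      fourCycles-expand : (φ : X → ℤ) (ρ : X → X → X → Bool) →
        fourCycles (λ a b → ∑ᶻ xs (λ c → φ c * + ⟦ ρ c a b ⟧)) ≡
        ∑ᶻ quadruples (λ t → φ⁴ φ t * + ∑ quadruples (λ p → ⟦ cycle ρ t p ⟧))
      fourCycles-expand φ ρ = begin
        ∑ᶻ quadruples (λ { ((a , a′) , (b , b′)) → (G a b * G a b′) * (G a′ b * G a′ b′) })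
          ≡⟨ ∑ᶻ-cong quadruples (λ { ((a , a′) , (b , b′)) → ∑⁴ }) ⟩
        ∑ᶻ quadruples (λ p → ∑ᶻ quadruples (λ t → term t p))
          ≡⟨ ∑ᶻ-cong quadruples (λ p → ∑ᶻ-cong quadruples (λ t → pointwise t p)) ⟩
        ∑ᶻ quadruples (λ p → ∑ᶻ quadruples (λ t → φ⁴ φ t * + ⟦ cycle ρ t p ⟧))
          ≡⟨ ∑ᶻ-swap quadruples quadruples ⟩
        ∑ᶻ quadruples (λ t → ∑ᶻ quadruples (λ p → φ⁴ φ t * + ⟦ cycle ρ t p ⟧))
          ≡⟨ ∑ᶻ-cong quadruples (λ t → trans (∑ᶻ-*ˡ quadruples (φ⁴ φ t)) (cong (φ⁴ φ t *_) (∑ᶻ-pos quadruples (λ p → ⟦ cycle ρ t p ⟧)))) ⟩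
        ∑ᶻ quadruples (λ t → φ⁴ φ t * + ∑ quadruples (λ p → ⟦ cycle ρ t p ⟧)) ∎
        where
        open ≡-Reasoning
        G : X → X → ℤ
        G a b = ∑ᶻ xs (λ c → φ c * + ⟦ ρ c a b ⟧)
        term : Quad → Quad → ℤ
        term ((c , c′) , (d , d′)) ((a , a′) , (b , b′)) =
          ((φ c * + ⟦ ρ c a b ⟧) * (φ c′ * + ⟦ ρ c′ a b′ ⟧)) * ((φ d * + ⟦ ρ d a′ b ⟧) * (φ d′ * + ⟦ ρ d′ a′ b′ ⟧))
        pointwise : ∀ t p → term t p ≡ φ⁴ φ t * + ⟦ cycle ρ t p ⟧
        pointwise ((c , c′) , (d , d′)) ((a , a′) , (b , b′)) = trans
          (solve 8 (λ f f′ g g′ r r′ s s′ →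
            ((f :* r) :* (f′ :* r′)) :* ((g :* s) :* (g′ :* s′)) := ((f :* f′) :* (g :* g′)) :* ((r :* r′) :* (s :* s′))) refl
            (φ c) (φ c′) (φ d) (φ d′) (+ ⟦ ρ c a b ⟧) (+ ⟦ ρ c′ a b′ ⟧) (+ ⟦ ρ d a′ b ⟧) (+ ⟦ ρ d′ a′ b′ ⟧))
          (cong (φ⁴ φ ((c , c′) , (d , d′)) *_) (sym (trans (⟦∧⟧ℤ (ρ c a b ∧ ρ c′ a b′) (ρ d a′ b ∧ ρ d′ a′ b′))
            (cong₂ _*_ (⟦∧⟧ℤ (ρ c a b) (ρ c′ a b′)) (⟦∧⟧ℤ (ρ d a′ b) (ρ d′ a′ b′))))))

      ∑φ⁴≡0 : (φ : X → ℤ) → ∑ᶻ xs φ ≡ 0ℤ → ∑ᶻ quadruples (φ⁴ φ) ≡ 0ℤ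
      ∑φ⁴≡0 φ eq = trans (sym ∑⁴) (cong (λ z → (z * ∑ᶻ xs φ) * (∑ᶻ xs φ * ∑ᶻ xs φ)) eq)

      -- The quadruples t that close up to exactly one four-cycle cancel, because ∑ φ⁴ = (∑ φ)⁴ = 0.
      fourCycles-bound : (φ : X → ℤ) (ρ : X → X → X → Bool) (B : ℕ) (degenerate : Quad → Bool) →
        ∑ᶻ xs φ ≡ 0ℤ → (∀ c → ∣ φ c ∣ ℕ.≤ B) →
        (∀ t → degenerate t ≡ false → φ⁴ φ t * + ∑ quadruples (λ p → ⟦ cycle ρ t p ⟧) ≡ φ⁴ φ t) →
        fourCycles (λ a b → ∑ᶻ xs (λ c → φ c * + ⟦ ρ c a b ⟧)) ≤
        + (((B ℕ.* B) ℕ.* (B ℕ.* B)) ℕ.* ∑ quadruples (λ t → ⟦ degenerate t ⟧ ℕ.* (∑ quadruples (λ p → ⟦ cycle ρ t p ⟧) ℕ.+ 1)))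
      fourCycles-bound φ ρ B deg ∑φ≡0 φ≤B generic = begin
        fourCycles (λ a b → ∑ᶻ xs (λ c → φ c * + ⟦ ρ c a b ⟧))
          ≡⟨ fourCycles-expand φ ρ ⟩
        ∑ᶻ quadruples (λ t → φ⁴ φ t * + M t)
          ≤⟨ ∑ᶻ-mono quadruples pointwise ⟩
        ∑ᶻ quadruples (λ t → φ⁴ φ t + + (Z ℕ.* (⟦ deg t ⟧ ℕ.* (M t ℕ.+ 1))))
          ≡⟨ ∑ᶻ-+ quadruples ⟩
        ∑ᶻ quadruples (φ⁴ φ) + ∑ᶻ quadruples (λ t → + (Z ℕ.* (⟦ deg t ⟧ ℕ.* (M t ℕ.+ 1))))
          ≡⟨ cong₂ _+_ (∑φ⁴≡0 φ ∑φ≡0) (∑ᶻ-pos quadruples (λ t → Z ℕ.* (⟦ deg t ⟧ ℕ.* (M t ℕ.+ 1)))) ⟩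
        0ℤ + + ∑ quadruples (λ t → Z ℕ.* (⟦ deg t ⟧ ℕ.* (M t ℕ.+ 1)))
          ≡⟨ trans (ℤₚ.+-identityˡ _) (cong +_ (∑-*ˡ quadruples Z)) ⟩
        + (Z ℕ.* ∑ quadruples (λ t → ⟦ deg t ⟧ ℕ.* (M t ℕ.+ 1))) ∎
        where
        open ℤₚ.≤-Reasoning
        Z : ℕ
        Z = (B ℕ.* B) ℕ.* (B ℕ.* B)
        M : Quad → ℕ
        M t = ∑ quadruples (λ p → ⟦ cycle ρ t p ⟧)
        φ⁴≤ : ∀ t → ∣ φ⁴ φ t ∣ ℕ.≤ Z
        φ⁴≤ ((c , c′) , (d , d′)) = subst (ℕ._≤ Z)
          (sym (trans (ℤₚ.abs-* (φ c * φ c′) (φ d * φ d′)) (cong₂ ℕ._*_ (ℤₚ.abs-* (φ c) (φ c′)) (ℤₚ.abs-* (φ d) (φ d′)))))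
          (ℕₚ.*-mono-≤ (ℕₚ.*-mono-≤ (φ≤B c) (φ≤B c′)) (ℕₚ.*-mono-≤ (φ≤B d) (φ≤B d′)))
        -- For i ≥ 0 the summand Z m already dominates. For i < 0 the left side is at most 0, and
        -- the 1 in `m + 1` supplies the Z that outweighs `i`.
        i*m≤ : ∀ i m → ∣ i ∣ ℕ.≤ Z → i * + m ≤ i + + (Z ℕ.* (1 ℕ.* (m ℕ.+ 1)))
        i*m≤ (+ n) m le = subst₂ _≤_ (ℤₚ.pos-* n m) (ℤₚ.pos-+ n (Z ℕ.* (1 ℕ.* (m ℕ.+ 1)))) (+≤+
          (ℕₚ.≤-trans (ℕₚ.*-mono-≤ le (ℕₚ.≤-trans (ℕₚ.m≤m+n m 1) (ℕₚ.≤-reflexive (sym (ℕₚ.*-identityˡ _))))) (ℕₚ.m≤n+m _ n)))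
        i*m≤ -[1+ n ] m le = ℤₚ.≤-trans (ℤₚ.*-monoʳ-≤-nonNeg (+ m) { -[1+ n ]} {0ℤ} ℤ.-≤+)
          (ℤₚ.≤-trans (ℤₚ.≤-reflexive (sym (ℤₚ.+-inverseʳ -[1+ n ]))) (ℤₚ.+-monoʳ-≤ -[1+ n ] (+≤+
            (ℕₚ.≤-trans le (ℕₚ.≤-trans (ℕₚ.≤-reflexive (sym (ℕₚ.*-identityʳ Z)))
              (ℕₚ.*-monoʳ-≤ Z (ℕₚ.≤-trans (ℕₚ.m≤n+m 1 m) (ℕₚ.≤-reflexive (sym (ℕₚ.*-identityˡ _))))))))))
        pointwise : ∀ t → φ⁴ φ t * + M t ≤ φ⁴ φ t + + (Z ℕ.* (⟦ deg t ⟧ ℕ.* (M t ℕ.+ 1)))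
        pointwise t with deg t in eq
        ... | true  = i*m≤ (φ⁴ φ t) (M t) (φ⁴≤ t)
        ... | false = ℤₚ.≤-reflexive (trans (generic t eq) (sym (trans (cong (λ z → φ⁴ φ t + + z) (ℕₚ.*-zeroʳ Z)) (ℤₚ.+-identityʳ _))))

-- The case k = 3: generic label quadruples close up once, degenerate ones are few.

module IncidenceGeometry where

  open import Data.Bool using (Bool; true; not; _∧_)
  open import Data.Integer using (+_)
  open import Data.List using (List)
  import Data.Nat as ℕ
  open import Data.Nat using (ℕ; _≤_)
  import Data.Nat.Properties as ℕₚ
  open import Data.Product using (Σ; _×_; _,_; proj₁; proj₂)
  open import Relation.Binary.PropositionalEquality
  open import Relation.Nullary using (does)
  open import Relation.Nullary.Decidable using (dec-true; dec-false)
  open FiniteSums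
  open BinaryFields
  open DividedDifferences
  open FourCycles

  module Incidence (F : BinaryField) where
    open FieldTheory F
    open Interpolation F using (V)

    s : ℕ
    s = order F

    finiteV : Finite V
    finiteV = finite-× finite finite

    Vs : List V
    Vs = Finite.elems finiteV

    -- For fixed c with m ≢ 0 this is the graph of an involution of the plane.
    incident : V → V → V → Bool
    incident (m , w) (x , y) (x′ , y′) = does (x ≟ m * y′ + w) ∧ does (x′ ≟ m * y + w)

    nonzero : V → Bool
    nonzero (m , w) = not (does (m ≟ 0#))

    nonzero⇒ : ∀ c → nonzero c ≡ true → proj₁ c ≢ 0#
    nonzero⇒ (m , w) eq = does-false (m ≟ 0#) (not-true eq)

    ⇒nonzero : ∀ c → proj₁ c ≢ 0# → nonzero c ≡ true
    ⇒nonzero (m , w) m≢0 = cong not (dec-false (m ≟ 0#) m≢0)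

    incident⇒ : ∀ {m w x y x′ y′} → incident (m , w) (x , y) (x′ , y′) ≡ true → x ≡ m * y′ + w × x′ ≡ m * y + w
    incident⇒ {m} {w} {x} {y} {x′} {y′} eq = let (p , q) = ∧-true eq in
      does-true (x ≟ m * y′ + w) p , does-true (x′ ≟ m * y + w) q

    ⇒incident : ∀ {m w x y x′ y′} → x ≡ m * y′ + w → x′ ≡ m * y + w → incident (m , w) (x , y) (x′ , y′) ≡ true
    ⇒incident e e′ = ∧-intro (dec-true (_ ≟ _) e) (dec-true (_ ≟ _) e′)

    Quadruple : Set
    Quadruple = (V × V) × (V × V)

    finiteQ : Finite Quadruple
    finiteQ = finite-× (finite-× finiteV finiteV) (finite-× finiteV finiteV)

    cycleᵇ : Quadruple → Quadruple → Bool
    cycleᵇ = CauchySchwarz.cycle Vs incident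

    record Cycle (t p : Quadruple) : Set where
      constructor cyc
      m = proj₁ (proj₁ (proj₁ t)) ; w = proj₂ (proj₁ (proj₁ t))
      m′ = proj₁ (proj₂ (proj₁ t)) ; w′ = proj₂ (proj₂ (proj₁ t))
      n = proj₁ (proj₁ (proj₂ t)) ; v = proj₂ (proj₁ (proj₂ t))
      n′ = proj₁ (proj₂ (proj₂ t)) ; v′ = proj₂ (proj₂ (proj₂ t))
      xa = proj₁ (proj₁ (proj₁ p)) ; ya = proj₂ (proj₁ (proj₁ p))
      xa′ = proj₁ (proj₂ (proj₁ p)) ; ya′ = proj₂ (proj₂ (proj₁ p))
      xb = proj₁ (proj₁ (proj₂ p)) ; yb = proj₂ (proj₁ (proj₂ p))
      xb′ = proj₁ (proj₂ (proj₂ p)) ; yb′ = proj₂ (proj₂ (proj₂ p))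
      field
        ab   : xa  ≡ m  * yb  + w
        ba   : xb  ≡ m  * ya  + w
        ab′  : xa  ≡ m′ * yb′ + w′
        b′a  : xb′ ≡ m′ * ya  + w′
        a′b  : xa′ ≡ n  * yb  + v
        ba′  : xb  ≡ n  * ya′ + v
        a′b′ : xa′ ≡ n′ * yb′ + v′
        b′a′ : xb′ ≡ n′ * ya′ + v′

    cycle⇒ : ∀ t p → cycleᵇ t p ≡ true → Cycle t p
    cycle⇒ t p eq =
      let (l , r) = ∧-true eq ; (e₁ , e₂) = ∧-true l ; (e₃ , e₄) = ∧-true r
          (f₁ , g₁) = incident⇒ e₁ ; (f₂ , g₂) = incident⇒ e₂ ; (f₃ , g₃) = incident⇒ e₃ ; (f₄ , g₄) = incident⇒ e₄
      in cyc f₁ g₁ f₂ g₂ f₃ g₃ f₄ g₄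

    ⇒cycle : ∀ t p → Cycle t p → cycleᵇ t p ≡ true
    ⇒cycle t p (cyc f₁ g₁ f₂ g₂ f₃ g₃ f₄ g₄) =
      ∧-intro (∧-intro (⇒incident f₁ g₁) (⇒incident f₂ g₂)) (∧-intro (⇒incident f₃ g₃) (⇒incident f₄ g₄))

    abstract
      transpose : ∀ {a b w w′ z} → z ≡ a + w → z ≡ b + w′ → a + b ≡ w + w′
      transpose {a} {b} {w} {w′} e e′ = +≡0⇒≡ (trans
        (solve 4 (λ a b w w′ → (a :+ b) :+ (w :+ w′) := (a :+ w) :+ (b :+ w′)) refl a b w w′)
        (≡⇒+≡0 (trans (sym e) e′)))

    module _ {m m′ n n′ : K} (D≢0 : m * n′ + m′ * n ≢ 0#) where
      private
        D : K
        D = m * n′ + m′ * n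

      abstract
        cramer-unique : ∀ {u z u₁ z₁ a b} → m * u + m′ * z ≡ a → n * u + n′ * z ≡ b →
                        m * u₁ + m′ * z₁ ≡ a → n * u₁ + n′ * z₁ ≡ b → u ≡ u₁ × z ≡ z₁
        cramer-unique {u} {z} {u₁} {z₁} e f e₁ f₁ =
          *-cancelˡ D≢0 (trans (expand₁ u z) (trans (cong₂ (λ a b → n′ * a + m′ * b) (trans e (sym e₁)) (trans f (sym f₁))) (sym (expand₁ u₁ z₁)))) ,
          *-cancelˡ D≢0 (trans (expand₂ u z) (trans (cong₂ (λ a b → n * a + m * b) (trans e (sym e₁)) (trans f (sym f₁))) (sym (expand₂ u₁ z₁))))
          where
          expand₁ : ∀ u z → D * u ≡ n′ * (m * u + m′ * z) + m′ * (n * u + n′ * z)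
          expand₁ = solve 6 (λ m m′ n n′ u z → (m :* n′ :+ m′ :* n) :* u := n′ :* (m :* u :+ m′ :* z) :+ m′ :* (n :* u :+ n′ :* z)) refl m m′ n n′
          expand₂ : ∀ u z → D * z ≡ n * (m * u + m′ * z) + m * (n * u + n′ * z)
          expand₂ = solve 6 (λ m m′ n n′ u z → (m :* n′ :+ m′ :* n) :* z := n :* (m :* u :+ m′ :* z) :+ m :* (n :* u :+ n′ :* z)) refl m m′ n n′

      abstract
        cramer : ∀ a b → Σ K λ u → Σ K λ z → m * u + m′ * z ≡ a × n * u + n′ * z ≡ b
        cramer a b = inv D * (n′ * a + m′ * b) , inv D * (n * a + m * b) ,
          trans (solve 7 (λ m m′ n n′ a b i → m :* (i :* (n′ :* a :+ m′ :* b)) :+ m′ :* (i :* (n :* a :+ m :* b)) :=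
                   (i :* (m :* n′ :+ m′ :* n)) :* a) refl m m′ n n′ a b (inv D)) (cancel a) ,
          trans (solve 7 (λ m m′ n n′ a b i → n :* (i :* (n′ :* a :+ m′ :* b)) :+ n′ :* (i :* (n :* a :+ m :* b)) :=
                   (i :* (m :* n′ :+ m′ :* n)) :* b) refl m m′ n n′ a b (inv D)) (cancel b)
          where
          cancel : ∀ a → (inv D * D) * a ≡ a
          cancel a = trans (cong (_* a) (inv-* D D≢0)) (*-idˡ a)

    cycle-unique : ∀ {m w m′ w′ n v n′ v′ p p₁} → m * n′ + m′ * n ≢ 0# → m * n′ + n * m′ ≢ 0# →
      let t = ((m , w) , (m′ , w′)) , ((n , v) , (n′ , v′)) in Cycle t p → Cycle t p₁ → p ≡ p₁
    cycle-unique D≢0 D′≢0 (cyc f₁ g₁ f₂ g₂ f₃ g₃ f₄ g₄) (cyc h₁ k₁ h₂ k₂ h₃ k₃ h₄ k₄)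
      with cramer-unique D≢0 (transpose f₁ f₂) (transpose f₃ f₄) (transpose h₁ h₂) (transpose h₃ h₄)
         | cramer-unique D′≢0 (transpose g₁ g₃) (transpose g₂ g₄) (transpose k₁ k₃) (transpose k₂ k₄)
    ... | refl , refl | refl , refl with trans f₁ (sym h₁) | trans f₃ (sym h₃) | trans g₁ (sym k₁) | trans g₂ (sym k₂)
    ... | refl | refl | refl | refl = refl

    -- Eliminating the x-coordinates leaves one linear system for yb, yb′ and one for ya, ya′. Both
    -- have determinant m n′ + m′ n, so Cramer's rule gives existence and uniqueness.
    generic-cycle : (t : Quadruple) → let ((m , _) , (m′ , _)) , ((n , _) , (n′ , _)) = t in
                    m * n′ ≢ m′ * n → count finiteQ (cycleᵇ t) ≡ 1
    generic-cycle t@(((m , w) , (m′ , w′)) , ((n , v) , (n′ , v′))) ne =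
      ℕₚ.≤-antisym (count-unique finiteQ (cycleᵇ t) unique) (count-exists finiteQ (cycleᵇ t) p₀ (⇒cycle t p₀ exists))
      where
      D≢0 : m * n′ + m′ * n ≢ 0#
      D≢0 = +≢0 ne
      D′≢0 : m * n′ + n * m′ ≢ 0#
      D′≢0 = subst (λ z → m * n′ + z ≢ 0#) (*-comm m′ n) D≢0
      Y : Σ K λ u → Σ K λ z → m * u + m′ * z ≡ w + w′ × n * u + n′ * z ≡ v + v′
      Y = cramer D≢0 (w + w′) (v + v′)
      Y′ : Σ K λ u → Σ K λ z → m * u + n * z ≡ w + v × m′ * u + n′ * z ≡ w′ + v′
      Y′ = cramer D′≢0 (w + v) (w′ + v′)
      yb yb′ ya ya′ : K
      yb = proj₁ Y ; yb′ = proj₁ (proj₂ Y) ; ya = proj₁ Y′ ; ya′ = proj₁ (proj₂ Y′)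
      p₀ : Quadruple
      p₀ = ((m * yb + w , ya) , (n * yb + v , ya′)) , ((m * ya + w , yb) , (m′ * ya + w′ , yb′))
      back : ∀ {a b w w′} → a + b ≡ w + w′ → a + w ≡ b + w′
      back {a} {b} {w} {w′} e = +≡0⇒≡ (trans
        (solve 4 (λ a b w w′ → (a :+ w) :+ (b :+ w′) := (a :+ b) :+ (w :+ w′)) refl a b w w′) (≡⇒+≡0 e))
      exists : Cycle t p₀
      exists = cyc refl refl (back (proj₁ (proj₂ (proj₂ Y)))) refl refl (back (proj₁ (proj₂ (proj₂ Y′))))
                   (back (proj₂ (proj₂ (proj₂ Y)))) (back (proj₂ (proj₂ (proj₂ Y′))))
      unique : ∀ p p₁ → cycleᵇ t p ≡ true → cycleᵇ t p₁ ≡ true → p ≡ p₁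
      unique p p₁ e e₁ = cycle-unique D≢0 D′≢0 (cycle⇒ t p e) (cycle⇒ t p₁ e₁)

    -- Only nonzero slopes are included, since a quadruple with a zero slope will carry weight 0.
    degenerate : Quadruple → Bool
    degenerate ((c@(m , _) , c′@(m′ , _)) , (d@(n , _) , d′@(n′ , _))) =
      ((nonzero c ∧ nonzero c′) ∧ (nonzero d ∧ nonzero d′)) ∧ does (m * n′ ≟ m′ * n)

    -- Seven parameters against the eight coordinates of a label quadruple. This saved factor `s`,
    -- in the count of degenerate quadruples and of their cycles, is the whole gain of the
    -- discrepancy bound.
    K⁷ : Set
    K⁷ = ((K × K) × (K × K)) × ((K × K) × K)

    finite⁷ : Finite K⁷
    finite⁷ = finite-× (finite-× (finite-× finite finite) (finite-× finite finite)) (finite-× (finite-× finite finite) finite)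

    size-× : {A B : Set} (F : Finite A) (G : Finite B) → size (finite-× F G) ≡ size F ℕ.* size G
    size-× F G = length-cartesianProduct (Finite.elems F) (Finite.elems G)

    size⁷ : size finite⁷ ≡ ((s ℕ.* s) ℕ.* (s ℕ.* s)) ℕ.* ((s ℕ.* s) ℕ.* s)
    size⁷ = trans (size-× (finite-× (finite-× finite finite) (finite-× finite finite)) (finite-× (finite-× finite finite) finite))
      (cong₂ ℕ._*_ (trans (size-× (finite-× finite finite) (finite-× finite finite)) (cong₂ ℕ._*_ (size-× finite finite) (size-× finite finite)))
        (trans (size-× (finite-× finite finite) finite) (cong (ℕ._* s) (size-× finite finite))))

    record Degenerate (t : Quadruple) : Set where
      constructor degen
      field
        m≢0 : proj₁ (proj₁ (proj₁ t)) ≢ 0#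
        n≢0 : proj₁ (proj₁ (proj₂ t)) ≢ 0#
        det : proj₁ (proj₁ (proj₁ t)) * proj₁ (proj₂ (proj₂ t)) ≡ proj₁ (proj₂ (proj₁ t)) * proj₁ (proj₁ (proj₂ t))

    degenerate⇒ : ∀ t → degenerate t ≡ true → Degenerate t
    degenerate⇒ ((c , c′) , (d , d′)) eq =
      let (l , r) = ∧-true eq ; (l₁ , l₂) = ∧-true l in
      degen (nonzero⇒ c (proj₁ (∧-true l₁))) (nonzero⇒ d (proj₁ (∧-true l₂))) (does-true (_ ≟ _) r)

    -- As m ≢ 0, the vanishing determinant recovers n′ from the other three slopes; the four
    -- intercepts are free.
    degenerate-count : count finiteQ degenerate ≤ size finite⁷
    degenerate-count = count-injection finiteQ finite⁷ degenerate
      (λ { (((m , w) , (m′ , w′)) , ((n , v) , (n′ , v′))) → ((w , w′) , (v , v′)) , ((m , m′) , n) }) injective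
      where
      injective : ∀ t t₁ → degenerate t ≡ true → degenerate t₁ ≡ true → _ → t ≡ t₁
      injective t t₁ e e₁ refl with degenerate⇒ t e | degenerate⇒ t₁ e₁
      ... | degen m≢0 _ det | degen _ _ det₁ with *-cancelˡ m≢0 (trans det (sym det₁))
      ... | refl = refl

    abstract
      solve-for : ∀ {a b w w′ z} → z ≡ a + w → z ≡ b + w′ → w′ ≡ w + (a + b)
      solve-for {a} {b} {w} {w′} e e′ = +≡0⇒≡ (trans
        (solve 4 (λ a b w w′ → w′ :+ (w :+ (a :+ b)) := (a :+ w) :+ (b :+ w′)) refl a b w w′)
        (≡⇒+≡0 (trans (sym e) e′)))

    -- Slopes, nodes and the single intercept `w` determine everything: two sides meeting at a
    -- vertex relate their intercepts, which gives w′, v and then v′, and the x-coordinates follow.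
    rigid : ∀ {m w m′ w′ n v n′ v′ xa ya xa′ ya′ xb yb xb′ yb′ w′₁ v₁ v′₁ xa₁ xa′₁ xb₁ xb′₁} →
      let t = ((m , w) , (m′ , w′)) , ((n , v) , (n′ , v′)) ; p = ((xa , ya) , (xa′ , ya′)) , ((xb , yb) , (xb′ , yb′))
          t₁ = ((m , w) , (m′ , w′₁)) , ((n , v₁) , (n′ , v′₁)) ; p₁ = ((xa₁ , ya) , (xa′₁ , ya′)) , ((xb₁ , yb) , (xb′₁ , yb′))
      in Cycle t p → Cycle t₁ p₁ → (t , p) ≡ (t₁ , p₁)
    rigid (cyc f₁ g₁ f₂ g₂ f₃ g₃ f₄ g₄) (cyc h₁ k₁ h₂ k₂ h₃ k₃ h₄ k₄)
      with trans (solve-for f₁ f₂) (sym (solve-for h₁ h₂)) | trans (solve-for g₁ g₃) (sym (solve-for k₁ k₃))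
    ... | refl | refl with trans (solve-for f₃ f₄) (sym (solve-for h₃ h₄))
    ... | refl with trans f₁ (sym h₁) | trans f₃ (sym h₃) | trans g₁ (sym k₁) | trans g₂ (sym k₂)
    ... | refl | refl | refl | refl = refl

    abstract
      -- The relations between intercepts at the four vertices add up to a condition on slopes and
      -- nodes alone. It can be solved for ya′ whenever n ≢ n′.
      constraint : ∀ {m w m′ w′ n v n′ v′ xa ya xa′ ya′ xb yb xb′ yb′} →
        Cycle (((m , w) , (m′ , w′)) , ((n , v) , (n′ , v′))) (((xa , ya) , (xa′ , ya′)) , ((xb , yb) , (xb′ , yb′))) →
        (n + n′) * ya′ ≡ (m * yb + m′ * yb′) + (n * yb + n′ * yb′) + (m * ya + m′ * ya)
      constraint {m} {w} {m′} {w′} {n} {v} {n′} {v′} {ya = ya} {ya′ = ya′} {yb = yb} {yb′ = yb′} (cyc f₁ g₁ f₂ g₂ f₃ g₃ f₄ g₄) = begin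
        (n + n′) * ya′
          ≡⟨ solve 6 (λ m m′ n n′ ya ya′ → (n :+ n′) :* ya′ := ((m :* ya :+ n :* ya′) :+ (m′ :* ya :+ n′ :* ya′)) :+ (m :* ya :+ m′ :* ya)) refl m m′ n n′ ya ya′ ⟩
        ((m * ya + n * ya′) + (m′ * ya + n′ * ya′)) + (m * ya + m′ * ya)
          ≡⟨ cong₂ (λ p q → (p + q) + (m * ya + m′ * ya)) (transpose g₁ g₃) (transpose g₂ g₄) ⟩
        ((w + v) + (w′ + v′)) + (m * ya + m′ * ya)
          ≡⟨ cong (_+ (m * ya + m′ * ya)) (solve 4 (λ w v w′ v′ → (w :+ v) :+ (w′ :+ v′) := (w :+ w′) :+ (v :+ v′)) refl w v w′ v′) ⟩
        ((w + w′) + (v + v′)) + (m * ya + m′ * ya)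
          ≡⟨ cong₂ (λ p q → (p + q) + (m * ya + m′ * ya)) (transpose f₁ f₂) (transpose f₃ f₄) ⟨
        (m * yb + m′ * yb′) + (n * yb + n′ * yb′) + (m * ya + m′ * ya) ∎
        where open ≡-Reasoning

    finiteQQ : Finite (Quadruple × Quadruple)
    finiteQQ = finite-× finiteQ finiteQ

    degenerateCycle equalSlopes : Quadruple × Quadruple → Bool
    degenerateCycle (t , p) = degenerate t ∧ cycleᵇ t p
    equalSlopes ((((m , _) , (m′ , _)) , _) , _) = does (m ≟ m′)

    -- If m ≡ m′, the determinant gives n ≡ n′, and two slopes, one intercept and four nodes remain.
    -- Otherwise n ≢ n′, so `constraint` recovers ya′, and three slopes, one intercept and three
    -- nodes remain. Both cases have seven parameters.
    degenerate-cycle-count : count finiteQQ degenerateCycle ≤ size finite⁷ ℕ.+ size finite⁷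
    degenerate-cycle-count = ℕₚ.≤-trans (ℕₚ.≤-reflexive (count-split finiteQQ degenerateCycle equalSlopes))
      (ℕₚ.+-mono-≤
        (count-injection finiteQQ finite⁷ (λ z → degenerateCycle z ∧ equalSlopes z)
          (λ { ((((m , w) , _) , ((n , _) , _)) , (((_ , ya) , (_ , ya′)) , ((_ , yb) , (_ , yb′)))) → ((m , n) , (w , ya)) , ((yb , yb′) , ya′) })
          inj-equal)
        (count-injection finiteQQ finite⁷ (λ z → degenerateCycle z ∧ not (equalSlopes z))
          (λ { ((((m , w) , (m′ , _)) , ((n , _) , _)) , (((_ , ya) , _) , ((_ , yb) , (_ , yb′)))) → ((m , m′) , (n , w)) , ((yb , yb′) , ya) })
          inj-unequal))
      where
      split : ∀ t p b → (degenerate t ∧ cycleᵇ t p) ∧ b ≡ true → Degenerate t × Cycle t p × b ≡ true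
      split t p b eq =
        let (l , r) = ∧-true {degenerate t ∧ cycleᵇ t p} eq ; (dg , cy) = ∧-true {degenerate t} l
        in degenerate⇒ t dg , cycle⇒ t p cy , r
      inj-equal : ∀ z z₁ → degenerateCycle z ∧ equalSlopes z ≡ true → degenerateCycle z₁ ∧ equalSlopes z₁ ≡ true → _ → z ≡ z₁
      inj-equal z@((((m , w) , (m′ , w′)) , ((n , v) , (n′ , v′))) , p) z₁@((((m₁ , w₁) , (m′₁ , w′₁)) , ((n₁ , v₁) , (n′₁ , v′₁))) , p₁) e e₁ refl
        with split (proj₁ z) p _ e | split (proj₁ z₁) p₁ _ e₁
      ... | degen m≢0 _ det , cy , es | degen _ _ det₁ , cy₁ , es₁ with does-true (m ≟ m′) es | does-true (m₁ ≟ m′₁) es₁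
      ... | refl | refl with *-cancelˡ m≢0 (trans det (sym det₁))
      ... | refl = rigid cy cy₁
      inj-unequal : ∀ z z₁ → degenerateCycle z ∧ not (equalSlopes z) ≡ true → degenerateCycle z₁ ∧ not (equalSlopes z₁) ≡ true → _ → z ≡ z₁
      inj-unequal z@((((m , w) , (m′ , w′)) , ((n , v) , (n′ , v′))) , p) z₁@((((m₁ , w₁) , (m′₁ , w′₁)) , ((n₁ , v₁) , (n′₁ , v′₁))) , p₁) e e₁ refl
        with split (proj₁ z) p _ e | split (proj₁ z₁) p₁ _ e₁
      ... | degen m≢0 n≢0 det , cy , es | degen _ _ det₁ , cy₁ , _ with *-cancelˡ m≢0 (trans det (sym det₁))
      ... | refl with *-cancelˡ (+≢0 n≢n′) (trans (constraint cy) (sym (constraint cy₁)))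
        where
        n≢n′ : n ≢ n′
        n≢n′ refl = does-false (m ≟ m′) (not-true es) (*-cancelˡ n≢0 (trans (*-comm n m) (trans det (*-comm m′ n))))
      ... | refl = rigid cy cy₁

-- Pseudorandomness of the incidence system.

module DiscrepancyBound where

  open import Data.Bool using (Bool; true; false; _∧_)
  import Data.Integer as ℤ
  open import Data.Integer using (ℤ; +_; ∣_∣; 0ℤ; +≤+)
  import Data.Integer.Properties as ℤₚ
  import Data.Integer.Solver as ℤ-Solver
  open import Data.List using (List; []; _∷_)
  import Data.Nat as ℕ
  open import Data.Nat using (ℕ; _+_; _*_; _≤_; _^_)
  import Data.Nat.Properties as ℕₚ
  import Data.Nat.Solver as ℕ-Solver
  open import Data.Product using (_×_; _,_; proj₁)
  open import Function using (_∘_)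
  open import Relation.Binary.PropositionalEquality
  open import Relation.Nullary using (yes; no)
  open FiniteSums
  open BinaryFields
  open DividedDifferences
  open FourCycles
  open IncidenceGeometry

  module Discrepancy (F : BinaryField) where
    open FieldTheory F using (finite; _≟_)
    private module 𝔽 = FieldTheory F
    open Interpolation F using (V)
    open Incidence F
    open CauchySchwarz using (∑ᶻ; ∑ᶻ-cong; ∑ᶻ-pos; φ⁴; fourCycles; fourCycles-bound; bilinear⁴≤fourCycles; i*i≡∣i∣*∣i∣)

    q : ℕ
    q = size finiteV

    q≡s*s : q ≡ s * s
    q≡s*s = size-× finite finite

    lines : ℕ
    lines = count finiteV nonzero

    edges : (W A B : V → Bool) → ℕ
    edges W A B = ∑ Vs λ a → ⟦ A a ⟧ * ∑ Vs λ b → ⟦ B b ⟧ * ∑ Vs λ c → ⟦ incident c a b ⟧ * ⟦ W c ⟧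

    abstract
      weighted-difference : {X : Set} (xs : List X) (β : X → ℕ) (p r : ℕ) (f g : X → ℕ) →
        ∑ᶻ xs (λ x → + β x ℤ.* (+ (p * f x) ℤ.- + (r * g x))) ≡
        + (p * ∑ xs (λ x → β x * f x)) ℤ.- + (r * ∑ xs (λ x → β x * g x))
      weighted-difference [] β p r f g rewrite ℕₚ.*-zeroʳ p | ℕₚ.*-zeroʳ r = refl
      weighted-difference (x ∷ xs) β p r f g = begin
        + β x ℤ.* (+ (p * f x) ℤ.- + (r * g x)) ℤ.+ ∑ᶻ xs (λ x → + β x ℤ.* (+ (p * f x) ℤ.- + (r * g x)))
          ≡⟨ cong (ℤ._+_ (+ β x ℤ.* (+ (p * f x) ℤ.- + (r * g x)))) (weighted-difference xs β p r f g) ⟩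
        + β x ℤ.* (+ (p * f x) ℤ.- + (r * g x)) ℤ.+ (+ (p * S) ℤ.- + (r * S′))
          ≡⟨ cong₂ (λ u v → + β x ℤ.* u ℤ.+ v) (cong₂ ℤ._-_ (ℤₚ.pos-* p (f x)) (ℤₚ.pos-* r (g x))) (cong₂ ℤ._-_ (ℤₚ.pos-* p S) (ℤₚ.pos-* r S′)) ⟩
        + β x ℤ.* (+ p ℤ.* + f x ℤ.- + r ℤ.* + g x) ℤ.+ (+ p ℤ.* + S ℤ.- + r ℤ.* + S′)
          ≡⟨ solve 7 (λ b p r f g S S′ → b :* (p :* f :- r :* g) :+ (p :* S :- r :* S′) := p :* (b :* f :+ S) :- r :* (b :* g :+ S′)) refl
               (+ β x) (+ p) (+ r) (+ f x) (+ g x) (+ S) (+ S′) ⟩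
        + p ℤ.* (+ β x ℤ.* + f x ℤ.+ + S) ℤ.- + r ℤ.* (+ β x ℤ.* + g x ℤ.+ + S′)
          ≡⟨ cong₂ ℤ._-_ (hom p (f x) S) (hom r (g x) S′) ⟨
        + (p * (β x * f x + S)) ℤ.- + (r * (β x * g x + S′)) ∎
        where
        open ≡-Reasoning
        open ℤ-Solver.+-*-Solver using (solve; _:=_; _:+_; _:*_; _:-_)
        S S′ : ℕ
        S = ∑ xs (λ x → β x * f x)
        S′ = ∑ xs (λ x → β x * g x)
        hom : ∀ p f S → + (p * (β x * f + S)) ≡ + p ℤ.* (+ β x ℤ.* + f ℤ.+ + S)
        hom p f S = trans (ℤₚ.pos-* p _) (cong (+ p ℤ.*_) (trans (ℤₚ.pos-+ (β x * f) S) (cong (ℤ._+ + S) (ℤₚ.pos-* (β x) f))))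

    ∣m-n∣≤ : ∀ m n o → m ≤ o → n ≤ o → ∣ + m ℤ.- + n ∣ ≤ o
    ∣m-n∣≤ m n o m≤o n≤o = subst (_≤ o) (cong ∣_∣ (sym (ℤₚ.m-n≡m⊖n m n))) (bound m n m≤o n≤o)
      where
      bound : ∀ m n → m ≤ o → n ≤ o → ∣ m ℤ.⊖ n ∣ ≤ o
      bound m n m≤o n≤o with m ℕₚ.≤? n
      ... | yes m≤n = ℕₚ.≤-trans (ℕₚ.≤-reflexive (ℤₚ.∣⊖∣-≤ m≤n)) (ℕₚ.≤-trans (ℕₚ.m∸n≤m n m) n≤o)
      ... | no m≰n = ℕₚ.≤-trans (ℕₚ.≤-reflexive (trans (ℤₚ.∣m⊖n∣≡∣n⊖m∣ m n) (ℤₚ.∣⊖∣-≤ (ℕₚ.<⇒≤ (ℕₚ.≰⇒> m≰n))))) (ℕₚ.≤-trans (ℕₚ.m∸n≤m m n) m≤o)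

    ∣m-n∣-bounds : ∀ m n → let e = ∣ + m ℤ.- + n ∣ in m ≤ n + e × n ≤ m + e
    ∣m-n∣-bounds m n rewrite ℤₚ.m-n≡m⊖n m n with m ℕₚ.≤? n
    ... | yes m≤n rewrite ℤₚ.∣⊖∣-≤ m≤n = ℕₚ.≤-trans m≤n (ℕₚ.m≤m+n n _) , ℕₚ.≤-reflexive (sym (ℕₚ.m+[n∸m]≡n m≤n))
    ... | no m≰n rewrite ℤₚ.∣m⊖n∣≡∣n⊖m∣ m n | ℤₚ.∣⊖∣-≤ (ℕₚ.<⇒≤ (ℕₚ.≰⇒> m≰n)) =
      ℕₚ.≤-reflexive (sym (ℕₚ.m+[n∸m]≡n (ℕₚ.<⇒≤ (ℕₚ.≰⇒> m≰n)))) , ℕₚ.≤-trans (ℕₚ.<⇒≤ (ℕₚ.≰⇒> m≰n)) (ℕₚ.m≤m+n m _)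

    degenerate-sum : ∑ (CauchySchwarz.quadruples Vs) (λ t → ⟦ degenerate t ⟧ * (count finiteQ (cycleᵇ t) + 1)) ≤ 3 * size finite⁷
    degenerate-sum = begin
      ∑ Qs (λ t → ⟦ degenerate t ⟧ * (count finiteQ (cycleᵇ t) + 1))
        ≡⟨ ∑-cong Qs (λ t → trans (ℕₚ.*-distribˡ-+ ⟦ degenerate t ⟧ _ 1) (cong (λ z → ⟦ degenerate t ⟧ * count finiteQ (cycleᵇ t) + z) (ℕₚ.*-identityʳ ⟦ degenerate t ⟧))) ⟩
      ∑ Qs (λ t → ⟦ degenerate t ⟧ * count finiteQ (cycleᵇ t) + ⟦ degenerate t ⟧)
        ≡⟨ ∑-+ Qs ⟩
      ∑ Qs (λ t → ⟦ degenerate t ⟧ * count finiteQ (cycleᵇ t)) + count finiteQ degenerate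
        ≡⟨ cong (_+ count finiteQ degenerate) (trans (∑-× Qs Qs) (∑-cong Qs (λ t →
             trans (∑-cong Qs (λ p → ⟦∧⟧ (degenerate t) (cycleᵇ t p))) (∑-*ˡ Qs ⟦ degenerate t ⟧)))) ⟨
      count finiteQQ degenerateCycle + count finiteQ degenerate
        ≤⟨ ℕₚ.+-mono-≤ degenerate-cycle-count degenerate-count ⟩
      size finite⁷ + size finite⁷ + size finite⁷
        ≡⟨ solve 1 (λ x → x :+ x :+ x := con 3 :* x) refl (size finite⁷) ⟩
      3 * size finite⁷ ∎
      where
      open ℕₚ.≤-Reasoning
      open ℕ-Solver.+-*-Solver using (solve; _:=_; _:+_; _:*_; con)
      Qs : List Quadruple
      Qs = CauchySchwarz.quadruples Vs

    sloped : (V → Bool) → V → Bool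
    sloped U c = nonzero c ∧ U c

    ∣sloped∣ : (V → Bool) → ℕ
    ∣sloped∣ U = count finiteV (sloped U)

    module _ (A B U : V → Bool) where

      -- The deviation from the expected proportion `∣sloped∣ U / lines` of all edges between `A`
      -- and `B`, multiplied by `lines` to stay in the integers.
      discrepancy : ℕ
      discrepancy = ∣ + (lines * edges (sloped U) A B) ℤ.- + (∣sloped∣ U * edges nonzero A B) ∣

      private
        -- The indicator of `U` on the labels of nonzero slope, centred and cleared of denominators.
        -- It has total 0 and vanishes on labels of slope 0.
        φ : V → ℤ
        φ c = + (lines * ⟦ sloped U c ⟧) ℤ.- + (∣sloped∣ U * ⟦ nonzero c ⟧)

        G : V → V → ℤ
        G a b = ∑ᶻ Vs (λ c → φ c ℤ.* + ⟦ incident c a b ⟧)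

        u≤lines : ∣sloped∣ U ≤ lines
        u≤lines = ∑-mono Vs (λ c → ⟦⟧-mono {sloped U c} (λ e → proj₁ (∧-true {nonzero c} e)))

        lines≤q : lines ≤ q
        lines≤q = Finite.count≤size finiteV nonzero

        φ≤q : ∀ c → ∣ φ c ∣ ≤ q
        φ≤q c = ∣m-n∣≤ _ _ q
          (ℕₚ.≤-trans (ℕₚ.*-monoʳ-≤ lines (⟦⟧≤1 (sloped U c))) (ℕₚ.≤-trans (ℕₚ.≤-reflexive (ℕₚ.*-identityʳ lines)) lines≤q))
          (ℕₚ.≤-trans (ℕₚ.*-monoʳ-≤ (∣sloped∣ U) (⟦⟧≤1 (nonzero c))) (ℕₚ.≤-trans (ℕₚ.≤-reflexive (ℕₚ.*-identityʳ (∣sloped∣ U))) (ℕₚ.≤-trans u≤lines lines≤q)))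

        ∑φ≡0 : ∑ᶻ Vs φ ≡ 0ℤ
        ∑φ≡0 = begin
          ∑ᶻ Vs φ
            ≡⟨ ∑ᶻ-cong Vs (λ c → sym (ℤₚ.*-identityˡ (φ c))) ⟩
          ∑ᶻ Vs (λ c → + 1 ℤ.* φ c)
            ≡⟨ weighted-difference Vs (λ _ → 1) lines (∣sloped∣ U) (λ c → ⟦ sloped U c ⟧) (λ c → ⟦ nonzero c ⟧) ⟩
          + (lines * ∑ Vs (λ c → 1 * ⟦ sloped U c ⟧)) ℤ.- + (∣sloped∣ U * ∑ Vs (λ c → 1 * ⟦ nonzero c ⟧))
            ≡⟨ cong₂ (λ x y → + (lines * x) ℤ.- + (∣sloped∣ U * y)) (∑-cong Vs (λ c → ℕₚ.*-identityˡ ⟦ sloped U c ⟧)) (∑-cong Vs (λ c → ℕₚ.*-identityˡ ⟦ nonzero c ⟧)) ⟩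
          + (lines * ∣sloped∣ U) ℤ.- + (∣sloped∣ U * lines)
            ≡⟨ trans (cong (λ x → + x ℤ.- + (∣sloped∣ U * lines)) (ℕₚ.*-comm lines (∣sloped∣ U))) (ℤₚ.+-inverseʳ (+ (∣sloped∣ U * lines))) ⟩
          0ℤ ∎
          where open ≡-Reasoning

        φ-vanishes : ∀ c → nonzero c ≡ false → φ c ≡ 0ℤ
        φ-vanishes c eq rewrite eq | ℕₚ.*-zeroʳ lines | ℕₚ.*-zeroʳ (∣sloped∣ U) = refl

        generic : ∀ t → degenerate t ≡ false → φ⁴ Vs φ t ℤ.* + count finiteQ (cycleᵇ t) ≡ φ⁴ Vs φ t
        generic t@((c@(m , _) , c′@(m′ , _)) , (d@(n , _) , d′@(n′ , _))) eq =
          cases (nonzero c) (nonzero c′) (nonzero d) (nonzero d′) _ eq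
            (λ e → absorb (cong (λ z → (z ℤ.* φ c′) ℤ.* (φ d ℤ.* φ d′)) (φ-vanishes c e)))
            (λ e → absorb (trans (cong (λ z → (φ c ℤ.* z) ℤ.* (φ d ℤ.* φ d′)) (φ-vanishes c′ e)) (cong (ℤ._* (φ d ℤ.* φ d′)) (ℤₚ.*-zeroʳ (φ c)))))
            (λ e → absorb (trans (cong (λ z → (φ c ℤ.* φ c′) ℤ.* (z ℤ.* φ d′)) (φ-vanishes d e)) (ℤₚ.*-zeroʳ (φ c ℤ.* φ c′))))
            (λ e → absorb (trans (cong (λ z → (φ c ℤ.* φ c′) ℤ.* (φ d ℤ.* z)) (φ-vanishes d′ e))
                     (trans (cong ((φ c ℤ.* φ c′) ℤ.*_) (ℤₚ.*-zeroʳ (φ d))) (ℤₚ.*-zeroʳ (φ c ℤ.* φ c′)))))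
            (λ e → trans (cong (λ M → φ⁴ Vs φ t ℤ.* + M) (generic-cycle t (does-false (m 𝔽.* n′ ≟ m′ 𝔽.* n) e))) (ℤₚ.*-identityʳ (φ⁴ Vs φ t)))
          where
          absorb : ∀ {i j} → i ≡ 0ℤ → i ℤ.* j ≡ i
          absorb refl = refl
          cases : {R : Set} → ∀ v w x y z → ((v ∧ w) ∧ (x ∧ y)) ∧ z ≡ false →
                  (v ≡ false → R) → (w ≡ false → R) → (x ≡ false → R) → (y ≡ false → R) → (z ≡ false → R) → R
          cases false _ _ _ _ _ f _ _ _ _ = f refl
          cases true false _ _ _ _ _ f _ _ _ = f refl
          cases true true false _ _ _ _ _ f _ _ = f refl
          cases true true true false _ _ _ _ _ f _ = f refl
          cases true true true true false _ _ _ _ _ f = f refl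

        T : ℤ
        T = ∑ᶻ Vs (λ a → + ⟦ A a ⟧ ℤ.* ∑ᶻ Vs (λ b → + ⟦ B b ⟧ ℤ.* G a b))

        T≡ : T ≡ + (lines * edges (sloped U) A B) ℤ.- + (∣sloped∣ U * edges nonzero A B)
        T≡ = begin
          T ≡⟨ ∑ᶻ-cong Vs (λ a → cong (+ ⟦ A a ⟧ ℤ.*_) (trans
                 (∑ᶻ-cong Vs (λ b → cong (+ ⟦ B b ⟧ ℤ.*_) (trans (∑ᶻ-cong Vs (λ c → ℤₚ.*-comm (φ c) (+ ⟦ incident c a b ⟧)))
                   (weighted-difference Vs (λ c → ⟦ incident c a b ⟧) lines (∣sloped∣ U) (λ c → ⟦ sloped U c ⟧) (λ c → ⟦ nonzero c ⟧)))))
                 (weighted-difference Vs (λ b → ⟦ B b ⟧) lines (∣sloped∣ U) _ _))) ⟩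
          ∑ᶻ Vs (λ a → + ⟦ A a ⟧ ℤ.* (+ (lines * ∑ Vs (λ b → ⟦ B b ⟧ * ∑ Vs λ c → ⟦ incident c a b ⟧ * ⟦ sloped U c ⟧))
                                 ℤ.- + (∣sloped∣ U * ∑ Vs (λ b → ⟦ B b ⟧ * ∑ Vs λ c → ⟦ incident c a b ⟧ * ⟦ nonzero c ⟧))))
            ≡⟨ weighted-difference Vs (λ a → ⟦ A a ⟧) lines (∣sloped∣ U) _ _ ⟩
          + (lines * edges (sloped U) A B) ℤ.- + (∣sloped∣ U * edges nonzero A B) ∎
          where open ≡-Reasoning

        idempotent : ∀ b → + ⟦ b ⟧ ℤ.* + ⟦ b ⟧ ≡ + ⟦ b ⟧
        idempotent true  = refl
        idempotent false = refl

      -- The two outer factors `q * q` bound the squared sizes of `A` and `B`; the fourth power of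
      -- `q` bounds the weights of four labels; the rest is `degenerate-sum`.
      discrepancy⁴ : (discrepancy * discrepancy) * (discrepancy * discrepancy) ≤
                     (q * q) * ((q * q) * (((q * q) * (q * q)) * (3 * size finite⁷)))
      discrepancy⁴ = ℤₚ.drop‿+≤+ (begin
        + ((e * e) * (e * e))
          ≡⟨ trans (ℤₚ.pos-* (e * e) (e * e)) (cong₂ ℤ._*_ sq sq) ⟩
        (T ℤ.* T) ℤ.* (T ℤ.* T)
          ≤⟨ bilinear⁴≤fourCycles Vs (λ a → + ⟦ A a ⟧) (λ b → + ⟦ B b ⟧) G (idempotent ∘ A) (idempotent ∘ B) ⟩
        (α ℤ.* α) ℤ.* ((β ℤ.* β) ℤ.* fourCycles Vs G)
          ≤⟨ ℤₚ.*-monoˡ-≤-nonNeg (α ℤ.* α) {{ℤ.nonNegative (CauchySchwarz.0≤i*i α)}}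
               (ℤₚ.*-monoˡ-≤-nonNeg (β ℤ.* β) {{ℤ.nonNegative (CauchySchwarz.0≤i*i β)}} cycles≤) ⟩
        (α ℤ.* α) ℤ.* ((β ℤ.* β) ℤ.* + (((q * q) * (q * q)) * (3 * size finite⁷)))
          ≡⟨ trans (cong₂ (λ x y → (x ℤ.* x) ℤ.* ((y ℤ.* y) ℤ.* + R)) (∑ᶻ-pos Vs (λ a → ⟦ A a ⟧)) (∑ᶻ-pos Vs (λ b → ⟦ B b ⟧))) (sym (hom (count finiteV A) (count finiteV B) R)) ⟩
        + ((a₀ * a₀) * ((b₀ * b₀) * R))
          ≤⟨ +≤+ (ℕₚ.*-mono-≤ (ℕₚ.*-mono-≤ a₀≤ a₀≤) (ℕₚ.*-monoˡ-≤ R (ℕₚ.*-mono-≤ b₀≤ b₀≤))) ⟩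
        + ((q * q) * ((q * q) * R)) ∎)
        where
        open ℤₚ.≤-Reasoning
        e a₀ b₀ R : ℕ
        e = discrepancy
        a₀ = count finiteV A
        b₀ = count finiteV B
        R = ((q * q) * (q * q)) * (3 * size finite⁷)
        a₀≤ : a₀ ≤ q
        a₀≤ = Finite.count≤size finiteV A
        b₀≤ : b₀ ≤ q
        b₀≤ = Finite.count≤size finiteV B
        α β : ℤ
        α = ∑ᶻ Vs (λ a → + ⟦ A a ⟧)
        β = ∑ᶻ Vs (λ b → + ⟦ B b ⟧)
        sq : + (e * e) ≡ T ℤ.* T
        sq = trans (sym (i*i≡∣i∣*∣i∣ (+ (lines * edges (sloped U) A B) ℤ.- + (∣sloped∣ U * edges nonzero A B)))) (sym (cong₂ ℤ._*_ T≡ T≡))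
        hom : ∀ x y r → + ((x * x) * ((y * y) * r)) ≡ (+ x ℤ.* + x) ℤ.* ((+ y ℤ.* + y) ℤ.* + r)
        hom x y r = trans (ℤₚ.pos-* (x * x) _) (cong₂ ℤ._*_ (ℤₚ.pos-* x x) (trans (ℤₚ.pos-* (y * y) r) (cong (ℤ._* + r) (ℤₚ.pos-* y y))))
        cycles≤ : fourCycles Vs G ℤ.≤ + R
        cycles≤ = ℤₚ.≤-trans (fourCycles-bound Vs φ incident q degenerate ∑φ≡0 φ≤q generic)
          (+≤+ (ℕₚ.*-monoʳ-≤ ((q * q) * (q * q)) degenerate-sum))

      -- With q = s² the fourth power is at most 3 s²³, while `s ^ 6` has fourth power s²⁴. The
      -- spare factor s / 3 pays for L⁴.
      discrepancy-small : ∀ L → 3 * L ^ 4 ≤ s → L * discrepancy ≤ s ^ 6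
      discrepancy-small L small = ℕₚ.≮⇒≥ (λ lt → ℕₚ.<-irrefl refl (begin-strict
        (s ^ 6) ^ 4                                    <⟨ ℕₚ.^-monoˡ-< 4 lt ⟩
        (L * e) ^ 4                                    ≡⟨ solve 2 (λ L e → (L :* e) :^ 4 := L :^ 4 :* ((e :* e) :* (e :* e))) refl L e ⟩
        L ^ 4 * ((e * e) * (e * e))                    ≤⟨ ℕₚ.*-monoʳ-≤ (L ^ 4) discrepancy⁴ ⟩
        L ^ 4 * ((q * q) * ((q * q) * (((q * q) * (q * q)) * (3 * size finite⁷))))
          ≡⟨ cong₂ (λ x y → L ^ 4 * ((x * x) * ((x * x) * (((x * x) * (x * x)) * (3 * y))))) q≡s*s size⁷ ⟩
        L ^ 4 * (((s * s) * (s * s)) * (((s * s) * (s * s)) * ((((s * s) * (s * s)) * ((s * s) * (s * s))) * (3 * (((s * s) * (s * s)) * ((s * s) * s))))))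
          ≡⟨ solve 2 (λ l s → l :* (((s :* s) :* (s :* s)) :* (((s :* s) :* (s :* s)) :* ((((s :* s) :* (s :* s)) :* ((s :* s) :* (s :* s))) :* (con 3 :* (((s :* s) :* (s :* s)) :* ((s :* s) :* s))))))
               := (con 3 :* l) :* s :^ 23) refl (L ^ 4) s ⟩
        (3 * L ^ 4) * s ^ 23                           ≤⟨ ℕₚ.*-monoˡ-≤ (s ^ 23) small ⟩
        s * s ^ 23                                     ≡⟨ ℕₚ.^-*-assoc s 6 4 ⟨
        (s ^ 6) ^ 4                                    ∎))
        where
        open ℕₚ.≤-Reasoning
        open ℕ-Solver.+-*-Solver using (solve; _:=_; _:*_; _:^_; con)
        e : ℕ
        e = discrepancy

-- Numbers of edges and of bad pairs between two sets of points.

module EdgeCounts where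

  open import Data.Bool using (Bool; true; false; not; _∧_)
  open import Data.Empty using (⊥; ⊥-elim)
  import Data.Nat as ℕ
  open import Data.Nat using (ℕ; suc; _+_; _*_; _≤_; z≤n; s≤s)
  import Data.Nat.Properties as ℕₚ
  import Data.Nat.Solver as ℕ-Solver
  open import Data.Product using (_×_; _,_; proj₁; proj₂)
  open import Relation.Binary.PropositionalEquality
  open import Relation.Nullary using (Dec; yes; no; does)
  open import Relation.Nullary.Decidable using (dec-false)
  open FiniteSums
  open BinaryFields
  open DividedDifferences
  open FourCycles
  open IncidenceGeometry
  open DiscrepancyBound

  module Counting (F : BinaryField) where
    open FieldTheory F using (finite; 0#; _≟_; +≢0; inv≢0; inv-*)
    private module 𝔽 = FieldTheory F
    open Interpolation F
    open Incidence F
    open Discrepancy F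
    open ℕₚ.≤-Reasoning

    sameX sameY : V → V → Bool
    sameX a b = does (proj₁ a ≟ proj₁ b)
    sameY a b = does (proj₂ a ≟ proj₂ b)

    swap-weighted : (A B : V → Bool) (f : V → V → ℕ) →
      ∑ Vs (λ a → ⟦ A a ⟧ * ∑ Vs (λ b → ⟦ B b ⟧ * f a b)) ≡ ∑ Vs (λ b → ⟦ B b ⟧ * ∑ Vs (λ a → ⟦ A a ⟧ * f a b))
    swap-weighted A B f = begin-equality
      ∑ Vs (λ a → ⟦ A a ⟧ * ∑ Vs (λ b → ⟦ B b ⟧ * f a b))
        ≡⟨ ∑-cong Vs (λ a → ∑-*ˡ Vs ⟦ A a ⟧) ⟨
      ∑ Vs (λ a → ∑ Vs (λ b → ⟦ A a ⟧ * (⟦ B b ⟧ * f a b)))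
        ≡⟨ ∑-swap Vs Vs ⟩
      ∑ Vs (λ b → ∑ Vs (λ a → ⟦ A a ⟧ * (⟦ B b ⟧ * f a b)))
        ≡⟨ ∑-cong Vs (λ b → trans (∑-cong Vs (λ a → solve 3 (λ x y z → x :* (y :* z) := y :* (x :* z)) refl ⟦ A a ⟧ ⟦ B b ⟧ (f a b))) (∑-*ˡ Vs ⟦ B b ⟧)) ⟩
      ∑ Vs (λ b → ⟦ B b ⟧ * ∑ Vs (λ a → ⟦ A a ⟧ * f a b)) ∎
      where open ℕ-Solver.+-*-Solver using (solve; _:=_; _:*_)

    weighted-mono : (A : V → Bool) {f g : V → ℕ} → (∀ a → A a ≡ true → f a ≤ g a) →
                    ∑ Vs (λ a → ⟦ A a ⟧ * f a) ≤ ∑ Vs (λ a → ⟦ A a ⟧ * g a)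
    weighted-mono A {f} {g} le = ∑-mono Vs pointwise
      where
      pointwise : ∀ a → ⟦ A a ⟧ * f a ≤ ⟦ A a ⟧ * g a
      pointwise a with A a in eq
      ... | true  = ℕₚ.*-monoʳ-≤ 1 (le a eq)
      ... | false = z≤n

    weighted-≤ : (A : V → Bool) {f : V → ℕ} {c : ℕ} → (∀ a → A a ≡ true → f a ≤ c) →
                 ∑ Vs (λ a → ⟦ A a ⟧ * f a) ≤ count finiteV A * c
    weighted-≤ A {c = c} le = ℕₚ.≤-trans (weighted-mono A {g = λ _ → c} le) (ℕₚ.≤-reflexive (∑-*ʳ Vs c))

    weighted-drop : (A : V → Bool) (f : V → ℕ) → ∑ Vs (λ a → ⟦ A a ⟧ * f a) ≤ ∑ Vs f
    weighted-drop A f = ∑-mono Vs (λ a → ℕₚ.≤-trans (ℕₚ.*-monoˡ-≤ (f a) (⟦⟧≤1 (A a))) (ℕₚ.≤-reflexive (ℕₚ.*-identityˡ (f a))))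

    sameY-count : ∀ b → count finiteV (λ a → sameY a b) ≤ s
    sameY-count b = count-injection finiteV finite (λ a → sameY a b) proj₁
      (λ { (x , y) (x′ , y′) e e′ refl → cong (x ,_) (trans (does-true (y ≟ _) e) (sym (does-true (y′ ≟ _) e′))) })

    sameX-count : ∀ b → count finiteV (λ a → sameX a b) ≤ s
    sameX-count b = count-injection finiteV finite (λ a → sameX a b) proj₂
      (λ { (x , y) (x′ , y′) e e′ refl → cong (_, y) (trans (does-true (x ≟ _) e) (sym (does-true (x′ ≟ _) e′))) })

    vertical-count : count finiteV (λ c → not (nonzero c)) ≤ s
    vertical-count = count-injection finiteV finite (λ c → not (nonzero c)) proj₂
      (λ { (m , w) (m′ , w′) e e′ refl → cong (_, w) (trans (zero-m m e) (sym (zero-m m′ e′))) })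
      where
      zero-m : ∀ m → not (not (does (m ≟ 0#))) ≡ true → m ≡ 0#
      zero-m m e with m ≟ 0#
      ... | yes eq = eq

    2lines : 2 ≤ s → q ≤ 2 * lines
    2lines 2≤s = ℕₚ.+-cancelʳ-≤ (s + s) q (2 * lines) (begin
      q + (s + s)          ≤⟨ ℕₚ.+-monoʳ-≤ q (ℕₚ.≤-trans (ℕₚ.≤-trans (ℕₚ.≤-reflexive (cong (s +_) (sym (ℕₚ.+-identityʳ s)))) (ℕₚ.*-monoˡ-≤ s 2≤s)) (ℕₚ.≤-reflexive (sym q≡s*s))) ⟩
      q + q                ≤⟨ ℕₚ.+-mono-≤ q≤ q≤ ⟩
      (lines + s) + (lines + s) ≡⟨ solve 2 (λ l s → (l :+ s) :+ (l :+ s) := con 2 :* l :+ (s :+ s)) refl lines s ⟩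
      2 * lines + (s + s)  ∎)
      where
      open ℕ-Solver.+-*-Solver using (solve; _:=_; _:+_; _:*_; con)
      q≤ : q ≤ lines + s
      q≤ = begin
        q ≡⟨ Finite.∑-1 finiteV ⟨
        count finiteV (λ _ → true) ≡⟨ count-split finiteV (λ _ → true) nonzero ⟩
        lines + count finiteV (λ c → not (nonzero c)) ≤⟨ ℕₚ.+-monoʳ-≤ lines vertical-count ⟩
        lines + s ∎

    -- Equal nodes would give equal points by the incidence equations; with distinct nodes the sum
    -- of the two equations yields `m`, and `w` follows.
    incident-slope : ∀ c a b → proj₁ c ≢ 0# → a ≢ b → incident c a b ≡ true →
                     proj₂ a ≢ proj₂ b × proj₁ a ≢ proj₁ b × c ≡ slope a b
    incident-slope (m , w) (x , y) (x′ , y′) m≢0 a≢b inc with incident⇒ inc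
    ... | e , e′ = y≢y′ , x≢x′ , cong₂ _,_ m≡ (trans w≡ (cong (λ z → x 𝔽.+ z 𝔽.* y′) m≡))
      where
      y≢y′ : y ≢ y′
      y≢y′ refl = a≢b (cong (_, y) (trans e (sym e′)))
      diff : m 𝔽.* (y 𝔽.+ y′) ≡ x 𝔽.+ x′
      diff = trans (𝔽.solve 4 (λ m w y y′ → m 𝔽.:* (y 𝔽.:+ y′) 𝔽.:= (m 𝔽.:* y′ 𝔽.:+ w) 𝔽.:+ (m 𝔽.:* y 𝔽.:+ w)) refl m w y y′) (sym (cong₂ 𝔽._+_ e e′))
      x≢x′ : x ≢ x′
      x≢x′ refl = 𝔽.*≢0 m≢0 (+≢0 y≢y′) (trans diff (𝔽.+-self x))
      m≡ : m ≡ (x 𝔽.+ x′) 𝔽.* 𝔽.inv (y 𝔽.+ y′)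
      m≡ = trans (trans (trans (sym (𝔽.*-idˡ m)) (cong (𝔽._* m) (sym (inv-* _ (+≢0 y≢y′)))))
        (𝔽.solve 3 (λ i d m → (i 𝔽.:* d) 𝔽.:* m 𝔽.:= (m 𝔽.:* d) 𝔽.:* i) refl (𝔽.inv (y 𝔽.+ y′)) (y 𝔽.+ y′) m))
        (cong (𝔽._* 𝔽.inv (y 𝔽.+ y′)) diff)
      w≡ : w ≡ x 𝔽.+ m 𝔽.* y′
      w≡ = trans (𝔽.solve 3 (λ m w y′ → w 𝔽.:= (m 𝔽.:* y′ 𝔽.:+ w) 𝔽.:+ m 𝔽.:* y′) refl m w y′) (cong (𝔽._+ m 𝔽.* y′) (sym e))

    slope-incident : ∀ a b → proj₂ a ≢ proj₂ b → proj₁ a ≢ proj₁ b → incident (slope a b) a b ≡ true × nonzero (slope a b) ≡ true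
    slope-incident (x , y) (x′ , y′) y≢y′ x≢x′ = let (e , e′) = slope-spec x y x′ y′ y≢y′ in
      ⇒incident e e′ , ⇒nonzero (slope (x , y) (x′ , y′)) (𝔽.*≢0 (+≢0 x≢x′) (inv≢0 (+≢0 y≢y′)))

    multiplicity : V → V → ℕ
    multiplicity a b = ∑ Vs λ c → ⟦ incident c a b ⟧ * ⟦ nonzero c ⟧

    -- Off the diagonal the only possible label is `slope a b`. On the diagonal every slope
    -- determines one intercept, hence the extra `s`.
    multiplicity-upper : ∀ a b → multiplicity a b ≤ 1 + ⟦ does (Finite._≟_ finiteV b a) ⟧ * s
    multiplicity-upper a b = ℕₚ.≤-trans (ℕₚ.≤-reflexive (∑-cong Vs (λ c → sym (⟦∧⟧ (incident c a b) (nonzero c))))) (bound (Finite._≟_ finiteV b a))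
      where
      P : V → Bool
      P c = incident c a b ∧ nonzero c
      bound : (d : Dec (b ≡ a)) → count finiteV P ≤ 1 + ⟦ does d ⟧ * s
      bound (yes refl) = ℕₚ.≤-trans (count-injection finiteV finite P proj₁ inj) (ℕₚ.≤-trans (ℕₚ.m≤n+m s 1) (ℕₚ.≤-reflexive (cong suc (sym (ℕₚ.+-identityʳ s)))))
        where
        inj : ∀ c c′ → P c ≡ true → P c′ ≡ true → proj₁ c ≡ proj₁ c′ → c ≡ c′
        inj (m , w) (.m , w′) e e′ refl = cong (m ,_) (𝔽.+-cancelˡ (m 𝔽.* proj₂ a)
          (trans (sym (proj₁ (incident⇒ (proj₁ (∧-true {incident (m , w) a a} e))))) (proj₁ (incident⇒ (proj₁ (∧-true {incident (m , w′) a a} e′))))))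
      bound (no b≢a) = count-unique finiteV P (λ c c′ e e′ →
          trans (slope≡ c e) (sym (slope≡ c′ e′)))
        where
        slope≡ : ∀ c → P c ≡ true → c ≡ slope a b
        slope≡ c e = let (i , nz) = ∧-true {incident c a b} e in
          proj₂ (proj₂ (incident-slope c a b (nonzero⇒ c nz) (λ eq → b≢a (sym eq)) i))

    multiplicity-lower : ∀ a b → 1 ≤ multiplicity a b + (⟦ sameY a b ⟧ + ⟦ sameX a b ⟧)
    multiplicity-lower a b with proj₂ a ≟ proj₂ b | proj₁ a ≟ proj₁ b
    ... | yes _ | _     = ℕₚ.≤-trans (s≤s z≤n) (ℕₚ.m≤n+m _ (multiplicity a b))
    ... | no _  | yes _ = ℕₚ.m≤n+m 1 (multiplicity a b)
    ... | no y≢ | no x≢ = let (i , nz) = slope-incident a b y≢ x≢ in ℕₚ.≤-trans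
      (ℕₚ.≤-trans (ℕₚ.≤-reflexive (cong₂ (λ x y → ⟦ x ⟧ * ⟦ y ⟧) (sym i) (sym nz)))
        (Finite.∑-term finiteV (slope a b) (λ c → ⟦ incident c a b ⟧ * ⟦ nonzero c ⟧))) (ℕₚ.m≤m+n _ 0)

    edges-upper : ∀ A B → edges nonzero A B ≤ count finiteV A * (count finiteV B + s)
    edges-upper A B = weighted-≤ A (λ a _ → begin
      ∑ Vs (λ b → ⟦ B b ⟧ * multiplicity a b)
        ≤⟨ weighted-mono B (λ b _ → multiplicity-upper a b) ⟩
      ∑ Vs (λ b → ⟦ B b ⟧ * (1 + ⟦ does (Finite._≟_ finiteV b a) ⟧ * s))
        ≡⟨ trans (∑-cong Vs (λ b → trans (ℕₚ.*-distribˡ-+ ⟦ B b ⟧ 1 _) (cong (_+ ⟦ B b ⟧ * _) (ℕₚ.*-identityʳ ⟦ B b ⟧)))) (∑-+ Vs) ⟩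
      count finiteV B + ∑ Vs (λ b → ⟦ B b ⟧ * (⟦ does (Finite._≟_ finiteV b a) ⟧ * s))
        ≤⟨ ℕₚ.+-monoʳ-≤ (count finiteV B) (weighted-drop B _) ⟩
      count finiteV B + ∑ Vs (λ b → ⟦ does (Finite._≟_ finiteV b a) ⟧ * s)
        ≡⟨ cong (count finiteV B +_) (Finite.∑-pick finiteV a (λ _ → s)) ⟩
      count finiteV B + s ∎)

    -- Counting from the side of `B` makes the error proportional to the size of `B`. It can then be
    -- cancelled against `B` in `unhit-small`, where `B` may be arbitrarily small.
    coincidences : ∀ A B → ∑ Vs (λ a → ⟦ A a ⟧ * ∑ Vs (λ b → ⟦ B b ⟧ * (⟦ sameY a b ⟧ + ⟦ sameX a b ⟧))) ≤ count finiteV B * (s + s)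
    coincidences A B = ℕₚ.≤-trans (ℕₚ.≤-reflexive (swap-weighted A B _)) (weighted-≤ B (λ b _ → begin
      ∑ Vs (λ a → ⟦ A a ⟧ * (⟦ sameY a b ⟧ + ⟦ sameX a b ⟧)) ≤⟨ weighted-drop A _ ⟩
      ∑ Vs (λ a → ⟦ sameY a b ⟧ + ⟦ sameX a b ⟧)              ≡⟨ ∑-+ Vs ⟩
      count finiteV (λ a → sameY a b) + count finiteV (λ a → sameX a b) ≤⟨ ℕₚ.+-mono-≤ (sameY-count b) (sameX-count b) ⟩
      s + s ∎))

    weighted-+ : (A B : V → Bool) (f g : V → V → ℕ) →
      ∑ Vs (λ a → ⟦ A a ⟧ * ∑ Vs (λ b → ⟦ B b ⟧ * (f a b + g a b))) ≡
      ∑ Vs (λ a → ⟦ A a ⟧ * ∑ Vs (λ b → ⟦ B b ⟧ * f a b)) + ∑ Vs (λ a → ⟦ A a ⟧ * ∑ Vs (λ b → ⟦ B b ⟧ * g a b))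
    weighted-+ A B f g = trans (∑-cong Vs (λ a → trans
      (cong (⟦ A a ⟧ *_) (trans (∑-cong Vs (λ b → ℕₚ.*-distribˡ-+ ⟦ B b ⟧ (f a b) (g a b))) (∑-+ Vs)))
      (ℕₚ.*-distribˡ-+ ⟦ A a ⟧ _ _))) (∑-+ Vs)

    edges-lower : ∀ A B → count finiteV A * count finiteV B ≤ edges nonzero A B + count finiteV B * (s + s)
    edges-lower A B = begin
      count finiteV A * count finiteV B
        ≡⟨ ∑-*ʳ Vs (count finiteV B) ⟨
      ∑ Vs (λ a → ⟦ A a ⟧ * ∑ Vs (λ b → ⟦ B b ⟧))
        ≤⟨ weighted-mono A (λ a _ → ∑-mono Vs (λ b → ℕₚ.≤-trans (ℕₚ.≤-reflexive (sym (ℕₚ.*-identityʳ ⟦ B b ⟧))) (ℕₚ.*-monoʳ-≤ ⟦ B b ⟧ (multiplicity-lower a b)))) ⟩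
      ∑ Vs (λ a → ⟦ A a ⟧ * ∑ Vs (λ b → ⟦ B b ⟧ * (multiplicity a b + (⟦ sameY a b ⟧ + ⟦ sameX a b ⟧))))
        ≡⟨ weighted-+ A B multiplicity (λ a b → ⟦ sameY a b ⟧ + ⟦ sameX a b ⟧) ⟩
      edges nonzero A B + ∑ Vs (λ a → ⟦ A a ⟧ * ∑ Vs (λ b → ⟦ B b ⟧ * (⟦ sameY a b ⟧ + ⟦ sameX a b ⟧)))
        ≤⟨ ℕₚ.+-monoʳ-≤ (edges nonzero A B) (coincidences A B) ⟩
      edges nonzero A B + count finiteV B * (s + s) ∎

    -- A sum instead of a disjunction, so that the contributions can be summed separately. For equal
    -- nodes the value of `slope` is meaningless, but such a pair already has positive weight.
    badPair : (V → Bool) → V → V → ℕ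
    badPair U a b = ⟦ sameY a b ⟧ + ⟦ sameX a b ⟧ + ⟦ U (slope a b) ⟧

    badPair-sum : ∀ A B U → ∑ Vs (λ a → ⟦ A a ⟧ * ∑ Vs (λ b → ⟦ B b ⟧ * badPair U a b)) ≤
                  edges (sloped U) A B + (count finiteV B * (s + s) + count finiteV B * (s + s))
    badPair-sum A B U = begin
      ∑ Vs (λ a → ⟦ A a ⟧ * ∑ Vs (λ b → ⟦ B b ⟧ * badPair U a b))
        ≤⟨ weighted-mono A (λ a _ → weighted-mono B (λ b _ → pointwise a b)) ⟩
      ∑ Vs (λ a → ⟦ A a ⟧ * ∑ Vs (λ b → ⟦ B b ⟧ * (e a b + (c a b + c a b))))
        ≡⟨ trans (weighted-+ A B e (λ a b → c a b + c a b)) (cong (edges (sloped U) A B +_) (weighted-+ A B c c)) ⟩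
      edges (sloped U) A B + (C + C)
        ≤⟨ ℕₚ.+-monoʳ-≤ (edges (sloped U) A B) (ℕₚ.+-mono-≤ (coincidences A B) (coincidences A B)) ⟩
      edges (sloped U) A B + (count finiteV B * (s + s) + count finiteV B * (s + s)) ∎
      where
      e c : V → V → ℕ
      e a b = ∑ Vs λ z → ⟦ incident z a b ⟧ * ⟦ sloped U z ⟧
      c a b = ⟦ sameY a b ⟧ + ⟦ sameX a b ⟧
      C : ℕ
      C = ∑ Vs (λ a → ⟦ A a ⟧ * ∑ Vs (λ b → ⟦ B b ⟧ * c a b))
      pointwise : ∀ a b → badPair U a b ≤ e a b + (c a b + c a b)
      pointwise a b with proj₂ a ≟ proj₂ b | proj₁ a ≟ proj₁ b
      ... | yes _ | d     = ℕₚ.≤-trans (ℕₚ.+-monoʳ-≤ (1 + ⟦ does d ⟧) (⟦⟧≤1 (U (slope a b))))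
        (ℕₚ.≤-trans (ℕₚ.+-monoʳ-≤ (1 + ⟦ does d ⟧) (ℕₚ.m≤m+n 1 ⟦ does d ⟧)) (ℕₚ.m≤n+m _ (e a b)))
      ... | no _  | yes _ = ℕₚ.≤-trans (ℕₚ.+-monoʳ-≤ 1 (⟦⟧≤1 (U (slope a b)))) (ℕₚ.m≤n+m 2 (e a b))
      ... | no y≢ | no x≢ = let (i , nz) = slope-incident a b y≢ x≢ in ℕₚ.≤-trans
        (ℕₚ.≤-trans (ℕₚ.≤-reflexive (trans (sym (ℕₚ.*-identityˡ _)) (cong₂ (λ x y → ⟦ x ⟧ * ⟦ y ∧ U (slope a b) ⟧) (sym i) (sym nz))))
          (Finite.∑-term finiteV (slope a b) (λ z → ⟦ incident z a b ⟧ * ⟦ sloped U z ⟧))) (ℕₚ.m≤m+n _ 0)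

    hit : (V → Bool) → V → V → Bool
    hit U a b = not (sameY a b) ∧ (not (sameX a b) ∧ U (slope a b))

    Disjoint : (V → Bool) → (V → Bool) → Set
    Disjoint A B = ∀ a → A a ≡ true → B a ≡ true → ⊥

    -- Disjointness keeps away the diagonal, where points are incident to labels other than the one
    -- given by `slope`.
    no-hit⇒no-edges : ∀ A B U → Disjoint A B → (∀ a b → A a ≡ true → B b ≡ true → hit U a b ≡ false) → edges (sloped U) A B ≡ 0
    no-hit⇒no-edges A B U disj none = ℕₚ.n≤0⇒n≡0 (ℕₚ.≤-trans
      (weighted-≤ A {c = 0} (λ a Aa → ℕₚ.≤-trans (weighted-≤ B {c = 0} (λ b Bb →
        ℕₚ.≤-trans (∑-mono Vs {g = λ _ → 0} (vanish a b Aa Bb)) (ℕₚ.≤-reflexive (∑-0 Vs)))) (ℕₚ.≤-reflexive (ℕₚ.*-zeroʳ (count finiteV B)))))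
      (ℕₚ.≤-reflexive (ℕₚ.*-zeroʳ (count finiteV A))))
      where
      vanish : ∀ a b → A a ≡ true → B b ≡ true → ∀ c → ⟦ incident c a b ⟧ * ⟦ sloped U c ⟧ ≤ 0
      vanish a b Aa Bb c with incident c a b in ei | sloped U c in ew
      ... | false | _     = z≤n
      ... | true  | false = z≤n
      ... | true  | true  =
        let (nz , Uc) = ∧-true {nonzero c} ew
            (y≢ , x≢ , c≡) = incident-slope c a b (nonzero⇒ c nz) (λ { refl → disj a Aa Bb }) ei
        in ⊥-elim (true≢false (trans (sym (∧-intro (cong not (dec-false (_ ≟ _) y≢)) (∧-intro (cong not (dec-false (_ ≟ _) x≢)) (trans (cong U (sym c≡)) Uc)))) (none a b Aa Bb)))
        where
        true≢false : true ≢ false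
        true≢false ()

-- Reduction of general k to k = 3 by Newton division.

module TupleCounts where

  open import Data.Bool using (Bool; true; false; not; _∧_)
  open import Data.Empty using (⊥-elim)
  open import Data.List using (List; []; _∷_; map; length)
  open import Data.List.Properties using (length-map)
  open import Data.List.Relation.Binary.Permutation.Propositional using (swap) renaming (refl to ↭-refl)
  open import Data.List.Relation.Unary.All as All using (All; []; _∷_)
  import Data.List.Relation.Unary.All.Properties as Allₚ
  import Data.Nat as ℕ
  open import Data.Nat using (ℕ; zero; suc; _+_; _*_; _≤_; _^_)
  import Data.Nat.Properties as ℕₚ
  import Data.Nat.Solver as ℕ-Solver
  open import Data.Product using (Σ; _×_; _,_; proj₁; proj₂)
  open import Data.Sum using (inj₁; inj₂)
  open import Function using (_∘_)
  open import Relation.Binary.PropositionalEquality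
  open import Relation.Nullary using (Dec; yes; no; does)
  open FiniteSums
  open BinaryFields
  open DividedDifferences
  open FourCycles
  open IncidenceGeometry
  open DiscrepancyBound
  open EdgeCounts

  -- Collects the error of `bad-sum`: each division step adds the number of remaining nodes that
  -- might coincide with the node of the fixed point. `blocked-constant` does the same for
  -- `blocked-sum`.
  bad-constant : ℕ → ℕ
  bad-constant zero    = 0
  bad-constant (suc r) = bad-constant r + (2 + r)

  blocked-constant : ℕ → ℕ
  blocked-constant zero    = 0
  blocked-constant (suc r) = blocked-constant r + suc r

  module Tuples (F : BinaryField) where
    open FieldTheory F using (0#; _≟_)
    open Interpolation F
    open Incidence F
    open Discrepancy F
    open Counting F
    open ℕₚ.≤-Reasoning

    Region : Set
    Region = V → Bool

    ∣_∣ᵣ : Region → ℕ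
    ∣ S ∣ᵣ = count finiteV S

    ∑∏ : List Region → (List V → ℕ) → ℕ
    ∑∏ []       h = h []
    ∑∏ (S ∷ Ss) h = ∑ Vs λ a → ⟦ S a ⟧ * ∑∏ Ss (λ u → h (a ∷ u))

    ∑∏-cong : ∀ Ss {h h′} → (∀ u → h u ≡ h′ u) → ∑∏ Ss h ≡ ∑∏ Ss h′
    ∑∏-cong []       eq = eq []
    ∑∏-cong (S ∷ Ss) eq = ∑-cong Vs (λ a → cong (⟦ S a ⟧ *_) (∑∏-cong Ss (λ u → eq (a ∷ u))))

    ∑∏-+ : ∀ Ss {h h′} → ∑∏ Ss (λ u → h u + h′ u) ≡ ∑∏ Ss h + ∑∏ Ss h′
    ∑∏-+ []       = refl
    ∑∏-+ (S ∷ Ss) = trans (∑-cong Vs (λ a → trans (cong (⟦ S a ⟧ *_) (∑∏-+ Ss)) (ℕₚ.*-distribˡ-+ ⟦ S a ⟧ _ _))) (∑-+ Vs)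

    ∑∏-*ˡ : ∀ Ss c {h} → ∑∏ Ss (λ u → c * h u) ≡ c * ∑∏ Ss h
    ∑∏-*ˡ []       c = refl
    ∑∏-*ˡ (S ∷ Ss) c {h} = trans (∑-cong Vs (λ a → trans (cong (⟦ S a ⟧ *_) (∑∏-*ˡ Ss c))
      (solve 3 (λ x y z → x :* (y :* z) := y :* (x :* z)) refl ⟦ S a ⟧ c (∑∏ Ss (λ u → h (a ∷ u)))))) (∑-*ˡ Vs c)
      where open ℕ-Solver.+-*-Solver using (solve; _:=_; _:*_)

    ∑∏-1≤ : ∀ {σ} Ss → All (λ S → ∣ S ∣ᵣ ≤ σ) Ss → ∑∏ Ss (λ _ → 1) ≤ σ ^ length Ss
    ∑∏-1≤ []       []         = ℕₚ.≤-refl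
    ∑∏-1≤ (S ∷ Ss) (le ∷ les) = ℕₚ.≤-trans (weighted-≤ S (λ _ _ → ∑∏-1≤ Ss les)) (ℕₚ.*-monoˡ-≤ _ le)

    hits : V → List V → ℕ
    hits e u = ∑ u (λ z → ⟦ sameY z e ⟧)

    avoids : V → List V → Bool
    avoids e []      = true
    avoids e (z ∷ u) = not (sameY z e) ∧ avoids e u

    avoids⇒ : ∀ e u → avoids e u ≡ true → All (λ a → proj₂ a ≢ proj₂ e) u
    avoids⇒ e []      _  = []
    avoids⇒ e (z ∷ u) eq = let (p , q) = ∧-true {not (sameY z e)} eq in does-false (_ ≟ _) (not-true p) ∷ avoids⇒ e u q

    no-hits⇒avoids : ∀ e u → hits e u ≡ 0 → avoids e u ≡ true
    no-hits⇒avoids e []      _ = refl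
    no-hits⇒avoids e (z ∷ u) eq with proj₂ z ≟ proj₂ e
    ... | no _ = no-hits⇒avoids e u eq

    -- Each of the suc j positions can take the node of `e` at no more than `s` points, while the
    -- other positions contribute σ each.
    hits-sum : ∀ {σ} e j Ss → length Ss ≡ suc j → All (λ S → ∣ S ∣ᵣ ≤ σ) Ss → ∑∏ Ss (hits e) ≤ suc j * (s * σ ^ j)
    hits-sum {σ} e zero (S ∷ []) refl (le ∷ []) = begin
      ∑ Vs (λ a → ⟦ S a ⟧ * (⟦ sameY a e ⟧ + 0)) ≤⟨ weighted-drop S _ ⟩
      ∑ Vs (λ a → ⟦ sameY a e ⟧ + 0)             ≡⟨ ∑-cong Vs (λ a → ℕₚ.+-identityʳ ⟦ sameY a e ⟧) ⟩
      count finiteV (λ a → sameY a e)            ≤⟨ sameY-count e ⟩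
      s                                          ≡⟨ solve 1 (λ s → s := con 1 :* (s :* con 1)) refl s ⟩
      1 * (s * σ ^ 0)                            ∎
      where open ℕ-Solver.+-*-Solver using (solve; _:=_; _:*_; con)
    hits-sum {σ} e (suc j) (S ∷ Ss) eq (le ∷ les) = begin
      ∑ Vs (λ a → ⟦ S a ⟧ * ∑∏ Ss (λ u → ⟦ sameY a e ⟧ + hits e u))
        ≡⟨ ∑-cong Vs (λ a → cong (⟦ S a ⟧ *_) (∑∏-+ Ss)) ⟩
      ∑ Vs (λ a → ⟦ S a ⟧ * (∑∏ Ss (λ _ → ⟦ sameY a e ⟧) + ∑∏ Ss (hits e)))
        ≤⟨ weighted-mono S (λ a _ → ℕₚ.+-mono-≤ (const a) (hits-sum e j Ss (ℕₚ.suc-injective eq) les)) ⟩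
      ∑ Vs (λ a → ⟦ S a ⟧ * (⟦ sameY a e ⟧ * σ ^ suc j + X))
        ≡⟨ trans (∑-cong Vs (λ a → ℕₚ.*-distribˡ-+ ⟦ S a ⟧ _ X)) (∑-+ Vs) ⟩
      ∑ Vs (λ a → ⟦ S a ⟧ * (⟦ sameY a e ⟧ * σ ^ suc j)) + ∑ Vs (λ a → ⟦ S a ⟧ * X)
        ≤⟨ ℕₚ.+-mono-≤ (ℕₚ.≤-trans (weighted-drop S _) (ℕₚ.≤-reflexive (∑-*ʳ Vs (σ ^ suc j)))) (ℕₚ.≤-reflexive (∑-*ʳ Vs X)) ⟩
      count finiteV (λ a → sameY a e) * σ ^ suc j + ∣ S ∣ᵣ * X
        ≤⟨ ℕₚ.+-mono-≤ (ℕₚ.*-monoˡ-≤ (σ ^ suc j) (sameY-count e)) (ℕₚ.*-monoˡ-≤ X le) ⟩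
      s * σ ^ suc j + σ * (suc j * (s * σ ^ j))
        ≡⟨ solve 4 (λ s σ t j → s :* (σ :* t) :+ σ :* (j :* (s :* t)) := (con 1 :+ j) :* (s :* (σ :* t))) refl s σ (σ ^ j) (suc j) ⟩
      suc (suc j) * (s * σ ^ suc j) ∎
      where
      open ℕ-Solver.+-*-Solver using (solve; _:=_; _:+_; _:*_; con)
      X : ℕ
      X = suc j * (s * σ ^ j)
      const : ∀ a → ∑∏ Ss (λ _ → ⟦ sameY a e ⟧) ≤ ⟦ sameY a e ⟧ * σ ^ suc j
      const a = begin
        ∑∏ Ss (λ _ → ⟦ sameY a e ⟧)       ≡⟨ ∑∏-cong Ss (λ _ → sym (ℕₚ.*-identityʳ ⟦ sameY a e ⟧)) ⟩
        ∑∏ Ss (λ _ → ⟦ sameY a e ⟧ * 1)   ≡⟨ ∑∏-*ˡ Ss ⟦ sameY a e ⟧ ⟩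
        ⟦ sameY a e ⟧ * ∑∏ Ss (λ _ → 1)   ≤⟨ ℕₚ.*-monoʳ-≤ ⟦ sameY a e ⟧ (∑∏-1≤ Ss les) ⟩
        ⟦ sameY a e ⟧ * σ ^ length Ss     ≡⟨ cong (λ l → ⟦ sameY a e ⟧ * σ ^ l) (ℕₚ.suc-injective eq) ⟩
        ⟦ sameY a e ⟧ * σ ^ suc j         ∎

    infixl 5 _▹_
    -- The image under `divide e` of the points of `S` whose node differs from that of `e`, written
    -- through the inverse map.
    _▹_ : Region → V → Region
    (S ▹ e) z = S (undivide e z) ∧ not (sameY z e)

    -- Change of variable z = divide e a. The maps `divide e` and `undivide e` are mutually inverse
    -- away from the node of `e`; at that node the weights on both sides vanish.
    divide-sum : ∀ S e (h : V → ℕ) →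
      ∑ Vs (λ a → ⟦ S a ⟧ * (⟦ not (sameY a e) ⟧ * h (divide e a))) ≡ ∑ Vs (λ z → ⟦ (S ▹ e) z ⟧ * h z)
    divide-sum S e h = begin-equality
      ∑ Vs (λ a → ⟦ S a ⟧ * (⟦ not (sameY a e) ⟧ * h (divide e a)))
        ≡⟨ ∑-cong Vs (λ a → Finite.∑-pick finiteV (divide e a) (λ z → ⟦ S a ⟧ * (⟦ not (sameY a e) ⟧ * h z))) ⟨
      ∑ Vs (λ a → ∑ Vs (λ z → ⟦ does (z ≟ᵥ divide e a) ⟧ * (⟦ S a ⟧ * (⟦ not (sameY a e) ⟧ * h z))))
        ≡⟨ ∑-swap Vs Vs ⟩
      ∑ Vs (λ z → ∑ Vs (λ a → ⟦ does (z ≟ᵥ divide e a) ⟧ * (⟦ S a ⟧ * (⟦ not (sameY a e) ⟧ * h z))))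
        ≡⟨ ∑-cong Vs (λ z → ∑-cong Vs (λ a → pointwise a z (z ≟ᵥ divide e a) (a ≟ᵥ undivide e z))) ⟩
      ∑ Vs (λ z → ∑ Vs (λ a → ⟦ does (a ≟ᵥ undivide e z) ⟧ * (⟦ (S ▹ e) z ⟧ * h z)))
        ≡⟨ ∑-cong Vs (λ z → Finite.∑-pick finiteV (undivide e z) (λ _ → ⟦ (S ▹ e) z ⟧ * h z)) ⟩
      ∑ Vs (λ z → ⟦ (S ▹ e) z ⟧ * h z) ∎
      where
      open Finite finiteV using () renaming (_≟_ to _≟ᵥ_)
      same : ∀ a z → sameY a e ≡ true → ⟦ S a ⟧ * (⟦ not (sameY a e) ⟧ * h z) ≡ 0
      same a z eq rewrite eq = ℕₚ.*-zeroʳ ⟦ S a ⟧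
      same′ : ∀ z → sameY z e ≡ true → ⟦ (S ▹ e) z ⟧ * h z ≡ 0
      same′ z eq with S (undivide e z)
      ... | false = refl
      ... | true rewrite eq = refl
      pointwise : ∀ a z (d : Dec (z ≡ divide e a)) (d′ : Dec (a ≡ undivide e z)) →
        ⟦ does d ⟧ * (⟦ S a ⟧ * (⟦ not (sameY a e) ⟧ * h z)) ≡ ⟦ does d′ ⟧ * (⟦ (S ▹ e) z ⟧ * h z)
      pointwise a z (yes refl) (yes a≡) = cong (1 *_) (trans (sym (ℕₚ.*-assoc ⟦ S a ⟧ ⟦ not (sameY a e) ⟧ _))
        (cong (_* h z) (trans (sym (⟦∧⟧ (S a) (not (sameY a e)))) (cong (λ b → ⟦ S b ∧ not (sameY a e) ⟧) a≡))))
      pointwise a z (yes refl) (no a≢) = trans (cong (1 *_) (same a z (decide (proj₂ a ≟ proj₂ e)))) refl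
        where
        decide : (d : Dec (proj₂ a ≡ proj₂ e)) → does d ≡ true
        decide (yes _)  = refl
        decide (no ya≢) = ⊥-elim (a≢ (sym (undivide-divide e a ya≢)))
      pointwise a z (no z≢) (yes refl) = sym (trans (cong (1 *_) (same′ z (decide (proj₂ z ≟ proj₂ e)))) refl)
        where
        decide : (d : Dec (proj₂ z ≡ proj₂ e)) → does d ≡ true
        decide (yes _)  = refl
        decide (no yz≢) = ⊥-elim (z≢ (sym (divide-undivide e z yz≢)))
      pointwise a z (no _) (no _) = refl

    ▹-size : ∀ S e → ∣ S ▹ e ∣ᵣ ≡ count finiteV (λ a → S a ∧ not (sameY a e))
    ▹-size S e = begin-equality
      ∣ S ▹ e ∣ᵣ                                       ≡⟨ ∑-cong Vs (λ z → sym (ℕₚ.*-identityʳ ⟦ (S ▹ e) z ⟧)) ⟩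
      ∑ Vs (λ z → ⟦ (S ▹ e) z ⟧ * 1)                   ≡⟨ divide-sum S e (λ _ → 1) ⟨
      ∑ Vs (λ a → ⟦ S a ⟧ * (⟦ not (sameY a e) ⟧ * 1)) ≡⟨ ∑-cong Vs (λ a → trans (cong (⟦ S a ⟧ *_) (ℕₚ.*-identityʳ ⟦ not (sameY a e) ⟧)) (sym (⟦∧⟧ (S a) (not (sameY a e))))) ⟩
      count finiteV (λ a → S a ∧ not (sameY a e))      ∎

    ▹-≤ : ∀ S e → ∣ S ▹ e ∣ᵣ ≤ ∣ S ∣ᵣ
    ▹-≤ S e = ℕₚ.≤-trans (ℕₚ.≤-reflexive (▹-size S e)) (∑-mono Vs (λ a → ⟦⟧-mono {S a ∧ _} (proj₁ ∘ ∧-true {S a})))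

    ≤-▹ : ∀ S e → ∣ S ∣ᵣ ≤ ∣ S ▹ e ∣ᵣ + s
    ≤-▹ S e = begin
      ∣ S ∣ᵣ ≡⟨ count-split finiteV S (λ a → sameY a e) ⟩
      count finiteV (λ a → S a ∧ sameY a e) + count finiteV (λ a → S a ∧ not (sameY a e))
        ≤⟨ ℕₚ.+-mono-≤ (ℕₚ.≤-trans (∑-mono Vs (λ a → ⟦⟧-mono {S a ∧ _} (proj₂ ∘ ∧-true {S a}))) (sameY-count e)) (ℕₚ.≤-reflexive (sym (▹-size S e))) ⟩
      s + ∣ S ▹ e ∣ᵣ ≡⟨ ℕₚ.+-comm s _ ⟩
      ∣ S ▹ e ∣ᵣ + s ∎

    divide-∑∏ : ∀ Ss e (h : List V → ℕ) →
      ∑∏ Ss (λ u → ⟦ avoids e u ⟧ * h (map (divide e) u)) ≡ ∑∏ (map (_▹ e) Ss) h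
    divide-∑∏ []       e h = ℕₚ.*-identityˡ (h [])
    divide-∑∏ (S ∷ Ss) e h = trans (∑-cong Vs (λ a → cong (⟦ S a ⟧ *_) (begin-equality
      ∑∏ Ss (λ u → ⟦ not (sameY a e) ∧ avoids e u ⟧ * h (divide e a ∷ map (divide e) u))
        ≡⟨ ∑∏-cong Ss (λ u → trans (cong (_* h (divide e a ∷ map (divide e) u)) (⟦∧⟧ (not (sameY a e)) (avoids e u))) (ℕₚ.*-assoc ⟦ not (sameY a e) ⟧ ⟦ avoids e u ⟧ _)) ⟩
      ∑∏ Ss (λ u → ⟦ not (sameY a e) ⟧ * (⟦ avoids e u ⟧ * h (divide e a ∷ map (divide e) u)))
        ≡⟨ ∑∏-*ˡ Ss ⟦ not (sameY a e) ⟧ ⟩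
      ⟦ not (sameY a e) ⟧ * ∑∏ Ss (λ u → ⟦ avoids e u ⟧ * h (divide e a ∷ map (divide e) u))
        ≡⟨ cong (⟦ not (sameY a e) ⟧ *_) (divide-∑∏ Ss e (λ u → h (divide e a ∷ u))) ⟩
      ⟦ not (sameY a e) ⟧ * ∑∏ (map (_▹ e) Ss) (λ u → h (divide e a ∷ u)) ∎)))
      (divide-sum S e (λ z → ∑∏ (map (_▹ e) Ss) (λ u → h (z ∷ u))))

    -- Iterated Newton division down to two points. The default value is reached only for lists
    -- whose length is not 2 + r.
    apex : ℕ → List V → V
    apex zero    (a ∷ b ∷ []) = slope a b
    apex (suc r) (e ∷ u)      = apex r (map (divide e) u)
    apex _       _            = 0# , 0#

    -- A weight that vanishes only if u is linked to apex r u and this lies outside U; lists of the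
    -- wrong length get weight 1.
    bad : ℕ → Region → List V → ℕ
    bad zero    U (a ∷ b ∷ []) = badPair U a b
    bad (suc r) U (e ∷ u)      = hits e u + ⟦ avoids e u ⟧ * bad r U (map (divide e) u)
    bad _       U _            = 1

    bad≡0⇒link : ∀ r U u → bad r U u ≡ 0 → Link (suc r) u (apex r u) × U (apex r u) ≡ false
    bad≡0⇒link zero U (a ∷ b ∷ []) eq with proj₂ a ≟ proj₂ b | proj₁ a ≟ proj₁ b | U (slope a b)
    ... | no y≢ | no x≢ | false = link-base y≢ x≢ , refl
    bad≡0⇒link (suc r) U (e ∷ u) eq with no-hits⇒avoids e u (ℕₚ.m+n≡0⇒m≡0 (hits e u) eq)
    ... | av = let (L , ok) = bad≡0⇒link r U (map (divide e) u)
                     (trans (sym (ℕₚ.*-identityˡ _)) (trans (cong (λ b → ⟦ b ⟧ * bad r U (map (divide e) u)) (sym av)) (ℕₚ.m+n≡0⇒n≡0 (hits e u) eq)))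
               in link-step e u (avoids⇒ e u av) L , ok

    -- Either a later point repeats the node of the first one, which `hits-sum` bounds, or the tuple
    -- can be divided by it. The hypothesis is made for all regions of size at most `σ` because
    -- division changes the regions, but never enlarges them.
    bad-sum : ∀ {σ β U} → (∀ A B → ∣ A ∣ᵣ ≤ σ → ∣ B ∣ᵣ ≤ σ → ∑ Vs (λ a → ⟦ A a ⟧ * ∑ Vs (λ b → ⟦ B b ⟧ * badPair U a b)) ≤ β) →
      ∀ r Ss → length Ss ≡ 2 + r → All (λ S → ∣ S ∣ᵣ ≤ σ) Ss → ∑∏ Ss (bad r U) ≤ σ ^ r * (β + bad-constant r * (s * σ))
    bad-sum {σ} {β} base zero (A ∷ B ∷ []) refl (leA ∷ leB ∷ []) = ℕₚ.≤-trans (base A B leA leB)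
      (ℕₚ.≤-reflexive (sym (trans (ℕₚ.*-identityˡ _) (ℕₚ.+-identityʳ β))))
    bad-sum {σ} {β} {U} base (suc r) (S ∷ Ss) eq (le ∷ les) = begin
      ∑ Vs (λ e → ⟦ S e ⟧ * ∑∏ Ss (λ u → hits e u + ⟦ avoids e u ⟧ * bad r U (map (divide e) u)))
        ≤⟨ weighted-≤ S (λ e _ → ℕₚ.≤-trans (ℕₚ.≤-reflexive (trans (∑∏-+ Ss) (cong (∑∏ Ss (hits e) +_) (divide-∑∏ Ss e (bad r U)))))
             (ℕₚ.+-mono-≤ (hits-sum e (suc r) Ss len les)
               (bad-sum base r (map (_▹ e) Ss) (trans (length-map (_▹ e) Ss) len) (Allₚ.map⁺ (All.map (λ {T} → ℕₚ.≤-trans (▹-≤ T e)) les))))) ⟩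
      ∣ S ∣ᵣ * (suc (suc r) * (s * σ ^ suc r) + σ ^ r * (β + bad-constant r * (s * σ)))
        ≤⟨ ℕₚ.*-monoˡ-≤ _ le ⟩
      σ * (suc (suc r) * (s * σ ^ suc r) + σ ^ r * (β + bad-constant r * (s * σ)))
        ≡⟨ solve 6 (λ σ s t β c n → σ :* (n :* (s :* (σ :* t)) :+ t :* (β :+ c :* (s :* σ))) := σ :* t :* (β :+ (c :+ n) :* (s :* σ)))
             refl σ s (σ ^ r) β (bad-constant r) (suc (suc r)) ⟩
      σ ^ suc r * (β + bad-constant (suc r) * (s * σ)) ∎
      where
      open ℕ-Solver.+-*-Solver using (solve; _:=_; _:+_; _:*_)
      len : length Ss ≡ suc (suc r)
      len = ℕₚ.suc-injective eq

    unhit : Region → Region → V → Bool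
    unhit S₁ U b = does (count finiteV (λ a → S₁ a ∧ hit U a b) ℕₚ.≟ 0)

    ⟦⟧≡0 : ∀ {b} → ⟦ b ⟧ ≡ 0 → b ≡ false
    ⟦⟧≡0 {false} _ = refl

    -- The counterpart of `bad` for an edge whose point in `S₁` is still missing, so lists are one
    -- shorter. A zero weight ensures that some point of `S₁` completes `u` to a link with apex in
    -- `U`; `S₁` has to be divided along with the tuple.
    blocked : ℕ → Region → Region → List V → ℕ
    blocked zero    S₁ U (b ∷ []) = ⟦ unhit S₁ U b ⟧
    blocked (suc r) S₁ U (e ∷ u)  = hits e u + ⟦ avoids e u ⟧ * blocked r (S₁ ▹ e) U (map (divide e) u)
    blocked _       S₁ U _        = 1

    blocked≡0⇒link : ∀ r S₁ U u → blocked r S₁ U u ≡ 0 →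
                     Σ V λ a → S₁ a ≡ true × Σ V λ c → Link (suc r) (a ∷ u) c × U c ≡ true
    blocked≡0⇒link zero S₁ U (b ∷ []) eq with search Vs (λ a → S₁ a ∧ hit U a b)
    ... | inj₁ ≡0      = ⊥-elim (does-false (_ ℕₚ.≟ 0) (⟦⟧≡0 eq) ≡0)
    ... | inj₂ (a , e) =
      let (Sa , h) = ∧-true {S₁ a} e ; (y , xu) = ∧-true {not (sameY a b)} h ; (x , u) = ∧-true {not (sameX a b)} xu
      in a , Sa , slope a b , link-base (does-false (_ ≟ _) (not-true y)) (does-false (_ ≟ _) (not-true x)) , u
    blocked≡0⇒link (suc r) S₁ U (e ∷ u) eq with no-hits⇒avoids e u (ℕₚ.m+n≡0⇒m≡0 (hits e u) eq)
    ... | av with blocked≡0⇒link r (S₁ ▹ e) U (map (divide e) u)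
                    (trans (sym (ℕₚ.*-identityˡ _)) (trans (cong (λ b → ⟦ b ⟧ * blocked r (S₁ ▹ e) U (map (divide e) u)) (sym av)) (ℕₚ.m+n≡0⇒n≡0 (hits e u) eq)))
    ...   | a , Sa , c , L , Uc =
      let (S₁a , y) = ∧-true {S₁ (undivide e a)} Sa
          y≢ = does-false (proj₂ a ≟ proj₂ e) (not-true y)
      in undivide e a , S₁a , c ,
         -- `link-step` puts the divisor `e` in front, whereas the completing point is wanted there.
         link-↭ (swap e (undivide e a) ↭-refl)
           (link-step e (undivide e a ∷ u) (y≢ ∷ avoids⇒ e u av) (subst (λ z → Link (suc r) (z ∷ map (divide e) u) c) (sym (divide-undivide e a y≢)) L)) , Uc

    ▹-disjoint : ∀ {S T} e → Disjoint S T → Disjoint (S ▹ e) (T ▹ e)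
    ▹-disjoint {S} {T} e disj a Sa Ta = disj (undivide e a) (proj₁ (∧-true {S (undivide e a)} Sa)) (proj₁ (∧-true {T (undivide e a)} Ta))

    -- Each division deletes from `S₁` only points sharing the node of the divisor, at most `s` of
    -- them; starting with τ + r s leaves at least `τ` for the case k = 3.
    blocked-sum : ∀ {σ β τ U} → (∀ S₁ S → τ ≤ ∣ S₁ ∣ᵣ → Disjoint S₁ S → ∑ Vs (λ b → ⟦ S b ⟧ * ⟦ unhit S₁ U b ⟧) ≤ β) →
      ∀ r S₁ Ss → length Ss ≡ 1 + r → All (λ S → ∣ S ∣ᵣ ≤ σ) Ss → τ + r * s ≤ ∣ S₁ ∣ᵣ → All (Disjoint S₁) Ss →
      ∑∏ Ss (blocked r S₁ U) ≤ σ ^ r * (β + blocked-constant r * s)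
    blocked-sum {σ} {β} {τ} base zero S₁ (S ∷ []) refl (le ∷ []) τ≤ (disj ∷ []) = ℕₚ.≤-trans
      (base S₁ S (ℕₚ.≤-trans (ℕₚ.m≤m+n τ 0) τ≤) disj) (ℕₚ.≤-reflexive (sym (trans (ℕₚ.*-identityˡ _) (ℕₚ.+-identityʳ β))))
    blocked-sum {σ} {β} {τ} {U} base (suc r) S₁ (S ∷ Ss) eq (le ∷ les) τ≤ (_ ∷ disj) = begin
      ∑ Vs (λ e → ⟦ S e ⟧ * ∑∏ Ss (λ u → hits e u + ⟦ avoids e u ⟧ * blocked r (S₁ ▹ e) U (map (divide e) u)))
        ≤⟨ weighted-≤ S (λ e _ → ℕₚ.≤-trans (ℕₚ.≤-reflexive (trans (∑∏-+ Ss) (cong (∑∏ Ss (hits e) +_) (divide-∑∏ Ss e (blocked r (S₁ ▹ e) U)))))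
             (ℕₚ.+-mono-≤ (hits-sum e r Ss len les)
               (blocked-sum base r (S₁ ▹ e) (map (_▹ e) Ss) (trans (length-map (_▹ e) Ss) len)
                 (Allₚ.map⁺ (All.map (λ {T} → ℕₚ.≤-trans (▹-≤ T e)) les)) (shrink e)
                 (Allₚ.map⁺ (All.map (λ {T} → ▹-disjoint {S₁} {T} e) disj))))) ⟩
      ∣ S ∣ᵣ * (suc r * (s * σ ^ r) + σ ^ r * (β + blocked-constant r * s))
        ≤⟨ ℕₚ.*-monoˡ-≤ _ le ⟩
      σ * (suc r * (s * σ ^ r) + σ ^ r * (β + blocked-constant r * s))
        ≡⟨ solve 6 (λ σ s t β c n → σ :* (n :* (s :* t) :+ t :* (β :+ c :* s)) := σ :* t :* (β :+ (c :+ n) :* s))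
             refl σ s (σ ^ r) β (blocked-constant r) (suc r) ⟩
      σ ^ suc r * (β + blocked-constant (suc r) * s) ∎
      where
      open ℕ-Solver.+-*-Solver using (solve; _:=_; _:+_; _:*_)
      len : length Ss ≡ suc r
      len = ℕₚ.suc-injective eq
      shrink : ∀ e → τ + r * s ≤ ∣ S₁ ▹ e ∣ᵣ
      shrink e = ℕₚ.+-cancelʳ-≤ s _ _ (begin
        τ + r * s + s     ≡⟨ trans (ℕₚ.+-assoc τ (r * s) s) (cong (τ +_) (ℕₚ.+-comm (r * s) s)) ⟩
        τ + suc r * s     ≤⟨ τ≤ ⟩
        ∣ S₁ ∣ᵣ           ≤⟨ ≤-▹ S₁ e ⟩
        ∣ S₁ ▹ e ∣ᵣ + s   ∎)

-- Ranks and slices in a linear order, and the averaging argument.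

module SelectionByCounting where

  open import Data.Bool using (Bool; true; false; not; _∧_)
  open import Data.Empty using (⊥-elim)
  open import Data.Fin using (Fin; zero; suc)
  open import Data.Fin.Subset using (Subset; ∣_∣)
  open import Data.List using (List; []; _∷_; map; length; _++_)
  open import Data.List.Membership.Propositional using (_∈_)
  open import Data.List.Membership.Propositional.Properties using (∈-++⁺ˡ; ∈-++⁺ʳ; ∈-++⁻; ∈-map⁺; ∈-map⁻)
  open import Data.List.Properties using (length-map; length-++)
  open import Data.List.Relation.Binary.Permutation.Propositional using (_↭_; prep; swap) renaming (refl to ↭-refl; trans to ↭-trans)
  open import Data.List.Relation.Unary.All as All using (All; []; _∷_)
  open import Data.List.Relation.Unary.Any using (here; there)
  import Data.Nat as ℕ
  open import Data.Nat using (ℕ; zero; suc; _+_; _*_; _≤_; _<_; z≤n; s≤s; _^_; NonZero)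
  import Data.Nat.Properties as ℕₚ
  import Data.Nat.Solver as ℕ-Solver
  open import Data.Product using (Σ; ∃; _×_; _,_; proj₁)
  open import Data.Sum using (_⊎_; inj₁; inj₂)
  open import Data.Vec using (Vec; []; _∷_; lookup; _[_]≔_)
  open import Function using (_∘_)
  open import Relation.Binary.Consequences using (tri⇒dec<)
  open import Relation.Binary.Definitions using (Transitive; Trichotomous; tri<; tri≈; tri>)
  open import Relation.Binary.PropositionalEquality
  open import Relation.Nullary using (Dec; yes; no; does; ¬_)
  open import Relation.Nullary.Decidable using (dec-true; dec-false)
  open FiniteSums
  open BinaryFields
  open DividedDifferences
  open FourCycles
  open IncidenceGeometry
  open DiscrepancyBound
  open EdgeCounts
  open TupleCounts

  ∑-< : {A : Set} (xs : List A) (w : A → Bool) (f : A → ℕ) (c : ℕ) →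
        ∑ xs (λ x → ⟦ w x ⟧ * f x) < ∑ xs (λ x → ⟦ w x ⟧) * c → ∃ λ x → w x ≡ true × f x < c
  ∑-< (x ∷ xs) w f c lt with w x in eq
  ... | false = ∑-< xs w f c lt
  ... | true with f x ℕₚ.<? c
  ...   | yes fx<c = x , eq , fx<c
  ...   | no  fx≮c = ∑-< xs w f c (ℕₚ.+-cancelˡ-< c _ _ (ℕₚ.≤-<-trans
            (ℕₚ.+-monoˡ-≤ _ (ℕₚ.≤-trans (ℕₚ.≮⇒≥ fx≮c) (ℕₚ.≤-reflexive (sym (ℕₚ.+-identityʳ (f x)))))) lt))

  restrict : {A : Set} {n : ℕ} → Subset n → Vec A n → List A
  restrict []          []      = []
  restrict (true  ∷ J) (x ∷ v) = x ∷ restrict J v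
  restrict (false ∷ J) (x ∷ v) = restrict J v

  length-restrict : {A : Set} {n : ℕ} (J : Subset n) (v : Vec A n) → length (restrict J v) ≡ ∣ J ∣
  length-restrict []          []      = refl
  length-restrict (true  ∷ J) (x ∷ v) = cong suc (length-restrict J v)
  length-restrict (false ∷ J) (x ∷ v) = length-restrict J v

  restrict-All : {A : Set} {P : A → Set} {n : ℕ} (J : Subset n) (v : Vec A n) → (∀ i → P (lookup v i)) → All P (restrict J v)
  restrict-All []          []      f = []
  restrict-All (true  ∷ J) (x ∷ v) f = f zero ∷ restrict-All J v (f ∘ suc)
  restrict-All (false ∷ J) (x ∷ v) f = restrict-All J v (f ∘ suc)

  restrict-update : {A : Set} {n : ℕ} (J : Subset n) (v : Vec A n) (i : Fin n) (a : A) → lookup J i ≡ true →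
                    restrict J (v [ i ]≔ a) ↭ a ∷ restrict (J [ i ]≔ false) v
  restrict-update (true  ∷ J) (x ∷ v) zero    a eq = ↭-refl
  restrict-update (true  ∷ J) (x ∷ v) (suc i) a eq = ↭-trans (prep x (restrict-update J v i a eq)) (swap x a ↭-refl)
  restrict-update (false ∷ J) (x ∷ v) (suc i) a eq = restrict-update J v i a eq

  restrict-ignore : {A : Set} {n : ℕ} (J : Subset n) (v : Vec A n) (i : Fin n) (a : A) → lookup J i ≡ false →
                    restrict J (v [ i ]≔ a) ≡ restrict J v
  restrict-ignore (false ∷ J) (x ∷ v) zero    a eq = refl
  restrict-ignore (true  ∷ J) (x ∷ v) (suc i) a eq = cong (x ∷_) (restrict-ignore J v i a eq)
  restrict-ignore (false ∷ J) (x ∷ v) (suc i) a eq = restrict-ignore J v i a eq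

  Separates : ∀ {n} → Subset n → Subset n → Fin n → Set
  Separates J J′ i = lookup J i ≡ true × lookup J′ i ≡ false

  -- The second alternative is the inclusion of `J` in `J′`, recorded only through its consequences
  -- for cardinalities.
  separate : ∀ {n} (J J′ : Subset n) → ∃ (Separates J J′) ⊎ (∣ J ∣ ≤ ∣ J′ ∣ × (∣ J ∣ ≡ ∣ J′ ∣ → J ≡ J′))
  separate [] [] = inj₂ (z≤n , λ _ → refl)
  separate (true ∷ J) (false ∷ J′) = inj₁ (zero , refl , refl)
  separate (true ∷ J) (true ∷ J′) with separate J J′
  ... | inj₁ (i , p)   = inj₁ (suc i , p)
  ... | inj₂ (le , eq) = inj₂ (s≤s le , cong (true ∷_) ∘ eq ∘ ℕₚ.suc-injective)
  separate (false ∷ J) (true ∷ J′) with separate J J′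
  ... | inj₁ (i , p)  = inj₁ (suc i , p)
  ... | inj₂ (le , _) = inj₂ (ℕₚ.m≤n⇒m≤1+n le , λ eq → ⊥-elim (ℕₚ.<-irrefl eq (s≤s le)))
  separate (false ∷ J) (false ∷ J′) with separate J J′
  ... | inj₁ (i , p)   = inj₁ (suc i , p)
  ... | inj₂ (le , eq) = inj₂ (le , cong (false ∷_) ∘ eq)

  subsets : (j n : ℕ) → List (Subset n)
  subsets zero    zero    = [] ∷ []
  subsets (suc j) zero    = []
  subsets zero    (suc n) = map (false ∷_) (subsets zero n)
  subsets (suc j) (suc n) = map (true ∷_) (subsets j n) ++ map (false ∷_) (subsets (suc j) n)

  ∈-subsets : ∀ (j : ℕ) {n} (J : Subset n) → ∣ J ∣ ≡ j → J ∈ subsets j n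
  ∈-subsets zero    []          eq = here refl
  ∈-subsets zero    (false ∷ J) eq = ∈-map⁺ (false ∷_) (∈-subsets zero J eq)
  ∈-subsets (suc j) (true ∷ J)  eq = ∈-++⁺ˡ (∈-map⁺ (true ∷_) (∈-subsets j J (ℕₚ.suc-injective eq)))
  ∈-subsets (suc j) (false ∷ J) eq = ∈-++⁺ʳ (map (true ∷_) (subsets j _)) (∈-map⁺ (false ∷_) (∈-subsets (suc j) J eq))

  subsets-size : ∀ (j n : ℕ) {J : Subset n} → J ∈ subsets j n → ∣ J ∣ ≡ j
  subsets-size zero    zero    (here refl) = refl
  subsets-size zero    (suc n) J∈ with ∈-map⁻ (false ∷_) J∈
  ... | J′ , J′∈ , refl = subsets-size zero n J′∈
  subsets-size (suc j) (suc n) J∈ with ∈-++⁻ (map (true ∷_) (subsets j n)) J∈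
  ... | inj₁ J∈ˡ with ∈-map⁻ (true ∷_) J∈ˡ
  ...   | J′ , J′∈ , refl = cong suc (subsets-size j n J′∈)
  subsets-size (suc j) (suc n) J∈ | inj₂ J∈ʳ with ∈-map⁻ (false ∷_) J∈ʳ
  ...   | J′ , J′∈ , refl = subsets-size (suc j) n J′∈

  length-subsets : ∀ (j n : ℕ) → length (subsets j n) ≤ n ^ j
  length-subsets zero    zero    = ℕₚ.≤-refl
  length-subsets (suc j) zero    = z≤n
  length-subsets zero    (suc n) = ℕₚ.≤-trans (ℕₚ.≤-reflexive (length-map (false ∷_) (subsets zero n))) (length-subsets zero n)
  length-subsets (suc j) (suc n) = begin
    length (map (true ∷_) (subsets j n) ++ map (false ∷_) (subsets (suc j) n))
      ≡⟨ length-++ (map (true ∷_) (subsets j n)) ⟩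
    length (map (true ∷_) (subsets j n)) + length (map (false ∷_) (subsets (suc j) n))
      ≡⟨ cong₂ _+_ (length-map (true ∷_) (subsets j n)) (length-map (false ∷_) (subsets (suc j) n)) ⟩
    length (subsets j n) + length (subsets (suc j) n)
      ≤⟨ ℕₚ.+-mono-≤ (length-subsets j n) (length-subsets (suc j) n) ⟩
    n ^ j + n * n ^ j
      ≤⟨ ℕₚ.*-monoʳ-≤ (suc n) (ℕₚ.^-monoˡ-≤ j (ℕₚ.n≤1+n n)) ⟩
    suc n * suc n ^ j ∎
    where open ℕₚ.≤-Reasoning

  ∑-≤-All : {A : Set} (xs : List A) {f : A → ℕ} {c : ℕ} → All (λ x → f x ≤ c) xs → ∑ xs f ≤ length xs * c
  ∑-≤-All []       []         = z≤n
  ∑-≤-All (x ∷ xs) (le ∷ les) = ℕₚ.+-mono-≤ le (∑-≤-All xs les)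

  ∑≡0 : {A : Set} (xs : List A) {f : A → ℕ} → ∑ xs f ≡ 0 → ∀ {x} → x ∈ xs → f x ≡ 0
  ∑≡0 (x ∷ xs) {f} eq (here refl) = ℕₚ.m+n≡0⇒m≡0 (f x) eq
  ∑≡0 (x ∷ xs) {f} eq (there x∈)  = ∑≡0 xs (ℕₚ.m+n≡0⇒n≡0 (f x) eq) x∈

  module Ranking {A : Set} (F : Finite A) (_⊏_ : A → A → Set) (⊏-trans : Transitive _⊏_) (compare : Trichotomous _≡_ _⊏_) where
    open Finite F using (elems; _≟_; once; ∑-1)
    open ℕₚ.≤-Reasoning

    _⊏?_ : ∀ x y → Dec (x ⊏ y)
    _⊏?_ = tri⇒dec< compare

    rank : A → ℕ
    rank v = count F (λ x → does (x ⊏? v))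

    ⊏-irrefl : ∀ {x} → ¬ x ⊏ x
    ⊏-irrefl {x} x⊏x with compare x x
    ... | tri< _ x≢x _ = x≢x refl
    ... | tri≈ x⊏̸x _ _ = x⊏̸x x⊏x
    ... | tri> _ x≢x _ = x≢x refl

    private
      below-or-equal : ∀ v → count F (λ x → does (x ⊏? v)) + 1 ≡ ∑ elems (λ x → ⟦ does (x ⊏? v) ⟧ + ⟦ does (x ≟ v) ⟧)
      below-or-equal v = trans (cong (rank v +_) (sym (once v))) (sym (∑-+ elems))

    rank-mono : ∀ {v v′} → v ⊏ v′ → rank v < rank v′
    rank-mono {v} {v′} v⊏v′ = begin
      suc (rank v) ≡⟨ ℕₚ.+-comm 1 (rank v) ⟩
      rank v + 1   ≡⟨ below-or-equal v ⟩
      ∑ elems (λ x → ⟦ does (x ⊏? v) ⟧ + ⟦ does (x ≟ v) ⟧) ≤⟨ ∑-mono elems pointwise ⟩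
      rank v′ ∎
      where
      pointwise : ∀ x → ⟦ does (x ⊏? v) ⟧ + ⟦ does (x ≟ v) ⟧ ≤ ⟦ does (x ⊏? v′) ⟧
      pointwise x with x ⊏? v | x ≟ v
      ... | yes x⊏v | yes refl = ⊥-elim (⊏-irrefl x⊏v)
      ... | yes x⊏v | no _     = ℕₚ.≤-reflexive (cong ⟦_⟧ (sym (dec-true (x ⊏? v′) (⊏-trans x⊏v v⊏v′))))
      ... | no _    | yes refl = ℕₚ.≤-reflexive (cong ⟦_⟧ (sym (dec-true (x ⊏? v′) v⊏v′)))
      ... | no _    | no _     = z≤n

    rank<size : ∀ v → rank v < size F
    rank<size v = begin
      suc (rank v) ≡⟨ ℕₚ.+-comm 1 (rank v) ⟩
      rank v + 1   ≡⟨ below-or-equal v ⟩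
      ∑ elems (λ x → ⟦ does (x ⊏? v) ⟧ + ⟦ does (x ≟ v) ⟧) ≤⟨ ∑-mono elems pointwise ⟩
      ∑ elems (λ _ → 1) ≡⟨ ∑-1 ⟩
      size F ∎
      where
      pointwise : ∀ x → ⟦ does (x ⊏? v) ⟧ + ⟦ does (x ≟ v) ⟧ ≤ 1
      pointwise x with x ⊏? v | x ≟ v
      ... | yes x⊏v | yes refl = ⊥-elim (⊏-irrefl x⊏v)
      ... | yes _   | no _     = ℕₚ.≤-refl
      ... | no _    | yes _    = ℕₚ.≤-refl
      ... | no _    | no _     = z≤n

    rank-reflects : ∀ {v v′} → rank v < rank v′ → v ⊏ v′
    rank-reflects {v} {v′} lt with compare v v′
    ... | tri< v⊏v′ _ _ = v⊏v′
    ... | tri≈ _ refl _ = ⊥-elim (ℕₚ.<-irrefl refl lt)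
    ... | tri> _ _ v′⊏v = ⊥-elim (ℕₚ.<-asym lt (rank-mono v′⊏v))

    rank-injective : ∀ v v′ → rank v ≡ rank v′ → v ≡ v′
    rank-injective v v′ eq with compare v v′
    ... | tri< v⊏v′ _ _ = ⊥-elim (ℕₚ.<-irrefl eq (rank-mono v⊏v′))
    ... | tri≈ _ v≡v′ _ = v≡v′
    ... | tri> _ _ v′⊏v = ⊥-elim (ℕₚ.<-irrefl (sym eq) (rank-mono v′⊏v))

    below : ℕ → A → Bool
    below j v = does (rank v ℕₚ.<? j)

    private
      below-suc : ∀ j → count F (below (suc j)) ≤ count F (below j) + count F (λ v → does (rank v ℕₚ.≟ j))
      below-suc j = ℕₚ.≤-trans (∑-mono elems pointwise) (ℕₚ.≤-reflexive (∑-+ elems))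
        where
        pointwise : ∀ v → ⟦ below (suc j) v ⟧ ≤ ⟦ below j v ⟧ + ⟦ does (rank v ℕₚ.≟ j) ⟧
        pointwise v = go (rank v ℕₚ.<? suc j) (rank v ℕₚ.<? j) (rank v ℕₚ.≟ j)
          where
          go : (d : Dec (rank v < suc j)) (d′ : Dec (rank v < j)) (d″ : Dec (rank v ≡ j)) → ⟦ does d ⟧ ≤ ⟦ does d′ ⟧ + ⟦ does d″ ⟧
          go (no _)   _       _       = z≤n
          go (yes _)  (yes _) _       = s≤s z≤n
          go (yes _)  (no _)  (yes _) = ℕₚ.≤-refl
          go (yes lt) (no ≮j) (no ≢j) = ⊥-elim (≮j (ℕₚ.≤∧≢⇒< (ℕ.s≤s⁻¹ lt) ≢j))

      at-most-one : ∀ j → count F (λ v → does (rank v ℕₚ.≟ j)) ≤ 1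
      at-most-one j = count-unique F _ (λ v v′ e e′ → rank-injective v v′
        (trans (does-true (rank v ℕₚ.≟ j) e) (sym (does-true (rank v′ ℕₚ.≟ j) e′))))

      below-+ : ∀ i j → count F (below (i + j)) ≤ i + count F (below j)
      below-+ zero    j = ℕₚ.≤-refl
      below-+ (suc i) j = begin
        count F (below (suc (i + j)))  ≤⟨ below-suc (i + j) ⟩
        count F (below (i + j)) + _    ≤⟨ ℕₚ.+-mono-≤ (below-+ i j) (at-most-one (i + j)) ⟩
        i + count F (below j) + 1      ≡⟨ ℕₚ.+-comm _ 1 ⟩
        suc i + count F (below j)      ∎

      below-0 : count F (below 0) ≡ 0
      below-0 = trans (∑-cong elems (λ v → cong ⟦_⟧ (dec-false (rank v ℕₚ.<? 0) λ ()))) (∑-0 elems)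

      below-size : count F (below (size F)) ≡ size F
      below-size = trans (∑-cong elems (λ v → cong ⟦_⟧ (dec-true (rank v ℕₚ.<? size F) (rank<size v)))) ∑-1

    -- rank is injective into {0, …, size − 1}, hence a bijection onto it.
    count-below : ∀ j → j ≤ size F → count F (below j) ≡ j
    count-below j j≤ = ℕₚ.≤-antisym
      (subst₂ _≤_ (cong (count F ∘ below) (ℕₚ.+-identityʳ j)) (trans (cong (j +_) below-0) (ℕₚ.+-identityʳ j)) (below-+ j 0))
      (ℕₚ.+-cancelˡ-≤ (size F ℕ.∸ j) j _ (begin
        (size F ℕ.∸ j) + j                         ≡⟨ ℕₚ.m∸n+n≡m j≤ ⟩
        size F                                     ≡⟨ below-size ⟨
        count F (below (size F))                   ≡⟨ cong (count F ∘ below) (ℕₚ.m∸n+n≡m j≤) ⟨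
        count F (below ((size F ℕ.∸ j) + j))       ≤⟨ below-+ (size F ℕ.∸ j) j ⟩
        (size F ℕ.∸ j) + count F (below j)         ∎))

    of-rank : ∀ j → j < size F → ∃ λ v → rank v ≡ j
    of-rank j j< with search elems (λ v → does (rank v ℕₚ.≟ j))
    ... | inj₂ (v , e) = v , does-true (rank v ℕₚ.≟ j) e
    ... | inj₁ none    = ⊥-elim (ℕₚ.<-irrefl refl (begin
      suc j                     ≡⟨ count-below (suc j) j< ⟨
      count F (below (suc j))   ≤⟨ below-suc j ⟩
      count F (below j) + _     ≡⟨ cong₂ _+_ (count-below j (ℕₚ.<⇒≤ j<)) none ⟩
      j + 0                     ≡⟨ ℕₚ.+-identityʳ j ⟩
      j                         ∎))

    slice : ℕ → ℕ → A → Bool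
    slice j σ v = below (j + σ) v ∧ not (below j v)

    slice⇒ : ∀ j σ v → slice j σ v ≡ true → j ≤ rank v × rank v < j + σ
    slice⇒ j σ v e = let (p , q) = ∧-true {below (j + σ) v} e in
      ℕₚ.≮⇒≥ (does-false (rank v ℕₚ.<? j) (not-true q)) , does-true (rank v ℕₚ.<? j + σ) p

    count-slice : ∀ j σ → j + σ ≤ size F → count F (slice j σ) ≡ σ
    count-slice j σ le = ℕₚ.+-cancelˡ-≡ j _ σ (begin-equality
      j + count F (slice j σ)
        ≡⟨ cong (_+ count F (slice j σ)) (count-below j (ℕₚ.≤-trans (ℕₚ.m≤m+n j σ) le)) ⟨
      count F (below j) + count F (slice j σ)
        ≡⟨ cong (_+ count F (slice j σ)) (count-cong F (λ v → sym (absorb v))) ⟩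
      count F (λ v → below (j + σ) v ∧ below j v) + count F (slice j σ)
        ≡⟨ count-split F (below (j + σ)) (below j) ⟨
      count F (below (j + σ))
        ≡⟨ count-below (j + σ) le ⟩
      j + σ ∎)
      where
      absorb : ∀ v → below (j + σ) v ∧ below j v ≡ below j v
      absorb v = go (rank v ℕₚ.<? j + σ) (rank v ℕₚ.<? j)
        where
        go : (d : Dec (rank v < j + σ)) (d′ : Dec (rank v < j)) → does d ∧ does d′ ≡ does d′
        go (yes _)  _       = refl
        go (no ≮+) (yes lt) = ⊥-elim (≮+ (ℕₚ.<-≤-trans lt (ℕₚ.m≤m+n j σ)))
        go (no _)  (no _)   = refl

  module Selection (F : BinaryField) where
    open FieldTheory F using (0#)
    open Interpolation F
    open Incidence F
    open Discrepancy F
    open Counting F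
    open Tuples F
    open ℕₚ.≤-Reasoning
    open Finite finiteV using () renaming (_≟_ to _≟ᵥ_)

    ∑ⱽ : ∀ {n} → Vec Region n → (Vec V n → ℕ) → ℕ
    ∑ⱽ []       h = h []
    ∑ⱽ (S ∷ Ss) h = ∑ Vs λ a → ⟦ S a ⟧ * ∑ⱽ Ss (λ v → h (a ∷ v))

    Uniform : ∀ {n} → ℕ → Vec Region n → Set
    Uniform σ Ss = ∀ i → ∣ lookup Ss i ∣ᵣ ≡ σ

    Within : ∀ {n} → Vec Region n → Vec V n → Set
    Within Ss v = ∀ i → lookup Ss i (lookup v i) ≡ true

    ∑ⱽ-mono : ∀ {n} (Ss : Vec Region n) {h h′} → (∀ v → h v ≤ h′ v) → ∑ⱽ Ss h ≤ ∑ⱽ Ss h′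
    ∑ⱽ-mono []       le = le []
    ∑ⱽ-mono (S ∷ Ss) le = ∑-mono Vs (λ a → ℕₚ.*-monoʳ-≤ ⟦ S a ⟧ (∑ⱽ-mono Ss (λ v → le (a ∷ v))))

    ∑ⱽ-+ : ∀ {n} (Ss : Vec Region n) {h h′} → ∑ⱽ Ss (λ v → h v + h′ v) ≡ ∑ⱽ Ss h + ∑ⱽ Ss h′
    ∑ⱽ-+ []       = refl
    ∑ⱽ-+ (S ∷ Ss) = trans (∑-cong Vs (λ a → trans (cong (⟦ S a ⟧ *_) (∑ⱽ-+ Ss)) (ℕₚ.*-distribˡ-+ ⟦ S a ⟧ _ _))) (∑-+ Vs)

    ∑ⱽ-0 : ∀ {n} (Ss : Vec Region n) → ∑ⱽ Ss (λ _ → 0) ≡ 0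
    ∑ⱽ-0 []       = refl
    ∑ⱽ-0 (S ∷ Ss) = trans (∑-cong Vs (λ a → trans (cong (⟦ S a ⟧ *_) (∑ⱽ-0 Ss)) (ℕₚ.*-zeroʳ ⟦ S a ⟧))) (∑-0 Vs)

    ∑ⱽ-∑ : ∀ {n} (Ss : Vec Region n) {X : Set} (xs : List X) {h : X → Vec V n → ℕ} →
           ∑ⱽ Ss (λ v → ∑ xs (λ x → h x v)) ≡ ∑ xs (λ x → ∑ⱽ Ss (h x))
    ∑ⱽ-∑ Ss []       = ∑ⱽ-0 Ss
    ∑ⱽ-∑ Ss (x ∷ xs) {h} = trans (∑ⱽ-+ Ss) (cong (∑ⱽ Ss (h x) +_) (∑ⱽ-∑ Ss xs))

    ∑ⱽ-*ˡ : ∀ {n} (Ss : Vec Region n) c {h} → ∑ⱽ Ss (λ v → c * h v) ≡ c * ∑ⱽ Ss h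
    ∑ⱽ-*ˡ []       c = refl
    ∑ⱽ-*ˡ (S ∷ Ss) c {h} = trans (∑-cong Vs (λ a → trans (cong (⟦ S a ⟧ *_) (∑ⱽ-*ˡ Ss c))
      (solve 3 (λ x y z → x :* (y :* z) := y :* (x :* z)) refl ⟦ S a ⟧ c (∑ⱽ Ss (λ v → h (a ∷ v)))))) (∑-*ˡ Vs c)
      where open ℕ-Solver.+-*-Solver using (solve; _:=_; _:*_)

    ∑ⱽ-1 : ∀ {n σ} (Ss : Vec Region n) → Uniform σ Ss → ∑ⱽ Ss (λ _ → 1) ≡ σ ^ n
    ∑ⱽ-1 []       unif = refl
    ∑ⱽ-1 {suc n} {σ} (S ∷ Ss) unif = trans (∑-*ʳ Vs (∑ⱽ Ss (λ _ → 1))) (cong₂ _*_ (unif zero) (∑ⱽ-1 Ss (unif ∘ suc)))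

    -- Every coordinate outside `J` contributes a factor `σ`. Multiplying by σ to the power ∣ J ∣
    -- avoids subtraction in the exponent.
    ∑ⱽ-restrict : ∀ {n σ} (Ss : Vec Region n) → Uniform σ Ss → (J : Subset n) (h : List V → ℕ) →
      σ ^ ∣ J ∣ * ∑ⱽ Ss (h ∘ restrict J) ≡ σ ^ n * ∑∏ (restrict J Ss) h
    ∑ⱽ-restrict [] unif [] h = refl
    ∑ⱽ-restrict {suc n} {σ} (S ∷ Ss) unif (true ∷ J) h = begin-equality
      σ * σ ^ ∣ J ∣ * ∑ Vs (λ a → ⟦ S a ⟧ * X a)
        ≡⟨ trans (ℕₚ.*-assoc σ _ _) (cong (σ *_) (trans (sym (∑-*ˡ Vs (σ ^ ∣ J ∣))) (∑-cong Vs (λ a →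
             solve 3 (λ x y z → x :* (y :* z) := y :* (x :* z)) refl (σ ^ ∣ J ∣) ⟦ S a ⟧ (X a))))) ⟩
      σ * ∑ Vs (λ a → ⟦ S a ⟧ * (σ ^ ∣ J ∣ * X a))
        ≡⟨ cong (σ *_) (∑-cong Vs (λ a → cong (⟦ S a ⟧ *_) (∑ⱽ-restrict Ss (unif ∘ suc) J (λ u → h (a ∷ u))))) ⟩
      σ * ∑ Vs (λ a → ⟦ S a ⟧ * (σ ^ n * Y a))
        ≡⟨ cong (σ *_) (trans (∑-cong Vs (λ a → solve 3 (λ x y z → y :* (x :* z) := x :* (y :* z)) refl (σ ^ n) ⟦ S a ⟧ (Y a))) (∑-*ˡ Vs (σ ^ n))) ⟩
      σ * (σ ^ n * ∑ Vs (λ a → ⟦ S a ⟧ * Y a))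
        ≡⟨ ℕₚ.*-assoc σ _ _ ⟨
      σ * σ ^ n * ∑ Vs (λ a → ⟦ S a ⟧ * Y a) ∎
      where
      open ℕ-Solver.+-*-Solver using (solve; _:=_; _:*_)
      X Y : V → ℕ
      X a = ∑ⱽ Ss (λ v → h (a ∷ restrict J v))
      Y a = ∑∏ (restrict J Ss) (λ u → h (a ∷ u))
    ∑ⱽ-restrict {suc n} {σ} (S ∷ Ss) unif (false ∷ J) h = begin-equality
      σ ^ ∣ J ∣ * ∑ Vs (λ a → ⟦ S a ⟧ * ∑ⱽ Ss (h ∘ restrict J))
        ≡⟨ cong (σ ^ ∣ J ∣ *_) (trans (∑-*ʳ Vs _) (cong (_* ∑ⱽ Ss (h ∘ restrict J)) (unif zero))) ⟩
      σ ^ ∣ J ∣ * (σ * ∑ⱽ Ss (h ∘ restrict J))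
        ≡⟨ solve 3 (λ x y z → x :* (y :* z) := y :* (x :* z)) refl (σ ^ ∣ J ∣) σ _ ⟩
      σ * (σ ^ ∣ J ∣ * ∑ⱽ Ss (h ∘ restrict J))
        ≡⟨ cong (σ *_) (∑ⱽ-restrict Ss (unif ∘ suc) J h) ⟩
      σ * (σ ^ n * ∑∏ (restrict J Ss) h)
        ≡⟨ ℕₚ.*-assoc σ _ _ ⟨
      σ * σ ^ n * ∑∏ (restrict J Ss) h ∎
      where open ℕ-Solver.+-*-Solver using (solve; _:=_; _:*_)

    -- A natural-number weight of average below 1 vanishes somewhere. The vector is found one
    -- coordinate at a time, keeping the conditional average below 1.
    ∑ⱽ-zero : ∀ {n σ} (Ss : Vec Region n) → Uniform σ Ss → (h : Vec V n → ℕ) → ∑ⱽ Ss h < σ ^ n →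
              Σ (Vec V n) λ v → Within Ss v × h v ≡ 0
    ∑ⱽ-zero []       unif h lt = [] , (λ ()) , ℕₚ.n<1⇒n≡0 lt
    ∑ⱽ-zero {suc n} {σ} (S ∷ Ss) unif h lt =
      let (a , Sa , lt′) = ∑-< Vs S (λ a → ∑ⱽ Ss (λ v → h (a ∷ v))) (σ ^ n) (subst (λ z → ∑ⱽ (S ∷ Ss) h < z * σ ^ n) (sym (unif zero)) lt)
          (v , within , hv≡0) = ∑ⱽ-zero Ss (unif ∘ suc) (λ v → h (a ∷ v)) lt′
      in a ∷ v , (λ { zero → Sa ; (suc i) → within i }) , hv≡0

    ∑ⱽ-one-free : ∀ {n σ} (Ss : Vec Region n) → Uniform σ Ss → (i : Fin n) (h : Vec V n → ℕ) →
      (∀ v → ∑ Vs (λ a → ⟦ lookup Ss i a ⟧ * h (v [ i ]≔ a)) ≤ 1) → σ * ∑ⱽ Ss h ≤ σ ^ n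
    ∑ⱽ-one-free {suc n} {σ} (S ∷ Ss) unif zero h free = ℕₚ.*-monoʳ-≤ σ (begin
      ∑ Vs (λ a → ⟦ S a ⟧ * ∑ⱽ Ss (λ v → h (a ∷ v)))       ≡⟨ ∑-cong Vs (λ a → ∑ⱽ-*ˡ Ss ⟦ S a ⟧) ⟨
      ∑ Vs (λ a → ∑ⱽ Ss (λ v → ⟦ S a ⟧ * h (a ∷ v)))       ≡⟨ ∑ⱽ-∑ Ss Vs ⟨
      -- The zero point is a placeholder that the update at position `zero` overwrites.
      ∑ⱽ Ss (λ v → ∑ Vs (λ a → ⟦ S a ⟧ * h (a ∷ v)))       ≤⟨ ∑ⱽ-mono Ss (λ v → free ((0# , 0#) ∷ v)) ⟩
      ∑ⱽ Ss (λ _ → 1)                                      ≡⟨ ∑ⱽ-1 Ss (unif ∘ suc) ⟩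
      σ ^ n                                                ∎)
    ∑ⱽ-one-free {suc n} {σ} (S ∷ Ss) unif (suc i) h free = begin
      σ * ∑ Vs (λ a → ⟦ S a ⟧ * X a)         ≡⟨ trans (sym (∑-*ˡ Vs σ)) (∑-cong Vs (λ a → solve 3 (λ x y z → x :* (y :* z) := y :* (x :* z)) refl σ ⟦ S a ⟧ (X a))) ⟩
      ∑ Vs (λ a → ⟦ S a ⟧ * (σ * X a))       ≤⟨ weighted-≤ S (λ a _ → ∑ⱽ-one-free Ss (unif ∘ suc) i (λ v → h (a ∷ v)) (λ v → free (a ∷ v))) ⟩
      ∣ S ∣ᵣ * σ ^ n                         ≡⟨ cong (_* σ ^ n) (unif zero) ⟩
      σ * σ ^ n                              ∎
      where
      open ℕ-Solver.+-*-Solver using (solve; _:=_; _:*_)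
      X : V → ℕ
      X a = ∑ⱽ Ss (λ v → h (a ∷ v))

    module _ {n′ : ℕ} (r : ℕ) (U : Region) where

      -- Both tuples are required to be good, so that the coinciding apexes really come from links
      -- and `link-latin` applies.
      collide : Subset n′ → Subset n′ → Vec V n′ → Bool
      collide J J′ v = does (apex r (restrict J v) ≟ᵥ apex r (restrict J′ v)) ∧
        (does (bad r U (restrict J v) ℕₚ.≟ 0) ∧ does (bad r U (restrict J′ v) ℕₚ.≟ 0))

      collide⇒ : ∀ J J′ v → collide J J′ v ≡ true →
                 apex r (restrict J v) ≡ apex r (restrict J′ v) × bad r U (restrict J v) ≡ 0
      collide⇒ J J′ v e =
        let (p , q) = ∧-true {does (apex r (restrict J v) ≟ᵥ apex r (restrict J′ v))} e
            (q₁ , _) = ∧-true {does (bad r U (restrict J v) ℕₚ.≟ 0)} q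
        in does-true (apex r (restrict J v) ≟ᵥ apex r (restrict J′ v)) p , does-true (bad r U (restrict J v) ℕₚ.≟ 0) q₁

      -- Let only the point at a position i in J but not in J′ vary. The apex of J′ stays fixed, and
      -- by `link-latin` at most one value of the moving point gives J the same apex.
      collide-sum : ∀ {σ} (Ss : Vec Region n′) → Uniform σ Ss → ∀ J J′ i → Separates J J′ i →
                    σ * ∑ⱽ Ss (λ v → ⟦ collide J J′ v ⟧) ≤ σ ^ n′
      collide-sum Ss unif J J′ i (Ji , J′i) = ∑ⱽ-one-free Ss unif i (λ v → ⟦ collide J J′ v ⟧) (λ v → ℕₚ.≤-trans
        (weighted-drop (lookup Ss i) (λ a → ⟦ collide J J′ (v [ i ]≔ a) ⟧))
        (count-unique finiteV (λ a → collide J J′ (v [ i ]≔ a)) (λ a a′ e e′ → link-latin (linked v a e) (linked v a′ e′))))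
        where
        linked : ∀ v a → collide J J′ (v [ i ]≔ a) ≡ true →
                 Link (suc r) (a ∷ restrict (J [ i ]≔ false) v) (apex r (restrict J′ v))
        linked v a e = let (same , ok) = collide⇒ J J′ (v [ i ]≔ a) e in
          subst (Link (suc r) _) (trans same (cong (apex r) (restrict-ignore J′ v i a J′i)))
            (link-↭ (restrict-update J v i a Ji) (proj₁ (bad≡0⇒link r U (restrict J (v [ i ]≔ a)) ok)))

    -- `point` holds y 2, ..., y n, the region `S₁` is the slice meant for y 1, and `I` is the index
    -- set with 1 removed.
    record Selected {n′ : ℕ} (r : ℕ) (Ss : Vec Region n′) (S₁ U U₁ : Region) (I : Subset n′) : Set where
      field
        point     : Vec V n′
        within    : Within Ss point
        good      : ∀ J → ∣ J ∣ ≡ 2 + r → bad r U (restrict J point) ≡ 0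
        unblocked : blocked r S₁ U₁ (restrict I point) ≡ 0
        injective : ∀ J J′ → ∣ J ∣ ≡ 2 + r → ∣ J′ ∣ ≡ 2 + r → apex r (restrict J point) ≡ apex r (restrict J′ point) → J ≡ J′

    -- The weight `h₁` charges bad tuples, `h₂` a blocked `I`, `h₃` collisions of apexes. Each
    -- averages at most 1/4, so their sum averages at most 3/4 and `∑ⱽ-zero` applies.
    select : ∀ {n′ r σ} (Ss : Vec Region n′) (S₁ U U₁ : Region) (I : Subset n′) → Uniform σ Ss → ∣ I ∣ ≡ 1 + r →
      (∀ J → ∣ J ∣ ≡ 2 + r → 4 * (n′ ^ (2 + r) * ∑∏ (restrict J Ss) (bad r U)) ≤ σ ^ (2 + r)) →
      4 * ∑∏ (restrict I Ss) (blocked r S₁ U₁) ≤ σ ^ (1 + r) →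
      4 * (n′ ^ (2 + r) * n′ ^ (2 + r)) ≤ σ → 1 ≤ σ →
      Selected r Ss S₁ U U₁ I
    select {n′} {r} {σ} Ss S₁ U U₁ I unif ∣I∣ bad-small blocked-small collide-small 1≤σ =
      let (v , within , hv≡0) = ∑ⱽ-zero Ss unif h total<
          (h₁₂≡0 , h₃≡0) = +≡0 (h₁ v + h₂ v) (h₃ v) hv≡0
          (h₁≡0 , h₂≡0) = +≡0 (h₁ v) (h₂ v) h₁₂≡0
      in record
        { point = v ; within = within ; good = good v h₁≡0 ; unblocked = h₂≡0
        ; injective = λ J J′ ∣J∣ ∣J′∣ same → distinct v J J′ ∣J∣ ∣J′∣ (good v h₁≡0 J ∣J∣) (good v h₁≡0 J′ ∣J′∣) same
            (no-collision v h₃≡0 J J′ ∣J∣ ∣J′∣) }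
      where
      +≡0 : ∀ a b → a + b ≡ 0 → a ≡ 0 × b ≡ 0
      +≡0 a b eq = ℕₚ.m+n≡0⇒m≡0 a eq , ℕₚ.m+n≡0⇒n≡0 a eq
      abstract
        Js : List (Subset n′)
        Js = subsets (2 + r) n′
        ∈Js : ∀ J → ∣ J ∣ ≡ 2 + r → J ∈ Js
        ∈Js = ∈-subsets (2 + r)
        Js-size : ∀ {J} → J ∈ Js → ∣ J ∣ ≡ 2 + r
        Js-size = subsets-size (2 + r) n′
        ∣Js∣≤ : length Js ≤ n′ ^ (2 + r)
        ∣Js∣≤ = length-subsets (2 + r) n′
      distinctᵇ : Subset n′ → Subset n′ → Bool
      distinctᵇ J J′ with separate J J′
      ... | inj₁ _ = true
      ... | inj₂ _ = false
      h₁ h₂ h₃ h : Vec V n′ → ℕ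
      h₁ v = ∑ Js (λ J → bad r U (restrict J v))
      h₂ v = blocked r S₁ U₁ (restrict I v)
      h₃ v = ∑ Js (λ J → ∑ Js (λ J′ → ⟦ distinctᵇ J J′ ⟧ * ⟦ collide r U J J′ v ⟧))
      h v = h₁ v + h₂ v + h₃ v
      good : ∀ v → h₁ v ≡ 0 → ∀ J → ∣ J ∣ ≡ 2 + r → bad r U (restrict J v) ≡ 0
      good v eq J ∣J∣ = ∑≡0 Js {λ J → bad r U (restrict J v)} eq (∈Js J ∣J∣)
      no-collision : ∀ v → h₃ v ≡ 0 → ∀ J J′ → ∣ J ∣ ≡ 2 + r → ∣ J′ ∣ ≡ 2 + r → ⟦ distinctᵇ J J′ ⟧ * ⟦ collide r U J J′ v ⟧ ≡ 0
      no-collision v eq J J′ ∣J∣ ∣J′∣ = ∑≡0 Js {λ J′ → ⟦ distinctᵇ J J′ ⟧ * ⟦ collide r U J J′ v ⟧}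
        (∑≡0 Js {λ J → ∑ Js (λ J′ → ⟦ distinctᵇ J J′ ⟧ * ⟦ collide r U J J′ v ⟧)} eq (∈Js J ∣J∣)) (∈Js J′ ∣J′∣)
      N S : ℕ
      N = n′ ^ (2 + r)
      S = σ ^ n′
      σ≢0 : NonZero σ
      σ≢0 = ℕ.>-nonZero 1≤σ
      cancel : ∀ j {x y} → σ ^ j * x ≤ σ ^ j * y → x ≤ y
      cancel j {x} {y} le = ℕₚ.*-cancelˡ-≤ (σ ^ j) {{ℕₚ.m^n≢0 σ j {{σ≢0}}}} le
      distinct : ∀ v J J′ → ∣ J ∣ ≡ 2 + r → ∣ J′ ∣ ≡ 2 + r → bad r U (restrict J v) ≡ 0 → bad r U (restrict J′ v) ≡ 0 →
        apex r (restrict J v) ≡ apex r (restrict J′ v) → ⟦ distinctᵇ J J′ ⟧ * ⟦ collide r U J J′ v ⟧ ≡ 0 → J ≡ J′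
      distinct v J J′ ∣J∣ ∣J′∣ good good′ same eq with separate J J′
      ... | inj₂ (_ , J≡J′) = J≡J′ (trans ∣J∣ (sym ∣J′∣))
      ... | inj₁ _ = ⊥-elim (1≢0 (trans (cong (λ b → 1 * ⟦ b ⟧) (sym collided)) eq))
        where
        1≢0 : 1 ≢ 0
        1≢0 ()
        collided : collide r U J J′ v ≡ true
        collided = ∧-intro (dec-true (_ ≟ᵥ _) same) (∧-intro (dec-true (_ ℕₚ.≟ 0) good) (dec-true (_ ℕₚ.≟ 0) good′))
      part₁ : 4 * ∑ⱽ Ss h₁ ≤ S
      part₁ = cancel (2 + r) (begin
        σ ^ (2 + r) * (4 * ∑ⱽ Ss h₁)
          ≡⟨ cong (λ z → σ ^ (2 + r) * (4 * z)) (∑ⱽ-∑ Ss Js {λ J v → bad r U (restrict J v)}) ⟩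
        σ ^ (2 + r) * (4 * ∑ Js (λ J → ∑ⱽ Ss (bad r U ∘ restrict J)))
          ≡⟨ trans (solve 2 (λ x y → x :* (con 4 :* y) := con 4 :* (x :* y)) refl (σ ^ (2 + r)) _) (cong (4 *_) (sym (∑-*ˡ Js (σ ^ (2 + r))))) ⟩
        4 * ∑ Js (λ J → σ ^ (2 + r) * ∑ⱽ Ss (bad r U ∘ restrict J))
          ≤⟨ weigh ⟩
        σ ^ (2 + r) * S ∎)
        where
        open ℕ-Solver.+-*-Solver using (solve; _:=_; _:*_; con)
        per-J : All (λ J → N * (4 * (σ ^ (2 + r) * ∑ⱽ Ss (bad r U ∘ restrict J))) ≤ σ ^ (2 + r) * S) Js
        per-J = All.tabulate (λ {J} J∈ → let ∣J∣ = Js-size {J} J∈ in begin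
          N * (4 * (σ ^ (2 + r) * ∑ⱽ Ss (bad r U ∘ restrict J)))
            ≡⟨ cong (λ j → N * (4 * (σ ^ j * ∑ⱽ Ss (bad r U ∘ restrict J)))) ∣J∣ ⟨
          N * (4 * (σ ^ ∣ J ∣ * ∑ⱽ Ss (bad r U ∘ restrict J)))
            ≡⟨ cong (λ z → N * (4 * z)) (∑ⱽ-restrict Ss unif J (bad r U)) ⟩
          N * (4 * (S * ∑∏ (restrict J Ss) (bad r U)))
            ≡⟨ solve 3 (λ n s b → n :* (con 4 :* (s :* b)) := (con 4 :* (n :* b)) :* s) refl N S (∑∏ (restrict J Ss) (bad r U)) ⟩
          (4 * (N * ∑∏ (restrict J Ss) (bad r U))) * S
            ≤⟨ ℕₚ.*-monoˡ-≤ S (bad-small J ∣J∣) ⟩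
          σ ^ (2 + r) * S ∎)
        -- Cancelling `N` requires it to be nonzero; if `N` is zero, there are no sets J to sum
        -- over.
        weigh : 4 * ∑ Js (λ J → σ ^ (2 + r) * ∑ⱽ Ss (bad r U ∘ restrict J)) ≤ σ ^ (2 + r) * S
        weigh with N ℕₚ.≟ 0
        ... | yes N≡0 = ℕₚ.≤-trans (ℕₚ.≤-reflexive (cong (4 *_) (empty Js (ℕₚ.n≤0⇒n≡0 (subst (length Js ≤_) N≡0 ∣Js∣≤))))) z≤n
          where
          empty : ∀ xs {f : Subset n′ → ℕ} → length xs ≡ 0 → ∑ xs f ≡ 0
          empty [] _ = refl
        ... | no N≢0 = ℕₚ.*-cancelˡ-≤ N {{ℕ.≢-nonZero N≢0}} (begin
          N * (4 * ∑ Js (λ J → σ ^ (2 + r) * ∑ⱽ Ss (bad r U ∘ restrict J)))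
            ≡⟨ trans (∑-*ˡ Js N) (cong (N *_) (∑-*ˡ Js 4)) ⟨
          ∑ Js (λ J → N * (4 * (σ ^ (2 + r) * ∑ⱽ Ss (bad r U ∘ restrict J))))
            ≤⟨ ∑-≤-All Js per-J ⟩
          length Js * (σ ^ (2 + r) * S)
            ≤⟨ ℕₚ.*-monoˡ-≤ _ ∣Js∣≤ ⟩
          N * (σ ^ (2 + r) * S) ∎)
      part₂ : 4 * ∑ⱽ Ss h₂ ≤ S
      part₂ = cancel (1 + r) (begin
        σ ^ (1 + r) * (4 * ∑ⱽ Ss h₂)
          ≡⟨ trans (solve 2 (λ x y → x :* (con 4 :* y) := con 4 :* (x :* y)) refl (σ ^ (1 + r)) _)
               (cong (4 *_) (trans (cong (λ j → σ ^ j * ∑ⱽ Ss h₂) (sym ∣I∣)) (∑ⱽ-restrict Ss unif I (blocked r S₁ U₁)))) ⟩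
        4 * (S * ∑∏ (restrict I Ss) (blocked r S₁ U₁))
          ≡⟨ solve 2 (λ s b → con 4 :* (s :* b) := (con 4 :* b) :* s) refl S _ ⟩
        (4 * ∑∏ (restrict I Ss) (blocked r S₁ U₁)) * S
          ≤⟨ ℕₚ.*-monoˡ-≤ S blocked-small ⟩
        σ ^ (1 + r) * S ∎)
        where open ℕ-Solver.+-*-Solver using (solve; _:=_; _:*_; con)
      per-pair : ∀ J J′ → σ * ∑ⱽ Ss (λ v → ⟦ distinctᵇ J J′ ⟧ * ⟦ collide r U J J′ v ⟧) ≤ S
      per-pair J J′ with separate J J′
      ... | inj₂ _ = ℕₚ.≤-trans (ℕₚ.≤-reflexive (trans (cong (σ *_) (∑ⱽ-0 Ss)) (ℕₚ.*-zeroʳ σ))) z≤n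
      ... | inj₁ (i , sep) = ℕₚ.≤-trans (ℕₚ.≤-reflexive (cong (σ *_) (trans (∑ⱽ-*ˡ Ss 1) (ℕₚ.*-identityˡ _)))) (collide-sum r U Ss unif J J′ i sep)
      part₃ : 4 * ∑ⱽ Ss h₃ ≤ S
      part₃ = ℕₚ.*-cancelˡ-≤ σ {{σ≢0}} (begin
        σ * (4 * ∑ⱽ Ss h₃)
          ≡⟨ cong (λ z → σ * (4 * z)) (trans (∑ⱽ-∑ Ss Js {Y}) (∑-cong Js (λ J → ∑ⱽ-∑ Ss Js {λ J′ v → ⟦ distinctᵇ J J′ ⟧ * ⟦ collide r U J J′ v ⟧}))) ⟩
        σ * (4 * ∑ Js (λ J → ∑ Js (λ J′ → X J J′)))
          ≡⟨ trans (solve 2 (λ x y → x :* (con 4 :* y) := con 4 :* (x :* y)) refl σ _)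
               (cong (4 *_) (trans (sym (∑-*ˡ Js σ {λ J → ∑ Js (X J)})) (∑-cong Js (λ J → sym (∑-*ˡ Js σ {X J}))))) ⟩
        4 * ∑ Js (λ J → ∑ Js (λ J′ → σ * X J J′))
          ≤⟨ ℕₚ.*-monoʳ-≤ 4 (∑-mono Js (λ J → ∑-mono Js (per-pair J))) ⟩
        4 * ∑ Js (λ J → ∑ Js (λ J′ → S))
          ≡⟨ cong (4 *_) (trans (∑-cong Js (λ _ → ∑-const Js S)) (∑-const Js _)) ⟩
        4 * (length Js * (length Js * S))
          ≤⟨ ℕₚ.*-monoʳ-≤ 4 (ℕₚ.*-mono-≤ ∣Js∣≤ (ℕₚ.*-monoˡ-≤ S ∣Js∣≤)) ⟩
        4 * (N * (N * S))
          ≡⟨ solve 2 (λ n s → con 4 :* (n :* (n :* s)) := (con 4 :* (n :* n)) :* s) refl N S ⟩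
        (4 * (N * N)) * S
          ≤⟨ ℕₚ.*-monoˡ-≤ S collide-small ⟩
        σ * S ∎)
        where
        open ℕ-Solver.+-*-Solver using (solve; _:=_; _:*_; con)
        Y : Subset n′ → Vec V n′ → ℕ
        Y J v = ∑ Js (λ J′ → ⟦ distinctᵇ J J′ ⟧ * ⟦ collide r U J J′ v ⟧)
        X : Subset n′ → Subset n′ → ℕ
        X J J′ = ∑ⱽ Ss (λ v → ⟦ distinctᵇ J J′ ⟧ * ⟦ collide r U J J′ v ⟧)
      total< : ∑ⱽ Ss h < S
      total< = ℕₚ.*-cancelˡ-< 4 _ _ (begin-strict
        4 * ∑ⱽ Ss h
          ≡⟨ cong (4 *_) (trans (∑ⱽ-+ Ss) (cong (_+ ∑ⱽ Ss h₃) (∑ⱽ-+ Ss))) ⟩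
        4 * (∑ⱽ Ss h₁ + ∑ⱽ Ss h₂ + ∑ⱽ Ss h₃)
          ≡⟨ solve 3 (λ a b c → con 4 :* (a :+ b :+ c) := con 4 :* a :+ con 4 :* b :+ con 4 :* c) refl (∑ⱽ Ss h₁) (∑ⱽ Ss h₂) (∑ⱽ Ss h₃) ⟩
        4 * ∑ⱽ Ss h₁ + 4 * ∑ⱽ Ss h₂ + 4 * ∑ⱽ Ss h₃
          ≤⟨ ℕₚ.+-mono-≤ (ℕₚ.+-mono-≤ part₁ part₂) part₃ ⟩
        S + S + S
          ≡⟨ solve 1 (λ s → s :+ s :+ s := con 3 :* s) refl S ⟩
        3 * S
          <⟨ ℕₚ.*-monoˡ-< S {{ℕₚ.m^n≢0 σ n′ {{σ≢0}}}} (ℕₚ.≤-refl {4}) ⟩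
        4 * S ∎)
        where open ℕ-Solver.+-*-Solver using (solve; _:=_; _:+_; _:*_; con)

-- Size conditions on the parameters and the resulting estimates.

module QuantitativeBounds where

  open import Data.Bool using (true; false; not; _∧_)
  open import Data.Fin using (suc)
  open import Data.Fin.Subset using (Subset; ∣_∣)
  open import Data.List using (length)
  open import Data.List.Relation.Unary.All using (All)
  import Data.Nat as ℕ
  open import Data.Nat using (ℕ; suc; _+_; _*_; _∸_; _/_; _≤_; z≤n; s≤s; _^_; NonZero)
  import Data.Nat.DivMod as DivMod
  import Data.Nat.Properties as ℕₚ
  import Data.Nat.Solver as ℕ-Solver
  open import Data.Product using (_,_; proj₁; proj₂)
  open import Data.Vec using (Vec; lookup)
  open import Function using (_∘_)
  open import Relation.Binary.PropositionalEquality
  open FiniteSums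
  open BinaryFields
  open DividedDifferences
  open FourCycles
  open IncidenceGeometry
  open DiscrepancyBound
  open EdgeCounts
  open TupleCounts
  open SelectionByCounting

  ≤-/ : ∀ m n o .{{_ : NonZero m}} → m * n ≤ o → n ≤ o / m
  ≤-/ m n o le = begin
    n           ≡⟨ DivMod.m*n/n≡m n m ⟨
    n * m / m   ≤⟨ DivMod./-monoˡ-≤ m (ℕₚ.≤-trans (ℕₚ.≤-reflexive (ℕₚ.*-comm n m)) le) ⟩
    o / m       ∎
    where open ℕₚ.≤-Reasoning

  module Quantitative (F : BinaryField) (2≤s : 2 ≤ order F) (r n G L σ : ℕ) where
    open Incidence F
    open Discrepancy F
    open Counting F
    open Tuples F
    open Selection F
    open ℕₚ.≤-Reasoning
    open ℕ-Solver.+-*-Solver using (solve; _:=_; _:+_; _:*_; con)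

    N : ℕ
    N = n ^ (2 + r)

    -- A slice of `σ` points is about a 1/G fraction of a copy, and `L` is the factor gained in the
    -- discrepancy. `big₁` controls the expected edges into the forbidden region, `big₂` and `big₄`
    -- coinciding nodes, `big₃` the points lost from the first slice by division. The two conditions
    -- on `L` make the discrepancy negligible for bad pairs and for unhit points, respectively.
    record Conditions : Set where
      field
        1≤n   : 1 ≤ n
        big₁  : 128 * (N * suc n) ≤ G
        big₂  : 8 * (N * (4 + bad-constant r)) ≤ G
        big₃  : 2 * r + 4 ≤ G
        big₄  : 8 * blocked-constant r ≤ G
        Gσ≤q  : G * σ ≤ q
        q≤2Gσ : q ≤ 2 * (G * σ)
        2GG≤s : 2 * (G * G) ≤ s
        L-big₁ : 4 * (G * G) * (64 * N) ≤ L
        L-big₂ : 8 * (G * (G * G)) * 32 ≤ L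
        large : 3 * L ^ 4 ≤ s

    module Bounds (C : Conditions) where
      open Conditions C

      private
        4≤G : 4 ≤ G
        4≤G = ℕₚ.≤-trans (ℕₚ.m≤n+m 4 (2 * r)) big₃

        G≢0 : NonZero G
        G≢0 = ℕ.>-nonZero (ℕₚ.<-≤-trans (s≤s z≤n) 4≤G)

        1≤N : 1 ≤ N
        1≤N = ℕₚ.≤-trans (ℕₚ.≤-reflexive (sym (ℕₚ.^-zeroˡ (2 + r)))) (ℕₚ.^-monoˡ-≤ (2 + r) 1≤n)

        -- Follows from s² = q ≤ 2 G σ and 2 G² ≤ s. Lines, with their `s` points, are thus smaller
        -- than slices by a factor `G`; this is how `scaled` absorbs the error terms that are
        -- multiples of `s`.
        Gs≤σ : G * s ≤ σ
        Gs≤σ = ℕₚ.*-cancelˡ-≤ (2 * G) {{ℕₚ.m*n≢0 2 G {{_}} {{G≢0}}}} (begin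
          2 * G * (G * s)      ≡⟨ solve 2 (λ g s → con 2 :* g :* (g :* s) := (con 2 :* (g :* g)) :* s) refl G s ⟩
          2 * (G * G) * s      ≤⟨ ℕₚ.*-monoˡ-≤ s 2GG≤s ⟩
          s * s                ≡⟨ q≡s*s ⟨
          q                    ≤⟨ q≤2Gσ ⟩
          2 * (G * σ)          ≡⟨ ℕₚ.*-assoc 2 G σ ⟨
          2 * G * σ            ∎)

        scaled : ∀ {k} → k ≤ G → k * s ≤ σ
        scaled le = ℕₚ.≤-trans (ℕₚ.*-monoˡ-≤ s le) Gs≤σ

        s≤σ : s ≤ σ
        s≤σ = ℕₚ.≤-trans (ℕₚ.≤-reflexive (sym (ℕₚ.*-identityˡ s))) (scaled {1} (ℕₚ.≤-trans (s≤s z≤n) 4≤G))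

      1≤σ : 1 ≤ σ
      1≤σ = ℕₚ.≤-trans (ℕₚ.≤-trans (s≤s z≤n) 2≤s) s≤σ

      private
        s⁶≡q³ : s ^ 6 ≡ q * (q * q)
        s⁶≡q³ = trans (solve 1 (λ s → s :* (s :* (s :* (s :* (s :* (s :* con 1))))) := (s :* s) :* ((s :* s) :* (s :* s))) refl s) (sym (cong (λ z → z * (z * z)) q≡s*s))

        q²≤ : q * q ≤ 4 * (G * G) * (σ * σ)
        q²≤ = ℕₚ.≤-trans (ℕₚ.*-mono-≤ q≤2Gσ q≤2Gσ)
          (ℕₚ.≤-reflexive (solve 2 (λ g σ → (con 2 :* (g :* σ)) :* (con 2 :* (g :* σ)) := con 4 :* (g :* g) :* (σ :* σ)) refl G σ))

        4GG≢0 : NonZero (4 * (G * G))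
        4GG≢0 = ℕₚ.m*n≢0 4 (G * G) {{_}} {{ℕₚ.m*n≢0 G G {{G≢0}} {{G≢0}}}}

        disc₁ : ∀ e → L * e ≤ s ^ 6 → 64 * N * e ≤ q * (σ * σ)
        disc₁ e le = ℕₚ.*-cancelˡ-≤ (4 * (G * G)) {{4GG≢0}} (begin
          4 * (G * G) * (64 * N * e)   ≡⟨ ℕₚ.*-assoc (4 * (G * G)) (64 * N) e ⟨
          4 * (G * G) * (64 * N) * e   ≤⟨ ℕₚ.*-monoˡ-≤ e L-big₁ ⟩
          L * e                        ≤⟨ le ⟩
          s ^ 6                        ≡⟨ s⁶≡q³ ⟩
          q * (q * q)                  ≤⟨ ℕₚ.*-monoʳ-≤ q q²≤ ⟩
          q * (4 * (G * G) * (σ * σ))  ≡⟨ solve 3 (λ q g σ → q :* (con 4 :* (g :* g) :* (σ :* σ)) := con 4 :* (g :* g) :* (q :* (σ :* σ))) refl q G σ ⟩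
          4 * (G * G) * (q * (σ * σ))  ∎)

        disc₂ : ∀ e → L * e ≤ s ^ 6 → 32 * e ≤ σ * (σ * σ)
        disc₂ e le = ℕₚ.*-cancelˡ-≤ (8 * G³) {{ℕₚ.m*n≢0 8 G³ {{_}} {{ℕₚ.m*n≢0 G (G * G) {{G≢0}} {{ℕₚ.m*n≢0 G G {{G≢0}} {{G≢0}}}}}}}} (begin
          8 * G³ * (32 * e)                          ≡⟨ ℕₚ.*-assoc (8 * G³) 32 e ⟨
          8 * G³ * 32 * e                            ≤⟨ ℕₚ.*-monoˡ-≤ e L-big₂ ⟩
          L * e                                      ≤⟨ le ⟩
          s ^ 6                                      ≡⟨ s⁶≡q³ ⟩
          q * (q * q)                                ≤⟨ ℕₚ.*-mono-≤ q≤2Gσ q²≤ ⟩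
          2 * (G * σ) * (4 * (G * G) * (σ * σ))      ≡⟨ solve 2 (λ g σ → con 2 :* (g :* σ) :* (con 4 :* (g :* g) :* (σ :* σ)) := con 8 :* (g :* (g :* g)) :* (σ :* (σ :* σ))) refl G σ ⟩
          8 * G³ * (σ * (σ * σ))                     ∎)
          where
          G³ : ℕ
          G³ = G * (G * G)

        q≢0 : NonZero q
        q≢0 = ℕ.>-nonZero (ℕₚ.≤-trans (ℕₚ.*-mono-≤ {1} (ℕₚ.≤-trans (s≤s z≤n) 2≤s) (ℕₚ.≤-trans (s≤s z≤n) 2≤s)) (ℕₚ.≤-reflexive (sym q≡s*s)))

        16N≢0 : NonZero (16 * N)
        16N≢0 = ℕₚ.m*n≢0 16 N {{_}} {{ℕ.>-nonZero 1≤N}}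

      module _ (U : Region) (∣U∣ : count finiteV U ≤ suc n * σ) where

        -- The expected count uses up half of the allowance by `big₁`, the discrepancy the other
        -- half by `disc₁`.
        edges-small : ∀ A B → ∣ A ∣ᵣ ≤ σ → ∣ B ∣ᵣ ≤ σ → 16 * N * edges (sloped U) A B ≤ σ * σ
        edges-small A B ∣A∣ ∣B∣ = ℕₚ.*-cancelˡ-≤ q {{q≢0}} (begin
          q * (16 * N * TU)
            ≤⟨ ℕₚ.*-monoˡ-≤ (16 * N * TU) (2lines 2≤s) ⟩
          2 * lines * (16 * N * TU)
            ≡⟨ solve 3 (λ l n t → con 2 :* l :* (con 16 :* n :* t) := con 32 :* n :* (l :* t)) refl lines N TU ⟩
          32 * N * (lines * TU)
            ≤⟨ ℕₚ.*-monoʳ-≤ (32 * N) (proj₁ (∣m-n∣-bounds (lines * TU) (∣sloped∣ U * edges nonzero A B))) ⟩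
          32 * N * (∣sloped∣ U * edges nonzero A B + e)
            ≤⟨ ℕₚ.*-monoʳ-≤ (32 * N) (ℕₚ.+-monoˡ-≤ e (ℕₚ.*-mono-≤ u≤ E≤)) ⟩
          32 * N * (suc n * σ * (σ * (σ + σ)) + e)
            ≡⟨ solve 4 (λ n m σ e → con 32 :* n :* (m :* σ :* (σ :* (σ :+ σ)) :+ e) := con 64 :* (n :* m) :* σ :* (σ :* σ) :+ con 32 :* n :* e) refl N (suc n) σ e ⟩
          64 * (N * suc n) * σ * (σ * σ) + 32 * N * e
            ≤⟨ ℕₚ.*-cancelˡ-≤ 2 halves ⟩
          q * (σ * σ) ∎)
          where
          TU e : ℕ
          TU = edges (sloped U) A B
          e = discrepancy A B U
          u≤ : ∣sloped∣ U ≤ suc n * σ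
          u≤ = ℕₚ.≤-trans (∑-mono Vs (λ c → ⟦⟧-mono {nonzero c ∧ U c} (λ eq → proj₂ (∧-true {nonzero c} eq)))) ∣U∣
          E≤ : edges nonzero A B ≤ σ * (σ + σ)
          E≤ = ℕₚ.≤-trans (edges-upper A B) (ℕₚ.*-mono-≤ ∣A∣ (ℕₚ.+-mono-≤ ∣B∣ s≤σ))
          halves : 2 * (64 * (N * suc n) * σ * (σ * σ) + 32 * N * e) ≤ 2 * (q * (σ * σ))
          halves = begin
            2 * (64 * (N * suc n) * σ * (σ * σ) + 32 * N * e)
              ≡⟨ solve 4 (λ m σ n e → con 2 :* (con 64 :* m :* σ :* (σ :* σ) :+ con 32 :* n :* e) := con 128 :* m :* σ :* (σ :* σ) :+ con 64 :* n :* e) refl (N * suc n) σ N e ⟩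
            128 * (N * suc n) * σ * (σ * σ) + 64 * N * e
              ≤⟨ ℕₚ.+-mono-≤ (ℕₚ.*-monoˡ-≤ (σ * σ) (ℕₚ.≤-trans (ℕₚ.*-monoˡ-≤ σ big₁) Gσ≤q)) (disc₁ e (discrepancy-small A B U L large)) ⟩
            q * (σ * σ) + q * (σ * σ)
              ≡⟨ cong (q * (σ * σ) +_) (ℕₚ.+-identityʳ _) ⟨
            2 * (q * (σ * σ)) ∎

        β : ℕ
        β = (σ * σ / (16 * N)) {{16N≢0}} + 4 * (σ * s)

        pair-bound : ∀ A B → ∣ A ∣ᵣ ≤ σ → ∣ B ∣ᵣ ≤ σ → ∑ Vs (λ a → ⟦ A a ⟧ * ∑ Vs (λ b → ⟦ B b ⟧ * badPair U a b)) ≤ β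
        pair-bound A B ∣A∣ ∣B∣ = ℕₚ.≤-trans (badPair-sum A B U) (ℕₚ.+-mono-≤
          (≤-/ (16 * N) _ (σ * σ) {{16N≢0}} (edges-small A B ∣A∣ ∣B∣))
          (ℕₚ.≤-trans (ℕₚ.+-mono-≤ (ℕₚ.*-monoˡ-≤ (s + s) ∣B∣) (ℕₚ.*-monoˡ-≤ (s + s) ∣B∣))
            (ℕₚ.≤-reflexive (solve 2 (λ σ s → σ :* (s :+ s) :+ σ :* (s :+ s) := con 4 :* (σ :* s)) refl σ s))))

        bad-bound : ∀ Ss → length Ss ≡ 2 + r → All (λ S → ∣ S ∣ᵣ ≤ σ) Ss → 4 * (N * ∑∏ Ss (bad r U)) ≤ σ ^ (2 + r)
        bad-bound Ss len les = begin
          4 * (N * ∑∏ Ss (bad r U))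
            ≤⟨ ℕₚ.*-monoʳ-≤ 4 (ℕₚ.*-monoʳ-≤ N (bad-sum pair-bound r Ss len les)) ⟩
          4 * (N * (σ ^ r * (β + c * (s * σ))))
            ≡⟨ solve 3 (λ n t x → con 4 :* (n :* (t :* x)) := t :* (con 4 :* n :* x)) refl N (σ ^ r) (β + c * (s * σ)) ⟩
          σ ^ r * (4 * N * (β + c * (s * σ)))
            ≤⟨ ℕₚ.*-monoʳ-≤ (σ ^ r) (ℕₚ.*-cancelˡ-≤ 4 quarter) ⟩
          σ ^ r * (σ * σ)
            ≡⟨ solve 2 (λ t σ → t :* (σ :* σ) := σ :* (σ :* t)) refl (σ ^ r) σ ⟩
          σ ^ (2 + r) ∎
          where
          c D : ℕ
          c = bad-constant r
          D = (σ * σ / (16 * N)) {{16N≢0}}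
          quarter : 4 * (4 * N * (β + c * (s * σ))) ≤ 4 * (σ * σ)
          quarter = begin
            4 * (4 * N * (D + 4 * (σ * s) + c * (s * σ)))
              ≡⟨ solve 5 (λ n d σ s c → con 4 :* (con 4 :* n :* (d :+ con 4 :* (σ :* s) :+ c :* (s :* σ))) :=
                   d :* (con 16 :* n) :+ con 2 :* (con 8 :* (n :* (con 4 :+ c)) :* s :* σ)) refl N D σ s c ⟩
            D * (16 * N) + 2 * (8 * (N * (4 + c)) * s * σ)
              ≤⟨ ℕₚ.+-mono-≤ (DivMod.m/n*n≤m (σ * σ) (16 * N) {{16N≢0}}) (ℕₚ.*-monoʳ-≤ 2 (ℕₚ.*-monoˡ-≤ σ (scaled big₂))) ⟩
            σ * σ + 2 * (σ * σ)
              ≤⟨ ℕₚ.m≤n+m _ (σ * σ) ⟩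
            σ * σ + (σ * σ + 2 * (σ * σ))
              ≡⟨ solve 1 (λ x → x :+ (x :+ con 2 :* x) := con 4 :* x) refl (σ * σ) ⟩
            4 * (σ * σ) ∎

      module _ (U : Region) (∣U∣ : σ ≤ count finiteV U) where

        -- Let `B` be the unhit part of `S`. No edge between `S₁` and `B` has its apex in `U`, so
        -- the whole expected count u₁ E is discrepancy. Since u₁ ≥ σ / 2 and E ≥ σ ∣B∣ / 2, this
        -- gives σ² ∣B∣ ≤ 4 e, and `disc₂` bounds `e`.
        unhit-small : ∀ S₁ S → σ + 4 * s ≤ 2 * ∣ S₁ ∣ᵣ → Disjoint S₁ S → 8 * ∑ Vs (λ b → ⟦ S b ⟧ * ⟦ unhit S₁ U b ⟧) ≤ σ
        unhit-small S₁ S ∣S₁∣ disj = ℕₚ.*-cancelˡ-≤ (σ * σ) {{ℕₚ.m*n≢0 σ σ {{ℕ.>-nonZero 1≤σ}} {{ℕ.>-nonZero 1≤σ}}}} (begin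
          σ * σ * (8 * ∑ Vs (λ b → ⟦ S b ⟧ * ⟦ unhit S₁ U b ⟧))
            ≡⟨ cong (λ z → σ * σ * (8 * z)) (∑-cong Vs (λ b → sym (⟦∧⟧ (S b) (unhit S₁ U b)))) ⟩
          σ * σ * (8 * ∣B∣)
            ≡⟨ solve 2 (λ σ b → σ :* σ :* (con 8 :* b) := con 8 :* (σ :* (σ :* b))) refl σ ∣B∣ ⟩
          8 * (σ * (σ * ∣B∣))
            ≤⟨ ℕₚ.*-monoʳ-≤ 8 key ⟩
          8 * (4 * e)
            ≡⟨ ℕₚ.*-assoc 8 4 e ⟨
          32 * e
            ≤⟨ disc₂ e (discrepancy-small S₁ B U L large) ⟩
          σ * (σ * σ)
            ≡⟨ ℕₚ.*-assoc σ σ σ ⟨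
          σ * σ * σ ∎)
          where
          B : Region
          B b = S b ∧ unhit S₁ U b
          ∣B∣ e u₁ E : ℕ
          ∣B∣ = ∣ B ∣ᵣ
          e = discrepancy S₁ B U
          u₁ = ∣sloped∣ U
          E = edges nonzero S₁ B
          none : ∀ a b → S₁ a ≡ true → B b ≡ true → hit U a b ≡ false
          none a b S₁a Bb = ⟦⟧≡0 (ℕₚ.n≤0⇒n≡0 (ℕₚ.≤-trans (ℕₚ.≤-reflexive (cong (λ z → ⟦ z ∧ hit U a b ⟧) (sym S₁a)))
            (ℕₚ.≤-trans (Finite.∑-term finiteV a (λ a → ⟦ S₁ a ∧ hit U a b ⟧))
              (ℕₚ.≤-reflexive (does-true (count finiteV (λ a → S₁ a ∧ hit U a b) ℕₚ.≟ 0) (proj₂ (∧-true {S b} Bb)))))))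
          edges≡0 : edges (sloped U) S₁ B ≡ 0
          edges≡0 = no-hit⇒no-edges S₁ B U (λ a S₁a Ba → disj a S₁a (proj₁ (∧-true {S a} Ba))) none
          uE≤e : u₁ * E ≤ e
          uE≤e = ℕₚ.≤-trans (proj₂ (∣m-n∣-bounds (lines * edges (sloped U) S₁ B) (u₁ * E)))
            (ℕₚ.≤-reflexive (cong (_+ e) (trans (cong (lines *_) edges≡0) (ℕₚ.*-zeroʳ lines))))
          σ≤2u : σ ≤ 2 * u₁
          σ≤2u = ℕₚ.+-cancelʳ-≤ (2 * s) σ (2 * u₁) (begin
            σ + 2 * s        ≤⟨ ℕₚ.+-monoʳ-≤ σ (scaled (ℕₚ.≤-trans (s≤s (s≤s z≤n)) 4≤G)) ⟩
            σ + σ            ≤⟨ ℕₚ.+-mono-≤ σ≤u+s σ≤u+s ⟩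
            u₁ + s + (u₁ + s) ≡⟨ solve 2 (λ u s → u :+ s :+ (u :+ s) := con 2 :* u :+ con 2 :* s) refl u₁ s ⟩
            2 * u₁ + 2 * s   ∎)
            where
            σ≤u+s : σ ≤ u₁ + s
            σ≤u+s = begin
              σ ≤⟨ ∣U∣ ⟩
              count finiteV U ≡⟨ count-split finiteV U nonzero ⟩
              count finiteV (λ c → U c ∧ nonzero c) + count finiteV (λ c → U c ∧ not (nonzero c))
                ≤⟨ ℕₚ.+-mono-≤ (∑-mono Vs (λ c → ⟦⟧-mono {U c ∧ nonzero c} {nonzero c ∧ U c} (λ eq → let (x , y) = ∧-true {U c} eq in ∧-intro y x)))
                     (ℕₚ.≤-trans (∑-mono Vs (λ c → ⟦⟧-mono {U c ∧ not (nonzero c)} (proj₂ ∘ ∧-true {U c}))) vertical-count) ⟩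
              u₁ + s ∎
          key : σ * (σ * ∣B∣) ≤ 4 * e
          key = begin
            σ * (σ * ∣B∣) ≤⟨ ℕₚ.*-monoˡ-≤ (σ * ∣B∣) σ≤2u ⟩
            2 * u₁ * (σ * ∣B∣) ≤⟨ ℕₚ.*-monoʳ-≤ (2 * u₁) σB≤2E ⟩
            2 * u₁ * (2 * E) ≡⟨ solve 2 (λ u e → con 2 :* u :* (con 2 :* e) := con 4 :* (u :* e)) refl u₁ E ⟩
            4 * (u₁ * E) ≤⟨ ℕₚ.*-monoʳ-≤ 4 uE≤e ⟩
            4 * e ∎
            where
            σB≤2E : σ * ∣B∣ ≤ 2 * E
            σB≤2E = ℕₚ.+-cancelʳ-≤ (4 * s * ∣B∣) _ _ (begin
              σ * ∣B∣ + 4 * s * ∣B∣     ≡⟨ ℕₚ.*-distribʳ-+ ∣B∣ σ (4 * s) ⟨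
              (σ + 4 * s) * ∣B∣         ≤⟨ ℕₚ.*-monoˡ-≤ ∣B∣ ∣S₁∣ ⟩
              2 * ∣ S₁ ∣ᵣ * ∣B∣         ≡⟨ ℕₚ.*-assoc 2 ∣ S₁ ∣ᵣ ∣B∣ ⟩
              2 * (∣ S₁ ∣ᵣ * ∣B∣)       ≤⟨ ℕₚ.*-monoʳ-≤ 2 (edges-lower S₁ B) ⟩
              2 * (E + ∣B∣ * (s + s))   ≡⟨ solve 3 (λ e b s → con 2 :* (e :+ b :* (s :+ s)) := con 2 :* e :+ con 4 :* s :* b) refl E ∣B∣ s ⟩
              2 * E + 4 * s * ∣B∣       ∎)

        blocked-bound : ∀ S₁ Ss → length Ss ≡ 1 + r → All (λ S → ∣ S ∣ᵣ ≤ σ) Ss → ∣ S₁ ∣ᵣ ≡ σ → All (Disjoint S₁) Ss →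
                        4 * ∑∏ Ss (blocked r S₁ U) ≤ σ ^ (1 + r)
        blocked-bound S₁ Ss len les ∣S₁∣ disj = begin
          4 * ∑∏ Ss (blocked r S₁ U)
            -- `τ` is what remains of the `σ` points of `S₁` after r divisions; by `big₃` it is
            -- still more than half of them, with room for the 4 s in `unhit-small`.
            ≤⟨ ℕₚ.*-monoʳ-≤ 4 (blocked-sum {τ = σ ∸ r * s} (λ S₁ S τ≤ dj → ≤-/ 8 _ σ (unhit-small S₁ S (enough τ≤) dj)) r S₁ Ss len les
                 (ℕₚ.≤-reflexive (trans (ℕₚ.m∸n+n≡m rs≤σ) (sym ∣S₁∣))) disj) ⟩
          4 * (σ ^ r * (σ / 8 + c * s))
            ≡⟨ solve 2 (λ t x → con 4 :* (t :* x) := t :* (con 4 :* x)) refl (σ ^ r) (σ / 8 + c * s) ⟩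
          σ ^ r * (4 * (σ / 8 + c * s))
            ≤⟨ ℕₚ.*-monoʳ-≤ (σ ^ r) (ℕₚ.*-cancelˡ-≤ 2 half) ⟩
          σ ^ r * σ
            ≡⟨ ℕₚ.*-comm (σ ^ r) σ ⟩
          σ ^ (1 + r) ∎
          where
          c : ℕ
          c = blocked-constant r
          2rs+4s≤σ : (2 * r + 4) * s ≤ σ
          2rs+4s≤σ = scaled big₃
          rs≤σ : r * s ≤ σ
          rs≤σ = ℕₚ.≤-trans (ℕₚ.*-monoˡ-≤ s (ℕₚ.≤-trans (ℕₚ.m≤n*m r 2) (ℕₚ.m≤m+n (2 * r) 4))) 2rs+4s≤σ
          enough : ∀ {x} → σ ∸ r * s ≤ x → σ + 4 * s ≤ 2 * x
          enough {x} le = ℕₚ.+-cancelʳ-≤ (2 * (r * s)) _ _ (begin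
            σ + 4 * s + 2 * (r * s)       ≡⟨ solve 3 (λ σ r s → σ :+ con 4 :* s :+ con 2 :* (r :* s) := σ :+ (con 2 :* r :+ con 4) :* s) refl σ r s ⟩
            σ + (2 * r + 4) * s           ≤⟨ ℕₚ.+-monoʳ-≤ σ 2rs+4s≤σ ⟩
            σ + σ                         ≡⟨ cong₂ _+_ (ℕₚ.m∸n+n≡m rs≤σ) (ℕₚ.m∸n+n≡m rs≤σ) ⟨
            (σ ∸ r * s) + r * s + ((σ ∸ r * s) + r * s) ≤⟨ ℕₚ.+-mono-≤ (ℕₚ.+-monoˡ-≤ (r * s) le) (ℕₚ.+-monoˡ-≤ (r * s) le) ⟩
            x + r * s + (x + r * s)       ≡⟨ solve 2 (λ x y → x :+ y :+ (x :+ y) := con 2 :* x :+ con 2 :* y) refl x (r * s) ⟩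
            2 * x + 2 * (r * s)           ∎)
          half : 2 * (4 * (σ / 8 + c * s)) ≤ 2 * σ
          half = begin
            2 * (4 * (σ / 8 + c * s))     ≡⟨ solve 3 (λ d c s → con 2 :* (con 4 :* (d :+ c :* s)) := d :* con 8 :+ con 8 :* c :* s) refl (σ / 8) c s ⟩
            σ / 8 * 8 + 8 * c * s         ≤⟨ ℕₚ.+-mono-≤ (DivMod.m/n*n≤m σ 8) (scaled big₄) ⟩
            σ + σ                         ≡⟨ cong (σ +_) (ℕₚ.+-identityʳ σ) ⟨
            2 * σ                         ∎

      selection : ∀ {n′} → n′ ≤ n → (Ss : Vec Region n′) (S₁ U U₁ : Region) (I : Subset n′) → Uniform σ Ss → ∣ S₁ ∣ᵣ ≡ σ →
        (∀ i → Disjoint S₁ (lookup Ss i)) → count finiteV U ≤ suc n * σ → σ ≤ count finiteV U₁ → ∣ I ∣ ≡ 1 + r →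
        Selected r Ss S₁ U U₁ I
      selection {n′} n′≤n Ss S₁ U U₁ I unif ∣S₁∣ disj ∣U∣ ∣U₁∣ ∣I∣ = select Ss S₁ U U₁ I unif ∣I∣
        (λ J ∣J∣ → ℕₚ.≤-trans (ℕₚ.*-monoʳ-≤ 4 (ℕₚ.*-monoˡ-≤ _ N′≤N))
          (bad-bound U ∣U∣ (restrict J Ss) (trans (length-restrict J Ss) ∣J∣) (restrict-All J Ss (λ i → ℕₚ.≤-reflexive (unif i)))))
        (blocked-bound U₁ ∣U₁∣ S₁ (restrict I Ss) (trans (length-restrict I Ss) ∣I∣) (restrict-All I Ss (λ i → ℕₚ.≤-reflexive (unif i))) ∣S₁∣ (restrict-All I Ss disj))
        (begin
          4 * (n′ ^ (2 + r) * n′ ^ (2 + r)) ≤⟨ ℕₚ.*-monoʳ-≤ 4 (ℕₚ.*-mono-≤ N′≤N N′≤N) ⟩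
          4 * (N * N)                       ≤⟨ ℕₚ.≤-reflexive (solve 1 (λ n → con 4 :* (n :* n) := (con 2 :* n) :* (con 2 :* n)) refl N) ⟩
          2 * N * (2 * N)                   ≤⟨ ℕₚ.*-mono-≤ 2N≤G 2N≤G ⟩
          G * G                             ≤⟨ ℕₚ.≤-trans (ℕₚ.m≤n*m (G * G) 2) 2GG≤s ⟩
          s                                 ≤⟨ s≤σ ⟩
          σ                                 ∎)
        1≤σ
        where
        N′≤N : n′ ^ (2 + r) ≤ N
        N′≤N = ℕₚ.^-monoˡ-≤ (2 + r) n′≤n
        2N≤G : 2 * N ≤ G
        2N≤G = ℕₚ.≤-trans (ℕₚ.*-mono-≤ {2} {128} (s≤s (s≤s z≤n)) (ℕₚ.m≤m*n N (suc n))) big₁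

-- The hypergraph and its Steiner property.

module SteinerSystems where

  open import Data.Bool using (true; false)
  open import Data.Empty using (⊥-elim)
  import Data.Fin as Fin
  open import Data.Fin using (Fin; zero; suc)
  import Data.Fin.Properties as Finₚ
  open import Data.Fin.Subset using (Subset; ⁅_⁆; _∪_; ⊥; ∣_∣; _⊆_) renaming (_∈_ to _∈ₛ_; _∉_ to _∉ₛ_)
  import Data.Fin.Subset.Properties as Subsetₚ
  open import Data.List using (List; []; _∷_; map; length; foldr)
  open import Data.List.Membership.Propositional using (_∈_)
  open import Data.List.Membership.Propositional.Properties using (∈-map⁺; ∈-map⁻)
  open import Data.List.Properties using (length-map)
  open import Data.List.Relation.Unary.All as All using (All; []; _∷_)
  import Data.List.Relation.Unary.All.Properties as Allₚ
  open import Data.List.Relation.Unary.AllPairs as AllPairs using (AllPairs; []; _∷_)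
  import Data.List.Relation.Unary.AllPairs.Properties as AllPairsₚ
  open import Data.List.Relation.Unary.Any using (here; there)
  open import Data.Nat using (ℕ; zero; suc; _+_)
  import Data.Nat.Properties as ℕₚ
  open import Data.Product using (Σ; _×_; _,_; proj₁; proj₂)
  open import Data.Sum using (_⊎_; inj₁; inj₂)
  open import Data.Vec using (Vec; []; _∷_; lookup; tabulate) renaming (here to hereᵥ; there to thereᵥ)
  open import Defs
  open import Function using (_∘_)
  open import Relation.Binary.PropositionalEquality
  open import Relation.Nullary using (Dec; yes; no; ¬_)
  open FiniteSums
  open BinaryFields
  open DividedDifferences
  open FourCycles
  open IncidenceGeometry
  open DiscrepancyBound
  open EdgeCounts
  open TupleCounts
  open SelectionByCounting
  open QuantitativeBounds

  fromList : ∀ {N} → List (Fin N) → Subset N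
  fromList = foldr (λ x p → ⁅ x ⁆ ∪ p) ⊥

  ∈-fromList⁺ : ∀ {N} {x : Fin N} {xs} → x ∈ xs → x ∈ₛ fromList xs
  ∈-fromList⁺ {x = x} {xs = y ∷ xs} (here refl) = Subsetₚ.x∈p∪q⁺ (inj₁ (Subsetₚ.x∈⁅x⁆ x))
  ∈-fromList⁺ {xs = y ∷ xs} (there x∈) = Subsetₚ.x∈p∪q⁺ {p = ⁅ y ⁆} (inj₂ (∈-fromList⁺ x∈))

  ∈-fromList⁻ : ∀ {N} {x : Fin N} xs → x ∈ₛ fromList xs → x ∈ xs
  ∈-fromList⁻ []       x∈ = ⊥-elim (Subsetₚ.∉⊥ x∈)
  ∈-fromList⁻ (y ∷ xs) x∈ with Subsetₚ.x∈p∪q⁻ ⁅ y ⁆ (fromList xs) x∈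
  ... | inj₁ x∈y  = here (Subsetₚ.x∈⁅y⁆⇒x≡y y x∈y)
  ... | inj₂ x∈xs = there (∈-fromList⁻ xs x∈xs)

  ∣⁅x⁆∪p∣ : ∀ {N} (x : Fin N) (p : Subset N) → x ∉ₛ p → ∣ ⁅ x ⁆ ∪ p ∣ ≡ suc ∣ p ∣
  ∣⁅x⁆∪p∣ zero    (true  ∷ p) x∉ = ⊥-elim (x∉ hereᵥ)
  ∣⁅x⁆∪p∣ zero    (false ∷ p) x∉ = cong (λ z → suc ∣ z ∣) (Subsetₚ.∪-identityˡ p)
  ∣⁅x⁆∪p∣ (suc x) (true  ∷ p) x∉ = cong suc (∣⁅x⁆∪p∣ x p (x∉ ∘ thereᵥ))
  ∣⁅x⁆∪p∣ (suc x) (false ∷ p) x∉ = ∣⁅x⁆∪p∣ x p (x∉ ∘ thereᵥ)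

  ∣fromList∣ : ∀ {N} {xs : List (Fin N)} → AllPairs _≢_ xs → ∣ fromList xs ∣ ≡ length xs
  ∣fromList∣ {N} {[]}     []         = Subsetₚ.∣⊥∣≡0 N
  ∣fromList∣ {N} {x ∷ xs} (x≢ ∷ dist) = trans
    (∣⁅x⁆∪p∣ x (fromList xs) (λ x∈ → All.lookup x≢ (∈-fromList⁻ xs x∈) refl)) (cong suc (∣fromList∣ dist))

  fromList-cong : ∀ {N} {xs ys : List (Fin N)} → (∀ {x} → x ∈ xs → x ∈ ys) → (∀ {x} → x ∈ ys → x ∈ xs) → fromList xs ≡ fromList ys
  fromList-cong {xs = xs} {ys} xs⊑ys ys⊑xs = Subsetₚ.⊆-antisym
    (λ x∈ → ∈-fromList⁺ (xs⊑ys (∈-fromList⁻ xs x∈))) (λ x∈ → ∈-fromList⁺ (ys⊑xs (∈-fromList⁻ ys x∈)))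

  img≡fromList : ∀ {A : Set} {N n} (f : A → Fin N) (v : Vec A n) (J : Subset n) →
                 img (λ j → f (lookup v j)) J ≡ fromList (map f (restrict J v))
  img≡fromList f []      []          = refl
  img≡fromList f (x ∷ v) (true  ∷ J) = cong (⁅ f x ⁆ ∪_) (img≡fromList f v J)
  img≡fromList f (x ∷ v) (false ∷ J) = trans (Subsetₚ.∪-identityˡ _) (img≡fromList f v J)

  at-most-one-missing : ∀ {N k} {e S : Subset N} → ∣ e ∣ ≡ suc k → ∣ S ∣ ≡ k → S ⊆ e →
                        ∀ {x y} → x ∈ₛ e → y ∈ₛ e → x ∉ₛ S → y ∉ₛ S → x ≡ y
  at-most-one-missing {k = k} {e} {S} ∣e∣ ∣S∣ S⊆e {x} {y} x∈e y∈e x∉S y∉S with x Finₚ.≟ y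
  ... | yes x≡y = x≡y
  ... | no x≢y  = ⊥-elim (ℕₚ.<-irrefl refl (begin
    suc (suc k)                  ≡⟨ cong (λ j → suc (suc j)) ∣S∣ ⟨
    suc (suc ∣ S ∣)              ≡⟨ cong suc (∣⁅x⁆∪p∣ y S y∉S) ⟨
    suc ∣ ⁅ y ⁆ ∪ S ∣            ≡⟨ ∣⁅x⁆∪p∣ x (⁅ y ⁆ ∪ S) x∉ ⟨
    ∣ ⁅ x ⁆ ∪ (⁅ y ⁆ ∪ S) ∣      ≤⟨ Subsetₚ.p⊆q⇒∣p∣≤∣q∣ sub ⟩
    ∣ e ∣                        ≡⟨ ∣e∣ ⟩
    suc k                        ∎))
    where
    open ℕₚ.≤-Reasoning
    x∉ : x ∉ₛ ⁅ y ⁆ ∪ S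
    x∉ x∈ with Subsetₚ.x∈p∪q⁻ ⁅ y ⁆ S x∈
    ... | inj₁ x∈y = x≢y (Subsetₚ.x∈⁅y⁆⇒x≡y y x∈y)
    ... | inj₂ x∈S = x∉S x∈S
    sub : ⁅ x ⁆ ∪ (⁅ y ⁆ ∪ S) ⊆ e
    sub z∈ with Subsetₚ.x∈p∪q⁻ ⁅ x ⁆ (⁅ y ⁆ ∪ S) z∈
    ... | inj₁ z∈x = subst (_∈ₛ e) (sym (Subsetₚ.x∈⁅y⁆⇒x≡y x z∈x)) x∈e
    ... | inj₂ z∈′ with Subsetₚ.x∈p∪q⁻ ⁅ y ⁆ S z∈′
    ...   | inj₁ z∈y = subst (_∈ₛ e) (sym (Subsetₚ.x∈⁅y⁆⇒x≡y y z∈y)) y∈e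
    ...   | inj₂ z∈S = S⊆e z∈S

  next : Fin 3 → Fin 3
  next zero             = suc zero
  next (suc zero)       = suc (suc zero)
  next (suc (suc zero)) = zero

  next-injective : ∀ {i j} → next i ≡ next j → i ≡ j
  next-injective {zero}           {zero}           _  = refl
  next-injective {zero}           {suc zero}       ()
  next-injective {zero}           {suc (suc zero)} ()
  next-injective {suc zero}       {zero}           ()
  next-injective {suc zero}       {suc zero}       _  = refl
  next-injective {suc zero}       {suc (suc zero)} ()
  next-injective {suc (suc zero)} {zero}           ()
  next-injective {suc (suc zero)} {suc zero}       ()
  next-injective {suc (suc zero)} {suc (suc zero)} _  = refl

  i≢next : ∀ i → i ≢ next i
  i≢next zero             ()
  i≢next (suc zero)       ()
  i≢next (suc (suc zero)) ()

  -- This is where three copies are needed: it excludes two edges each having its apex among the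
  -- lower points of the other.
  i≢next² : ∀ i → i ≢ next (next i)
  i≢next² zero             ()
  i≢next² (suc zero)       ()
  i≢next² (suc (suc zero)) ()

  -- The vertices are reached through an arbitrary injection `ι`, so that the number of vertices can
  -- be padded to any larger `N`; vertices outside its image lie in no edge.
  module Hypergraph (F : BinaryField) (r N : ℕ) (ι : Fin 3 → Interpolation.V F → Fin N)
                    (ι-injective : ∀ {i j a b} → ι i a ≡ ι j b → i ≡ j × a ≡ b) where
    open Interpolation F

    edge : Fin 3 → List V → V → List (Fin N)
    edge i u c = ι (next i) c ∷ map (ι i) u

    edge-distinct : ∀ i {u c} → DistinctY u → AllPairs _≢_ (edge i u c)
    edge-distinct i {u} dist =
      Allₚ.map⁺ (All.tabulate (λ _ eq → i≢next i (sym (proj₁ (ι-injective eq))))) ∷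
      AllPairsₚ.map⁺ (AllPairs.map (λ y≢ eq → y≢ (cong proj₂ (proj₂ (ι-injective eq)))) dist)

    H : KGraph (3 + r) N
    H = record
      { Edge    = λ e → Σ (Fin 3) λ i → Σ (List V) λ u → Σ V λ c → Link (suc r) u c × e ≡ fromList (edge i u c)
      ; uniform = λ { e (i , u , c , L , refl) → trans (∣fromList∣ (edge-distinct i {u} {c} (Link.distinct L)))
          (cong suc (trans (length-map (ι i) u) (Link.len L))) }
      }

    ∈-edge⁻ : ∀ i u c j a → ι j a ∈ edge i u c → (j ≡ next i × a ≡ c) ⊎ (j ≡ i × a ∈ u)
    ∈-edge⁻ i u c j a (here eq)  = inj₁ (ι-injective eq)
    ∈-edge⁻ i u c j a (there a∈) with ∈-map⁻ (ι i) a∈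
    ... | b , b∈u , eq with ι-injective eq
    ...   | refl , refl = inj₂ (refl , b∈u)

    ∈-same-part : ∀ i u c a → ι i a ∈ edge i u c → a ∈ u
    ∈-same-part i u c a a∈ with ∈-edge⁻ i u c i a a∈
    ... | inj₁ (i≡next , _) = ⊥-elim (i≢next i i≡next)
    ... | inj₂ (_ , a∈u)    = a∈u

    edge-cong : ∀ i {u u′} c → u ⊑ u′ → u′ ⊑ u → fromList (edge i u c) ≡ fromList (edge i u′ c)
    edge-cong i {u} {u′} c le ge = fromList-cong (mono le) (mono ge)
      where
      mono : ∀ {u u′} → u ⊑ u′ → ∀ {x} → x ∈ edge i u c → x ∈ edge i u′ c
      mono le (here eq) = here eq
      mono le (there x∈) with ∈-map⁻ (ι i) x∈
      ... | a , a∈u , refl = there (∈-map⁺ (ι i) (le a∈u))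

    -- Drops the one element that fails `P`, or the last element if none fails, so that the length
    -- of the result is the same in both cases.
    almost-all : (P : V → Set) (P? : ∀ a → Dec (P a)) → ∀ a u → DistinctY (a ∷ u) →
      (∀ {x y} → x ∈ a ∷ u → y ∈ a ∷ u → ¬ P x → ¬ P y → x ≡ y) →
      Σ (List V) λ R → length R ≡ length u × DistinctY R × R ⊑ a ∷ u × (∀ {x} → x ∈ R → P x)
    almost-all P P? a u (a≢ ∷ dist) missing with P? a
    ... | no ¬Pa = u , refl , dist , there , λ {x} x∈u → decide x x∈u (P? x)
      where
      decide : ∀ x → x ∈ u → Dec (P x) → P x
      decide x x∈u (yes Px) = Px
      decide x x∈u (no ¬Px) with missing (here refl) (there x∈u) ¬Pa ¬Px
      ... | refl = ⊥-elim (All.lookup a≢ x∈u refl)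
    almost-all P P? a [] (a≢ ∷ dist) missing | yes Pa = [] , refl , [] , (λ ()) , λ ()
    almost-all P P? a (b ∷ u) (a≢ ∷ dist) missing | yes Pa =
      let (R , len , distR , R⊑ , all) = almost-all P P? b u dist (λ x∈ y∈ → missing (there x∈) (there y∈)) in
      a ∷ R , cong suc len , All.tabulate (λ x∈R → All.lookup a≢ (R⊑ x∈R)) ∷ distR ,
      (λ { (here eq) → here eq ; (there x∈) → there (R⊑ x∈) }) , λ { (here refl) → Pa ; (there x∈) → all x∈ }

    private
      -- `S` is then the whole set of lower points. These are at least two, so not all of them can
      -- be the apex of the second edge, and both edges start in the same copy. Now the lower points
      -- determine the apex, and the apex with the common points determines the rest.
      apex-missing : ∀ {i u c i′ u′ c′ S} → Link (suc r) u c → Link (suc r) u′ c′ → ∣ S ∣ ≡ 2 + r →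
        S ⊆ fromList (edge i u c) → S ⊆ fromList (edge i′ u′ c′) → ι (next i) c ∉ₛ S →
        fromList (edge i u c) ≡ fromList (edge i′ u′ c′)
      apex-missing {i} {u@(a₁ ∷ a₂ ∷ u₀)} {c} {i′} {u′} {c′} {S} L L′ ∣S∣ S⊆e S⊆e′ c∉S = same-part i≡i′
        where
        in-e′ : ∀ {a} → a ∈ u → ι i a ∈ edge i′ u′ c′
        in-e′ {a} a∈u with ι i a Subsetₚ.∈? S
        ... | yes a∈S = ∈-fromList⁻ _ (S⊆e′ a∈S)
        ... | no a∉S = ⊥-elim (i≢next i (proj₁ (ι-injective (at-most-one-missing
                (KGraph.uniform H _ (i , u , c , L , refl)) ∣S∣ S⊆e (∈-fromList⁺ (there (∈-map⁺ (ι i) a∈u))) (∈-fromList⁺ {xs = edge i u c} (here refl)) a∉S c∉S))))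
        i≡i′ : i ≡ i′
        i≡i′ with ∈-edge⁻ i′ u′ c′ i a₁ (in-e′ (here refl)) | ∈-edge⁻ i′ u′ c′ i a₂ (in-e′ (there (here refl)))
        ... | inj₂ (eq , _) | _             = eq
        ... | inj₁ _        | inj₂ (eq , _) = eq
        ... | inj₁ (_ , e₁) | inj₁ (_ , e₂) with Link.distinct L
        ...   | (y≢ ∷ _) ∷ _ = ⊥-elim (y≢ (cong proj₂ (trans e₁ (sym e₂))))
        same-part : i ≡ i′ → fromList (edge i u c) ≡ fromList (edge i′ u′ c′)
        same-part refl with link-functional L L′ u⊑u′
          where
          u⊑u′ : u ⊑ u′
          u⊑u′ {a} a∈u = ∈-same-part i u′ c′ a (in-e′ a∈u)
        ... | refl with Link.distinct L
        ...   | _ ∷ dist = edge-cong i c (λ {a} a∈u → ∈-same-part i u′ c′ a (in-e′ a∈u))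
          (link-determined (a₂ ∷ u₀) L L′ (ℕₚ.suc-injective (Link.len L)) dist there (λ {a} a∈ → ∈-same-part i u′ c′ a (in-e′ (there a∈))))
      apex-missing {u = []} L with Link.len L
      ... | ()
      apex-missing {u = _ ∷ []} L with Link.len L
      ... | ()

      -- At most one lower point is outside `S`, so the two edges share suc r lower points and the
      -- apex; `link-determined` applies in both directions.
      apex-shared : ∀ {i u u′ c S} → Link (suc r) u c → Link (suc r) u′ c → ∣ S ∣ ≡ 2 + r →
        S ⊆ fromList (edge i u c) → S ⊆ fromList (edge i u′ c) → fromList (edge i u c) ≡ fromList (edge i u′ c)
      apex-shared {u = []} L with Link.len L
      ... | ()
      apex-shared {i} {u@(a₁ ∷ u₀)} {u′} {c} {S} L L′ ∣S∣ S⊆e S⊆e′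
        with almost-all (λ a → ι i a ∈ₛ S) (λ a → ι i a Subsetₚ.∈? S) a₁ u₀ (Link.distinct L)
               (λ x∈ y∈ x∉ y∉ → proj₂ (ι-injective (at-most-one-missing (KGraph.uniform H _ (i , u , c , L , refl)) ∣S∣ S⊆e
                 (∈-fromList⁺ (there (∈-map⁺ (ι i) x∈))) (∈-fromList⁺ (there (∈-map⁺ (ι i) y∈))) x∉ y∉)))
      ... | R , len , distR , R⊑u , inS = edge-cong i c
        (link-determined R L′ L lenR distR R⊑u′ R⊑u) (link-determined R L L′ lenR distR R⊑u R⊑u′)
        where
        lenR : length R ≡ suc r
        lenR = trans len (ℕₚ.suc-injective (Link.len L))
        R⊑u′ : R ⊑ u′
        R⊑u′ {a} a∈R = ∈-same-part i u′ c a (∈-fromList⁻ _ (S⊆e′ (inS a∈R)))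

    -- If both apexes belong to `S`, then either they coincide or each is a lower point of the other
    -- edge. The latter contradicts the cyclic arrangement of three copies.
    steiner : PartialSteiner (2 + r) H
    steiner e e′ S (i , u , c , L , refl) (i′ , u′ , c′ , L′ , refl) ∣S∣ S⊆e S⊆e′
      with ι (next i) c Subsetₚ.∈? S | ι (next i′) c′ Subsetₚ.∈? S
    ... | no c∉S  | _        = apex-missing L L′ ∣S∣ S⊆e S⊆e′ c∉S
    ... | yes _   | no c′∉S  = sym (apex-missing L′ L ∣S∣ S⊆e′ S⊆e c′∉S)
    ... | yes c∈S | yes c′∈S with ∈-edge⁻ i′ u′ c′ (next i) c (∈-fromList⁻ _ (S⊆e′ c∈S))
    ...   | inj₁ (eq , refl) with next-injective eq
    ...     | refl = apex-shared L L′ ∣S∣ S⊆e S⊆e′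
    steiner e e′ S (i , u , c , L , refl) (i′ , u′ , c′ , L′ , refl) ∣S∣ S⊆e S⊆e′ | yes c∈S | yes c′∈S | inj₂ (refl , _)
      with ∈-edge⁻ i u c (next i′) c′ (∈-fromList⁻ _ (S⊆e c′∈S))
    ... | inj₁ (eq , _) = ⊥-elim (i≢next i (sym (next-injective eq)))
    ... | inj₂ (eq , _) = ⊥-elim (i≢next² i (sym eq))

-- Finding the ordered configuration in an arbitrary linear order.

module OrderedCopies where

  open import Data.Bool using (true; false; not; _∨_)
  open import Data.Empty using (⊥-elim)
  import Data.Fin as Fin
  open import Data.Fin using (Fin; zero; suc; toℕ)
  import Data.Fin.Properties as Finₚ
  open import Data.Fin.Subset using (Subset; ⁅_⁆; _∪_; ∣_∣)
  open import Data.List using (_∷_)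
  import Data.Nat as ℕ
  open import Data.Nat using (ℕ; zero; suc; _+_; _*_; _∸_; _≤_; _<_; z≤n; s≤s; _^_)
  import Data.Nat.Properties as ℕₚ
  open import Data.Product using (Σ; ∃; _×_; _,_; proj₁; proj₂)
  open import Data.Sum using (inj₁; inj₂)
  open import Data.Vec using (Vec; _∷_; lookup; tabulate)
  open import Data.Vec.Properties using (lookup∘tabulate)
  open import Defs
  open import Function using (_∘_)
  open import Relation.Binary.Definitions using (Trichotomous; tri<; tri≈; tri>)
  open import Relation.Binary.PropositionalEquality
  open import Relation.Binary.Structures using (IsStrictTotalOrder)
  open import Relation.Nullary using (Dec; yes; no; does; ¬_)
  open FiniteSums
  open BinaryFields
  open DividedDifferences
  open FourCycles
  open IncidenceGeometry
  open DiscrepancyBound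
  open EdgeCounts
  open TupleCounts
  open SelectionByCounting
  open QuantitativeBounds
  open SteinerSystems

  module Embedding (F : BinaryField) (2≤s : 2 ≤ order F) (r n′ G L σ : ℕ)
                   (C : Quantitative.Conditions F 2≤s r (suc n′) G L σ)
                   (N : ℕ) (ι : Fin 3 → Interpolation.V F → Fin N)
                   (ι-injective : ∀ {i j a b} → ι i a ≡ ι j b → i ≡ j × a ≡ b)
                   (_≺_ : Fin N → Fin N → Set) (sto : IsStrictTotalOrder _≡_ _≺_) where
    open Interpolation F
    open Incidence F using (finiteV; Vs)
    open Discrepancy F using (q)
    open Tuples F
    open Selection F
    open Hypergraph F r N ι ι-injective
    open Quantitative F 2≤s r (suc n′) G L σ using (module Conditions; module Bounds)
    open Conditions C
    open Bounds C
    open IsStrictTotalOrder sto using (compare) renaming (trans to ≺-trans; irrefl to ≺-irrefl)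

    private
      n : ℕ
      n = suc n′

    ≺-≤-trans : ∀ {x y z} → x ≺ y → ¬ z ≺ y → x ≺ z
    ≺-≤-trans {x} {y} {z} x≺y z⊀y with compare x z
    ... | tri< x≺z _ _ = x≺z
    ... | tri≈ _ refl _ = ⊥-elim (z⊀y x≺y)
    ... | tri> _ _ z≺x = ⊥-elim (z⊀y (≺-trans z≺x x≺y))

    part-compare : ∀ i → Trichotomous _≡_ (λ a b → ι i a ≺ ι i b)
    part-compare i a b with compare (ι i a) (ι i b)
    ... | tri< lt ne gt = tri< lt (λ eq → ne (cong (ι i) eq)) gt
    ... | tri≈ lt eq gt = tri≈ lt (proj₂ (ι-injective eq)) gt
    ... | tri> lt ne gt = tri> lt (λ eq → ne (cong (ι i) eq)) gt

    module Part (i : Fin 3) = Ranking finiteV (λ a b → ι i a ≺ ι i b) ≺-trans (part-compare i)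

    nσ+σ≤q : suc n * σ ≤ q
    nσ+σ≤q = ℕₚ.≤-trans (ℕₚ.*-monoˡ-≤ σ (ℕₚ.≤-trans (ℕₚ.≤-trans
      (ℕₚ.m≤n*m (suc n) (n ^ (2 + r)) {{ℕₚ.m^n≢0 n (2 + r)}}) (ℕₚ.m≤n*m (n ^ (2 + r) * suc n) 128)) big₁)) Gσ≤q

    -- The n σ largest vertices of a part are those of rank at least j₀.
    j₀ : ℕ
    j₀ = q ∸ n * σ

    j₀+nσ≡q : j₀ + n * σ ≡ q
    j₀+nσ≡q = ℕₚ.m∸n+n≡m (ℕₚ.≤-trans (ℕₚ.m≤n+m (n * σ) σ) nσ+σ≤q)

    σ≤j₀ : σ ≤ j₀
    σ≤j₀ = ℕₚ.+-cancelʳ-≤ (n * σ) σ j₀ (ℕₚ.≤-trans nσ+σ≤q (ℕₚ.≤-reflexive (sym j₀+nσ≡q)))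

    j₀<q : j₀ < q
    j₀<q = ℕₚ.<-≤-trans (ℕₚ.m<m+n j₀ (ℕₚ.≤-trans 1≤σ (ℕₚ.m≤n*m σ n))) (ℕₚ.≤-reflexive j₀+nσ≡q)

    abstract
      threshold : Fin 3 → V
      threshold i = proj₁ (Part.of-rank i j₀ j₀<q)

      rank-threshold : ∀ i → Part.rank i (threshold i) ≡ j₀
      rank-threshold i = proj₂ (Part.of-rank i j₀ j₀<q)

    -- Only the cut of the next copy has to be compared, so a step of the cycle that does not
    -- increase serves in place of a maximum.
    no-cyclic-increase : (t : Fin 3 → Fin N) → ∃ λ i → ¬ t i ≺ t (next i)
    no-cyclic-increase t with compare (t zero) (t (suc zero)) | compare (t (suc zero)) (t (suc (suc zero))) | compare (t (suc (suc zero))) (t zero)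
    ... | tri≈ ¬lt _ _ | _ | _ = zero , ¬lt
    ... | tri> ¬lt _ _ | _ | _ = zero , ¬lt
    ... | tri< _ _ _ | tri≈ ¬lt _ _ | _ = suc zero , ¬lt
    ... | tri< _ _ _ | tri> ¬lt _ _ | _ = suc zero , ¬lt
    ... | tri< _ _ _ | tri< _ _ _ | tri≈ ¬lt _ _ = suc (suc zero) , ¬lt
    ... | tri< _ _ _ | tri< _ _ _ | tri> ¬lt _ _ = suc (suc zero) , ¬lt
    ... | tri< a _ _ | tri< b _ _ | tri< c _ _ = ⊥-elim (≺-irrefl refl (≺-trans a (≺-trans b c)))

    abstract
      winner : ∃ λ i → ¬ ι i (threshold i) ≺ ι (next i) (threshold (next i))
      winner = no-cyclic-increase (λ i → ι i (threshold i))

    i₀ : Fin 3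
    i₀ = proj₁ winner

    open Part i₀ using (slice; slice⇒; count-slice) renaming (rank to rankʸ; rank-reflects to rankʸ-reflects; rank-mono to rankʸ-mono)
    open Part (next i₀) using (below; count-below) renaming (rank to rankˣ; rank-reflects to rankˣ-reflects)

    -- The vertex `c` precedes the threshold of its copy, which is not above the threshold of copy
    -- `i₀`, which in turn is not above `a`.
    below-threshold : ∀ {c a} → rankˣ c < j₀ → j₀ ≤ rankʸ a → ι (next i₀) c ≺ ι i₀ a
    below-threshold {c} {a} c< ≤a = ≺-≤-trans
      (≺-≤-trans (rankˣ-reflects (ℕₚ.<-≤-trans c< (ℕₚ.≤-reflexive (sym (rank-threshold (next i₀)))))) (proj₂ winner))
      (λ lt → ℕₚ.<-irrefl refl (ℕₚ.<-≤-trans (ℕₚ.<-≤-trans (rankʸ-mono lt) (ℕₚ.≤-reflexive (rank-threshold i₀))) ≤a))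

    base : ℕ → ℕ
    base j = j₀ + j * σ

    base+σ : ∀ j → base j + σ ≡ base (suc j)
    base+σ j = trans (ℕₚ.+-assoc j₀ (j * σ) σ) (cong (j₀ +_) (ℕₚ.+-comm (j * σ) σ))

    base-mono : ∀ {j k} → j ≤ k → base j ≤ base k
    base-mono le = ℕₚ.+-monoʳ-≤ j₀ (ℕₚ.*-monoˡ-≤ σ le)

    level : ℕ → Region
    level j = slice (base j) σ

    level-size : ∀ j → j < n → ∣ level j ∣ᵣ ≡ σ
    level-size j j<n = count-slice (base j) σ (ℕₚ.≤-trans (ℕₚ.≤-reflexive (base+σ j)) (ℕₚ.≤-trans (base-mono j<n) (ℕₚ.≤-reflexive j₀+nσ≡q)))

    level-rank : ∀ {j a} → level j a ≡ true → base j ≤ rankʸ a × rankʸ a < base (suc j)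
    level-rank {j} {a} e = let (lo , hi) = slice⇒ (base j) σ a e in lo , ℕₚ.<-≤-trans hi (ℕₚ.≤-reflexive (base+σ j))

    level-< : ∀ {j k a b} → j < k → level j a ≡ true → level k b ≡ true → rankʸ a < rankʸ b
    level-< {j} {k} j<k a∈ b∈ = ℕₚ.<-≤-trans (proj₂ (level-rank {j} a∈)) (ℕₚ.≤-trans (base-mono j<k) (proj₁ (level-rank {k} b∈)))

    level-≥ : ∀ {j a} → level j a ≡ true → j₀ ≤ rankʸ a
    level-≥ {j} a∈ = ℕₚ.≤-trans (ℕₚ.m≤m+n j₀ (j * σ)) (proj₁ (level-rank {j} a∈))

    -- Slices are shifted by one, because level 0 is reserved for y 1.
    Ss : Vec Region n′
    Ss = tabulate (λ j → level (suc (toℕ j)))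

    lookup-Ss : ∀ j a → lookup Ss j a ≡ level (suc (toℕ j)) a
    lookup-Ss j a = cong (λ S → S a) (lookup∘tabulate (λ j → level (suc (toℕ j))) j)

    lowest forbidden : Region
    lowest = below σ
    forbidden c = below σ c ∨ not (below j₀ c)

    forbidden-size : ∣ forbidden ∣ᵣ ≤ suc n * σ
    forbidden-size = begin
      ∣ forbidden ∣ᵣ                                      ≤⟨ ∑-mono Vs (λ c → ⟦∨⟧ (below σ c) (not (below j₀ c))) ⟩
      ∑ Vs (λ c → ⟦ below σ c ⟧ + ⟦ not (below j₀ c) ⟧)    ≡⟨ ∑-+ Vs ⟩
      ∣ lowest ∣ᵣ + ∣ not ∘ below j₀ ∣ᵣ                    ≡⟨ cong₂ _+_ (count-below σ (ℕₚ.≤-trans σ≤j₀ (ℕₚ.<⇒≤ j₀<q))) top ⟩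
      σ + n * σ                                           ∎
      where
      open ℕₚ.≤-Reasoning
      ⟦∨⟧ : ∀ a b → ⟦ a ∨ b ⟧ ≤ ⟦ a ⟧ + ⟦ b ⟧
      ⟦∨⟧ true  b = s≤s z≤n
      ⟦∨⟧ false b = ℕₚ.≤-refl
      top : ∣ not ∘ below j₀ ∣ᵣ ≡ n * σ
      top = ℕₚ.+-cancelˡ-≡ j₀ _ (n * σ) (begin-equality
        j₀ + ∣ not ∘ below j₀ ∣ᵣ              ≡⟨ cong (_+ ∣ not ∘ below j₀ ∣ᵣ) (count-below j₀ (ℕₚ.<⇒≤ j₀<q)) ⟨
        ∣ below j₀ ∣ᵣ + ∣ not ∘ below j₀ ∣ᵣ   ≡⟨ count-split finiteV (λ _ → true) (below j₀) ⟨
        count finiteV (λ _ → true)            ≡⟨ Finite.∑-1 finiteV ⟩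
        q                                     ≡⟨ j₀+nσ≡q ⟨
        j₀ + n * σ                            ∎)

    allowed : ∀ c → forbidden c ≡ false → σ ≤ rankˣ c × rankˣ c < j₀
    allowed c eq = go (rankˣ c ℕₚ.<? σ) (rankˣ c ℕₚ.<? j₀) eq
      where
      go : (d : Dec (rankˣ c < σ)) (d′ : Dec (rankˣ c < j₀)) → does d ∨ not (does d′) ≡ false → σ ≤ rankˣ c × rankˣ c < j₀
      go (no ≮σ) (yes <j₀) _ = ℕₚ.≮⇒≥ ≮σ , <j₀

    module _ (I′ : Subset n′) (∣I′∣ : ∣ I′ ∣ ≡ 1 + r) where

      abstract
        selected : Selected r Ss (level 0) forbidden lowest I′
        selected = selection (ℕₚ.n≤1+n n′) Ss (level 0) forbidden lowest I′
          (λ j → trans (count-cong finiteV (lookup-Ss j)) (level-size (suc (toℕ j)) (s≤s (Finₚ.toℕ<n j))))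
          (level-size 0 (s≤s z≤n))
          (λ j a a∈₀ a∈ⱼ → ℕₚ.<-irrefl refl (level-< {0} {suc (toℕ j)} (s≤s z≤n) a∈₀ (trans (sym (lookup-Ss j a)) a∈ⱼ)))
          forbidden-size
          (ℕₚ.≤-reflexive (sym (count-below σ (ℕₚ.≤-trans σ≤j₀ (ℕₚ.<⇒≤ j₀<q)))))
          ∣I′∣

      open Selected selected

      abstract
        first : Σ V λ a → level 0 a ≡ true × Σ V λ c → Link (suc r) (a ∷ restrict I′ point) c × lowest c ≡ true
        first = blocked≡0⇒link r (level 0) lowest (restrict I′ point) unblocked

      a₁ c₁ : V
      a₁ = proj₁ first
      c₁ = proj₁ (proj₂ (proj₂ first))

      apexOf : Subset n′ → V
      apexOf J = apex r (restrict J point)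

      -- Among the sets containing 1 only `I` belongs to Ω, so a single value serves for all of
      -- them.
      x : Subset n → Fin N
      x (true  ∷ _) = ι (next i₀) c₁
      x (false ∷ J) = ι (next i₀) (apexOf J)

      points : Vec V n
      points = a₁ ∷ point

      y : Fin n → Fin N
      y j = ι i₀ (lookup points j)

      y-level : ∀ j → level (toℕ j) (lookup points j) ≡ true
      y-level zero    = proj₁ (proj₂ first)
      y-level (suc j) = trans (sym (lookup-Ss j (lookup point j))) (within j)

      c₁-rank : rankˣ c₁ < σ
      c₁-rank = does-true (rankˣ c₁ ℕₚ.<? σ) (proj₂ (proj₂ (proj₂ (proj₂ first))))

      linked : ∀ J → ∣ J ∣ ≡ 2 + r → Link (suc r) (restrict J point) (apexOf J) × σ ≤ rankˣ (apexOf J) × rankˣ (apexOf J) < j₀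
      linked J ∣J∣ = let (L , ok) = bad≡0⇒link r forbidden (restrict J point) (good J ∣J∣) in L , allowed _ ok

      data Index : Subset n → Set where
        isI   : Index (true ∷ I′)
        other : ∀ J → ∣ J ∣ ≡ 2 + r → Index (false ∷ J)

      index : ∀ J → InΩ (3 + r) (true ∷ I′) J → Index J
      index (true  ∷ J) (inj₁ (_ , ¬one)) = ⊥-elim (¬one refl)
      index (false ∷ J) (inj₁ (∣J∣ , _))  = other J ∣J∣
      index _           (inj₂ refl)       = isI

      contains : ContainsG H _≺_ n (true ∷ I′)
      contains = x , y ,
        (λ J J′ JΩ J′Ω → x-injective (index J JΩ) (index J′ J′Ω)) ,
        y-injective ,
        (λ J j JΩ → x≢y j (index J JΩ)) ,
        (λ J JΩ → is-edge (index J JΩ)) ,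
        (λ J JΩ → x-least (index J JΩ)) ,
        (λ J j JΩ → x≺y j (index J JΩ)) ,
        y-mono
        where
        y-mono : ∀ i j → i Fin.< j → y i ≺ y j
        y-mono i j i<j = rankʸ-reflects (level-< {toℕ i} {toℕ j} i<j (y-level i) (y-level j))

        y-injective : ∀ i j → y i ≡ y j → i ≡ j
        y-injective i j eq with Finₚ.<-cmp i j
        ... | tri< i<j _ _ = ⊥-elim (≺-irrefl eq (y-mono i j i<j))
        ... | tri≈ _ i≡j _ = i≡j
        ... | tri> _ _ j<i = ⊥-elim (≺-irrefl (sym eq) (y-mono j i j<i))

        x-injective : ∀ {J J′} → Index J → Index J′ → x J ≡ x J′ → J ≡ J′
        x-injective isI isI _ = refl
        x-injective isI (other J ∣J∣) eq = ⊥-elim (ℕₚ.<-irrefl (cong rankˣ (proj₂ (ι-injective eq))) (ℕₚ.<-≤-trans c₁-rank (proj₁ (proj₂ (linked J ∣J∣)))))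
        x-injective (other J ∣J∣) isI eq = ⊥-elim (ℕₚ.<-irrefl (cong rankˣ (sym (proj₂ (ι-injective eq)))) (ℕₚ.<-≤-trans c₁-rank (proj₁ (proj₂ (linked J ∣J∣)))))
        x-injective (other J ∣J∣) (other J′ ∣J′∣) eq = cong (false ∷_) (injective J J′ ∣J∣ ∣J′∣ (proj₂ (ι-injective eq)))

        x≢y : ∀ {J} j → Index J → ¬ x J ≡ y j
        x≢y j isI         eq = i≢next i₀ (sym (proj₁ (ι-injective eq)))
        x≢y j (other _ _) eq = i≢next i₀ (sym (proj₁ (ι-injective eq)))

        is-edge : ∀ {J} → Index J → Edge H (⁅ x J ⁆ ∪ img y J)
        is-edge isI = i₀ , a₁ ∷ restrict I′ point , c₁ , proj₁ (proj₂ (proj₂ (proj₂ first))) ,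
          cong (⁅ ι (next i₀) c₁ ⁆ ∪_) (img≡fromList (ι i₀) points (true ∷ I′))
        is-edge (other J ∣J∣) = i₀ , restrict J point , apexOf J , proj₁ (linked J ∣J∣) ,
          cong (⁅ ι (next i₀) (apexOf J) ⁆ ∪_) (img≡fromList (ι i₀) points (false ∷ J))

        x-least : ∀ {J} → Index J → ¬ J ≡ true ∷ I′ → x (true ∷ I′) ≺ x J
        x-least isI           ne = ⊥-elim (ne refl)
        x-least (other J ∣J∣) ne = rankˣ-reflects (ℕₚ.<-≤-trans c₁-rank (proj₁ (proj₂ (linked J ∣J∣))))

        x≺y : ∀ {J} j → Index J → x J ≺ y j
        x≺y j isI           = below-threshold (ℕₚ.<-≤-trans c₁-rank σ≤j₀) (level-≥ {toℕ j} (y-level j))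
        x≺y j (other J ∣J∣) = below-threshold (proj₂ (proj₂ (linked J ∣J∣))) (level-≥ {toℕ j} (y-level j))

-- Choice of parameters, the number of vertices, and the theorem.

module Construction where

  open import Data.Bool using (true)
  open import Data.Empty using (⊥-elim)
  import Data.Fin as Fin
  open import Data.Fin using (Fin; suc)
  import Data.Fin.Properties as Finₚ
  open import Data.Fin.Subset using (Subset; ∣_∣)
  import Data.List as List
  open import Data.List using (List; []; _∷_)
  open import Data.List.Membership.Propositional using (_∈_)
  open import Data.List.Relation.Unary.Any as Any using (here; there)
  import Data.List.Relation.Unary.Any.Properties as Anyₚ
  import Data.Nat as ℕ
  open import Data.Nat using (ℕ; suc; _+_; _*_; _∸_; _/_; _%_; _≤_; z≤n; s≤s; _^_; NonZero)
  import Data.Nat.DivMod as DivMod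
  import Data.Nat.Properties as ℕₚ
  import Data.Nat.Solver as ℕ-Solver
  open import Data.Product using (Σ; _×_; _,_)
  open import Data.Vec using ([]; _∷_)
  open import Defs
  open import Function using (flip)
  import Relation.Binary.Construct.Flip.EqAndOrd as Flip
  open import Relation.Binary.PropositionalEquality
  open import Relation.Binary.Structures using (IsStrictTotalOrder)
  open import Relation.Nullary using (yes; no; does)
  open FiniteSums
  open BinaryFields
  open DividedDifferences
  open FourCycles
  open IncidenceGeometry
  open DiscrepancyBound
  open EdgeCounts
  open TupleCounts
  open SelectionByCounting
  open QuantitativeBounds
  open SteinerSystems
  open OrderedCopies

  module Position {A : Set} (F : Finite A) where
    open Finite F using (elems; _≟_; once)

    private
      occurs : ∀ a xs → ∑ xs (λ x → ⟦ does (x ≟ a) ⟧) ≢ 0 → a ∈ xs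
      occurs a []       ≢0 = ⊥-elim (≢0 refl)
      occurs a (x ∷ xs) ≢0 with x ≟ a
      ... | yes refl = here refl
      ... | no _     = there (occurs a xs ≢0)

      ∈-elems : ∀ a → a ∈ elems
      ∈-elems a = occurs a elems (λ eq → 1≢0 (trans (sym (once a)) eq))
        where
        1≢0 : 1 ≢ 0
        1≢0 ()

    position : A → Fin (size F)
    position a = Any.index (∈-elems a)

    position-injective : ∀ {a b} → position a ≡ position b → a ≡ b
    position-injective {a} {b} eq = trans (Anyₚ.lookup-index (∈-elems a))
      (trans (cong (List.lookup elems) eq) (sym (Anyₚ.lookup-index (∈-elems b))))

  cube : ℕ → ℕ
  cube x = x * (x * x)

  module VertexBound (κ n d : ℕ) where
    open ℕₚ.≤-Reasoning
    open ℕ-Solver.+-*-Solver using (solve; _:=_; _:+_; _:*_; con)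

    -- Here `d` will be k, because `big₁` asks `G` to exceed a multiple of n to the power k - 1
    -- times n + 1. `L` meets `L-big₂` with equality, `X` is the least field order allowed by
    -- `large`, and `K₀` is the part of `X` that does not depend on n.
    p G L X K₀ : ℕ
    p = n ^ d
    G = κ * p
    L = 8 * cube G * 32
    X = 3 * L ^ 4
    K₀ = 3 * (8 * cube κ * 32) ^ 4

    abstract
      3*^4 : ∀ a b → 3 * (a * b) ^ 4 ≡ 3 * a ^ 4 * b ^ 4
      3*^4 = solve 2 (λ a b → con 3 :* ((a :* b) :* ((a :* b) :* ((a :* b) :* ((a :* b) :* con 1)))) :=
        con 3 :* (a :* (a :* (a :* (a :* con 1)))) :* (b :* (b :* (b :* (b :* con 1))))) refl

      L≡ : L ≡ 8 * cube κ * 32 * cube p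
      L≡ = solve 2 (λ κ p → con 8 :* ((κ :* p) :* ((κ :* p) :* (κ :* p))) :* con 32 :=
        con 8 :* (κ :* (κ :* κ)) :* con 32 :* (p :* (p :* p))) refl κ p

      ^-square² : ∀ P → (P * P) * (P * P) ≡ P ^ 4
      ^-square² = solve 1 (λ P → (P :* P) :* (P :* P) := P :* (P :* (P :* (P :* con 1)))) refl

      fourth : ∀ k P → 3 * ((k * P * (k * P)) * (k * P * (k * P))) ≡ 3 * ((k * k) * (k * k)) * ((P * P) * (P * P))
      fourth = solve 2 (λ k p → con 3 :* ((k :* p :* (k :* p)) :* (k :* p :* (k :* p))) := con 3 :* ((k :* k) :* (k :* k)) :* ((p :* p) :* (p :* p))) refl

      cube≡ : ∀ x → cube x ≡ x ^ 3
      cube≡ x = cong (x *_) (cong (x *_) (sym (ℕₚ.*-identityʳ x)))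

      X≡ : X ≡ K₀ * cube p ^ 4
      X≡ = trans (cong (λ z → 3 * z ^ 4) L≡) (3*^4 (8 * cube κ * 32) (cube p))

      power : (cube p ^ 4) ^ 4 ≡ n ^ (d * 3 * 4 * 4)
      power = trans (cong (λ z → (z ^ 4) ^ 4) (trans (cube≡ p) (ℕₚ.^-*-assoc n d 3)))
        (trans (cong (_^ 4) (ℕₚ.^-*-assoc n (d * 3) 4)) (ℕₚ.^-*-assoc n (d * 3 * 4) 4))

      -- The field order may be as large as X², so there are up to 3 X⁴ vertices. This is a constant
      -- times the 48th power of `p`, and for large n the constant is at most one further factor n.
      vertex-bound : ∀ s → s ≤ X * X → 3 * ((K₀ * K₀) * (K₀ * K₀)) ≤ n → 3 * (s * s) ≤ n ^ suc (d * 3 * 4 * 4)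
      vertex-bound s s≤ n₁≤n = begin
        3 * (s * s)                            ≤⟨ ℕₚ.*-monoʳ-≤ 3 (ℕₚ.*-mono-≤ s≤ s≤) ⟩
        3 * ((X * X) * (X * X))                ≡⟨ cong (λ z → 3 * ((z * z) * (z * z))) X≡ ⟩
        3 * ((K₀ * P * (K₀ * P)) * (K₀ * P * (K₀ * P))) ≡⟨ fourth K₀ P ⟩
        3 * ((K₀ * K₀) * (K₀ * K₀)) * ((P * P) * (P * P)) ≤⟨ ℕₚ.*-monoˡ-≤ _ n₁≤n ⟩
        n * ((P * P) * (P * P))                ≡⟨ cong (n *_) (trans (^-square² P) power) ⟩
        n * n ^ (d * 3 * 4 * 4)                ∎
        where
        P : ℕ
        P = cube p ^ 4

  module Parameters (r κ n : ℕ) (1≤n : 1 ≤ n) (256≤κ : 256 ≤ κ) (κ-big₂ : 8 * (4 + bad-constant r) ≤ κ)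
                    (κ-big₃ : 2 * r + 4 ≤ κ) (κ-big₄ : 8 * blocked-constant r ≤ κ) where
    open ℕₚ.≤-Reasoning
    open ℕ-Solver.+-*-Solver using (solve; _:=_; _:+_; _:*_; con)
    open VertexBound κ n (3 + r)

    private
      n≢0 : NonZero n
      n≢0 = ℕ.>-nonZero 1≤n
      κ≢0 : NonZero κ
      κ≢0 = ℕ.>-nonZero (ℕₚ.≤-trans (s≤s z≤n) 256≤κ)
      p≢0 : NonZero p
      p≢0 = ℕₚ.m^n≢0 n (3 + r) {{n≢0}}
      G≢0 : NonZero G
      G≢0 = ℕₚ.m*n≢0 κ p {{κ≢0}} {{p≢0}}
      GG≢0 : NonZero (G * G)
      GG≢0 = ℕₚ.m*n≢0 G G {{G≢0}} {{G≢0}}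
      L≢0 : NonZero L
      L≢0 = ℕₚ.m*n≢0 (8 * cube G) 32 {{ℕₚ.m*n≢0 8 (cube G) {{_}} {{ℕₚ.m*n≢0 G (G * G) {{G≢0}} {{GG≢0}}}}}}

      L≤X : L ≤ X
      L≤X = ℕₚ.≤-trans (ℕₚ.m≤m*n L (L ^ 3) {{ℕₚ.m^n≢0 L 3 {{L≢0}}}}) (ℕₚ.m≤n*m (L ^ 4) 3)

      2GG≤L : 2 * (G * G) ≤ L
      2GG≤L = begin
        2 * (G * G)        ≤⟨ ℕₚ.*-mono-≤ {2} {8} (s≤s (s≤s z≤n)) (ℕₚ.m≤n*m (G * G) G {{G≢0}}) ⟩
        8 * cube G         ≤⟨ ℕₚ.m≤m*n (8 * cube G) 32 ⟩
        L                  ∎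

      N : ℕ
      N = n ^ (2 + r)

      N≤p : N ≤ p
      N≤p = ℕₚ.m≤n*m N n {{n≢0}}

      κ≤G : κ ≤ G
      κ≤G = ℕₚ.m≤m*n κ p {{p≢0}}

    2≤X : 2 ≤ X
    2≤X = ℕₚ.≤-trans (ℕₚ.m≤m*n 2 (G * G) {{GG≢0}}) (ℕₚ.≤-trans 2GG≤L L≤X)

    module _ (F : BinaryField) (2≤s : 2 ≤ order F) (X≤s : X ≤ order F) where
      open Discrepancy F using (q; q≡s*s)

      private
        s : ℕ
        s = order F

        G≤q : G ≤ q
        G≤q = begin
          G         ≤⟨ ℕₚ.m≤m*n G G {{G≢0}} ⟩
          G * G     ≤⟨ ℕₚ.m≤n*m (G * G) 2 ⟩
          2 * (G * G) ≤⟨ 2GG≤L ⟩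
          L         ≤⟨ L≤X ⟩
          X         ≤⟨ X≤s ⟩
          s         ≤⟨ ℕₚ.m≤m*n s s {{ℕ.>-nonZero (ℕₚ.≤-trans (s≤s z≤n) 2≤s)}} ⟩
          s * s     ≡⟨ q≡s*s ⟨
          q         ∎

      -- Since G ≤ q, the quotient is at least 1, and rounding down loses at most a factor 2, as
      -- `q≤2Gσ` requires.
      σ : ℕ
      σ = (q / G) {{G≢0}}

      private
        1≤σ : 1 ≤ σ
        1≤σ = ≤-/ G 1 q {{G≢0}} (ℕₚ.≤-trans (ℕₚ.≤-reflexive (ℕₚ.*-identityʳ G)) G≤q)

      abstract
        conditions : Quantitative.Conditions F 2≤s r n G L σ
        conditions = record
          { 1≤n = 1≤n
          ; big₁ = begin
              128 * (N * suc n)     ≤⟨ ℕₚ.*-monoʳ-≤ 128 (ℕₚ.*-monoʳ-≤ N (ℕₚ.+-monoˡ-≤ n 1≤n)) ⟩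
              128 * (N * (n + n))   ≡⟨ solve 2 (λ N n → con 128 :* (N :* (n :+ n)) := con 256 :* (n :* N)) refl N n ⟩
              256 * p               ≤⟨ ℕₚ.*-monoˡ-≤ p 256≤κ ⟩
              G                     ∎
          ; big₂ = begin
              8 * (N * (4 + bad-constant r))  ≡⟨ solve 2 (λ N c → con 8 :* (N :* c) := con 8 :* c :* N) refl N (4 + bad-constant r) ⟩
              8 * (4 + bad-constant r) * N    ≤⟨ ℕₚ.*-mono-≤ κ-big₂ N≤p ⟩
              G                               ∎
          ; big₃ = ℕₚ.≤-trans κ-big₃ κ≤G
          ; big₄ = ℕₚ.≤-trans κ-big₄ κ≤G
          ; Gσ≤q = ℕₚ.≤-trans (ℕₚ.≤-reflexive (ℕₚ.*-comm G σ)) (DivMod.m/n*n≤m q G {{G≢0}})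
          ; q≤2Gσ = begin
              q                       ≡⟨ DivMod.m≡m%n+[m/n]*n q G {{G≢0}} ⟩
              (q % G) {{G≢0}} + σ * G ≤⟨ ℕₚ.+-monoˡ-≤ (σ * G) (ℕₚ.<⇒≤ (DivMod.m%n<n q G {{G≢0}})) ⟩
              G + σ * G               ≤⟨ ℕₚ.+-monoˡ-≤ (σ * G) (ℕₚ.m≤n*m G σ {{ℕ.>-nonZero 1≤σ}}) ⟩
              σ * G + σ * G           ≡⟨ solve 2 (λ σ g → σ :* g :+ σ :* g := con 2 :* (g :* σ)) refl σ G ⟩
              2 * (G * σ)             ∎
          ; 2GG≤s = ℕₚ.≤-trans 2GG≤L (ℕₚ.≤-trans L≤X X≤s)
          ; L-big₁ = begin
              4 * (G * G) * (64 * N)   ≤⟨ ℕₚ.*-monoʳ-≤ (4 * (G * G)) (ℕₚ.*-monoʳ-≤ 64 (ℕₚ.≤-trans N≤p (ℕₚ.m≤n*m p κ {{κ≢0}}))) ⟩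
              4 * (G * G) * (64 * G)   ≡⟨ solve 1 (λ g → con 4 :* (g :* g) :* (con 64 :* g) := con 8 :* (g :* (g :* g)) :* con 32) refl G ⟩
              L                        ∎
          ; L-big₂ = ℕₚ.≤-refl
          ; large = X≤s
          }

  OrderedRamsey : (k n N : ℕ) → Subset n → Set₁
  OrderedRamsey k n N I = Σ (KGraph k N) λ H →
    PartialSteiner (k ∸ 1) H ×
    (∀ (_≺_ : Fin N → Fin N → Set) → IsStrictTotalOrder _≡_ _≺_ → ContainsG H _≺_ n I) ×
    (∀ (_≺_ : Fin N → Fin N → Set) → IsStrictTotalOrder _≡_ _≺_ → ContainsG H (flip _≺_) n I)

  -- The reversed order is again a strict total order, so the forward statement for the same H gives
  -- both conclusions.
  ordered-ramsey : (F : BinaryField) (2≤s : 2 ≤ order F) (r n G L σ N : ℕ) → Quantitative.Conditions F 2≤s r n G L σ →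
    3 * Discrepancy.q F ≤ N → (I : Subset n) → ∣ I ∣ ≡ 2 + r → HasOne I → OrderedRamsey (3 + r) n N I
  ordered-ramsey F 2≤s r (suc n′) G L σ N C 3q≤N (b ∷ I) ∣I∣ refl =
    H , steiner , forward , λ _≺_ sto → forward (flip _≺_) (Flip.isStrictTotalOrder sto)
    where
    open Interpolation F using (V)
    open Position (Incidence.finiteV F)
    ι : Fin 3 → V → Fin N
    -- The three copies fill the first 3 q vertices; any further ones are isolated.
    ι i a = Fin.inject≤ (Fin.combine i (position a)) 3q≤N
    ι-injective : ∀ {i j a b} → ι i a ≡ ι j b → i ≡ j × a ≡ b
    ι-injective {i} {j} {a} {b} eq =
      let (i≡j , pos) = Finₚ.combine-injective i (position a) j (position b) (Finₚ.inject≤-injective 3q≤N 3q≤N _ _ eq)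
      in i≡j , position-injective pos
    open Hypergraph F r N ι ι-injective
    forward : (_≺_ : Fin N → Fin N → Set) → IsStrictTotalOrder _≡_ _≺_ → ContainsG H _≺_ (suc n′) (true ∷ I)
    forward _≺_ sto = Embedding.contains F 2≤s r n′ G L σ C N ι ι-injective _≺_ sto I (ℕₚ.suc-injective ∣I∣)

  abstract
    -- Here 256 is twice the 128 of `big₁`, because suc n is replaced by n + n.
    constant : ∀ r → Σ ℕ λ κ → 256 ≤ κ × 8 * (4 + bad-constant r) ≤ κ × 2 * r + 4 ≤ κ × 8 * blocked-constant r ≤ κ
    constant r = 256 + (b₂ + (b₃ + b₄)) ,
      ℕₚ.m≤m+n 256 _ ,
      ℕₚ.≤-trans (ℕₚ.m≤m+n b₂ _) (ℕₚ.m≤n+m _ 256) ,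
      ℕₚ.≤-trans (ℕₚ.m≤m+n b₃ _) (ℕₚ.≤-trans (ℕₚ.m≤n+m _ b₂) (ℕₚ.m≤n+m _ 256)) ,
      ℕₚ.≤-trans (ℕₚ.m≤n+m b₄ b₃) (ℕₚ.≤-trans (ℕₚ.m≤n+m _ b₂) (ℕₚ.m≤n+m _ 256))
      where
      b₂ b₃ b₄ : ℕ
      b₂ = 8 * (4 + bad-constant r)
      b₃ = 2 * r + 4
      b₄ = 8 * blocked-constant r

open import Defs
open import Data.Nat using (ℕ; _≤_; _∸_; _^_)
open import Data.Fin using (Fin)
open import Data.Fin.Subset using (Subset; ∣_∣)
open import Data.Product using (Σ; _×_)
open import Function using (flip)
open import Relation.Binary.PropositionalEquality using (_≡_)
open import Relation.Binary.Structures using (IsStrictTotalOrder)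
import Data.Nat.Properties as ℕₚ
open import Data.Nat using (suc; z≤n; s≤s; _+_; _*_)
open import Data.Product using (_,_; proj₁; proj₂)
open import Relation.Binary.PropositionalEquality using (cong)
open BinaryFields using (order; field-of-order-between)
open TupleCounts using (bad-constant; blocked-constant)
open DiscrepancyBound using (module Discrepancy)
open Construction

theorem3p2 : ∀ (k : ℕ) → 3 ≤ k →
    Σ ℕ λ n₁ → Σ ℕ λ C →
    ∀ (n : ℕ) → n₁ ≤ n →
    ∀ (I : Subset n) → ∣ I ∣ ≡ k ∸ 1 → HasOne I →
    Σ (KGraph k (n ^ C)) λ H →
    PartialSteiner (k ∸ 1) H ×
    (∀ (_≺_ : Fin (n ^ C) → Fin (n ^ C) → Set) →
    IsStrictTotalOrder _≡_ _≺_ → ContainsG H _≺_ n I) ×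
    (∀ (_≺_ : Fin (n ^ C) → Fin (n ^ C) → Set) →
    IsStrictTotalOrder _≡_ _≺_ → ContainsG H (flip _≺_) n I)
-- The additional successor in the threshold ensures n ≥ 1. In the exponent, 3 + r is the power of n
-- in `G`, the product with 3 * 4 * 4 is the growth of the vertex count, and the successor absorbs
-- the constant.
theorem3p2 (suc (suc (suc r))) (s≤s (s≤s (s≤s z≤n))) = suc n₁ , suc ((3 + r) * 3 * 4 * 4) , λ n n₁<n I ∣I∣ one →
  let 1≤n = ℕₚ.≤-trans (s≤s z≤n) n₁<n
      open VertexBound κ n (3 + r) using (X; G; L; vertex-bound)
      open Parameters r κ n 1≤n κ-big₁ κ-big₂ κ-big₃ κ-big₄
      (F , 2≤s , X≤s , s≤X²) = field-of-order-between X 2≤X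
  in ordered-ramsey F 2≤s r n G L (σ F 2≤s X≤s) (n ^ suc ((3 + r) * 3 * 4 * 4)) (conditions F 2≤s X≤s)
       (ℕₚ.≤-trans (ℕₚ.≤-reflexive (cong (3 *_) (Discrepancy.q≡s*s F))) (vertex-bound (order F) s≤X² (ℕₚ.<⇒≤ n₁<n))) I ∣I∣ one
  where
  κ : ℕ
  κ = proj₁ (constant r)
  κ-big₁ : 256 ≤ κ
  κ-big₁ = proj₁ (proj₂ (constant r))
  κ-big₂ : 8 * (4 + bad-constant r) ≤ κ
  κ-big₂ = proj₁ (proj₂ (proj₂ (constant r)))
  κ-big₃ : 2 * r + 4 ≤ κ
  κ-big₃ = proj₁ (proj₂ (proj₂ (proj₂ (constant r))))
  κ-big₄ : 8 * blocked-constant r ≤ κ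
  κ-big₄ = proj₂ (proj₂ (proj₂ (proj₂ (constant r))))
  n₁ : ℕ
  -- `K₀` depends on `κ` only, so the zeros are dummy arguments.
  n₁ = let K₀ = VertexBound.K₀ κ 0 0 in 3 * ((K₀ * K₀) * (K₀ * K₀))
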